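{- Let $n\geq 4$ be an integer, let $G=\mathrm{Sym}(n)$ be the symmetric group on $n$ letters, and let $Z_n$ be the set of all $n$-cycles in $G$. Let $\Gamma_n=\mathrm{Cay}(G,Z_n)$. Then $\Gamma_n$ is an integral hyperenergetic graph, its energy is $\mathcal{E}(\Gamma_n)=2^{n-1}(n-1)!$, and its nullity is $\eta(\Gamma_n)=n!-\binom{2n-2}{n-1}$.
   Context: For a finite group $G$ and an inverse-closed subset $S\subseteq G$ with $1\notin S$, the Cayley graph $\mathrm{Cay}(G,S)$ has vertex set $G$, with $u,v$ adjacent iff $v=au$ for some $a\in S$. The eigenvalues of a simple graph are the eigenvalues of its adjacency matrix. A graph is integral if all its eigenvalues are integers. The energy $\mathcal{E}(\Gamma)$ of a graph $\Gamma$ is the sum of the absolute values of its eigenvalues (with multiplicity). A simple graph $\Gamma$ on $N$ vertices is hyperenergetic if $\mathcal{E}(\Gamma)>2N-2$. The nullity $\eta(\Gamma)$ is the multiplicity of $0$ as an eigenvalue of $\Gamma$. -}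

module Defs where

open import Algebra.Bundles using (CommutativeRing; Group)
open import Data.Bool.Base using (if_then_else_)
open import Data.Fin.Base using (Fin; zero; suc; toℕ; opposite; combine; remQuot; punchIn)
import Data.Fin.Permutation as Perm
open Perm using (Permutation′; _⟨$⟩ʳ_; _⟨$⟩ˡ_; _∘ₚ_; insert; remove)
import Data.Fin.Properties as Fin
open import Data.Integer.Base as ℤ using (ℤ; +_)
open import Data.List.Base using (List; foldr)
open import Data.List.Relation.Unary.All using (All)
open import Data.List.Relation.Unary.AllPairs using (AllPairs)
open import Data.List.Relation.Unary.Any using (Any)
open import Data.Nat.Base as ℕ using (ℕ; zero; suc; _!; z≤n; s≤s)
open import Data.Nat.DivMod using (_%_; _mod_; n%n≡0; m<n⇒m%n≡m)
import Data.Nat.Properties as ℕ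
open import Data.Product.Base using (∃; _×_; _,_; proj₁; proj₂)
open import Data.Rational.Base as ℚ using (ℚ; 0ℚ; 1ℚ; ½)
import Data.Rational.Properties as ℚ
open import Data.Rational.Solver using (module +-*-Solver)
open import Data.Sum.Base using (_⊎_; inj₁; inj₂)
open import Data.Vec.Functional using (Vector)
open import Function.Bundles using (Inverse)
open import Level using (0ℓ)
open import Relation.Binary.Core using (Rel)
open import Relation.Binary.Definitions using (Decidable; Symmetric; _Respects_; _Respects₂_)
open import Relation.Binary.Bundles using (Setoid)
open import Relation.Binary.PropositionalEquality as ≡ using (_≡_; refl; cong; cong₂; subst)
open import Relation.Nullary.Decidable using (does; map′)
open import Relation.Nullary.Negation using (¬_; contradiction)
import Relation.Unary as U

Eventually : (ℕ → Set) → Set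
Eventually P = ∃ λ N → ∀ n → N ℕ.≤ n → P n

-- Cauchy sequences of rationals, carrying their modulus of convergence;
-- two of them are the same real number when their difference tends to 0.
record ℝ : Set where
  field
    seq    : ℕ → ℚ
    cauchy : ∀ ε → 0ℚ ℚ.< ε →
             ∃ λ N → ∀ m n → N ℕ.≤ m → N ℕ.≤ n → ℚ.∣ seq m ℚ.- seq n ∣ ℚ.< ε

open ℝ public

infix 4 _≈_ _<_

_≈_ : Rel ℝ 0ℓ
x ≈ y = ∀ ε → 0ℚ ℚ.< ε → Eventually λ n → ℚ.∣ seq x n ℚ.- seq y n ∣ ℚ.< ε

_<_ : Rel ℝ 0ℓ
x < y = ∃ λ ε → 0ℚ ℚ.< ε × Eventually λ n → seq x n ℚ.+ ε ℚ.≤ seq y n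

private
  open +-*-Solver using (solve; _:=_; _:+_; _:-_; _:*_; :-_)

  dist-sym : ∀ a b → ℚ.∣ a ℚ.- b ∣ ≡ ℚ.∣ b ℚ.- a ∣
  dist-sym a b = ≡.trans
    (cong ℚ.∣_∣ (solve 2 (λ a b → a :- b := :- (b :- a)) refl a b))
    (ℚ.∣-p∣≡∣p∣ (b ℚ.- a))

  dist-refl : ∀ a → ℚ.∣ a ℚ.- a ∣ ≡ 0ℚ
  dist-refl a = cong ℚ.∣_∣ (ℚ.+-inverseʳ a)

  dist-triangle : ∀ a b c → ℚ.∣ a ℚ.- c ∣ ℚ.≤ ℚ.∣ a ℚ.- b ∣ ℚ.+ ℚ.∣ b ℚ.- c ∣
  dist-triangle a b c = ℚ.≤-trans
    (ℚ.≤-reflexive (cong ℚ.∣_∣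
      (solve 3 (λ a b c → a :- c := (a :- b) :+ (b :- c)) refl a b c)))
    (ℚ.∣p+q∣≤∣p∣+∣q∣ (a ℚ.- b) (b ℚ.- c))

  dist-+ : ∀ a b c d → ℚ.∣ (a ℚ.+ b) ℚ.- (c ℚ.+ d) ∣ ℚ.≤ ℚ.∣ a ℚ.- c ∣ ℚ.+ ℚ.∣ b ℚ.- d ∣
  dist-+ a b c d = ℚ.≤-trans
    (ℚ.≤-reflexive (cong ℚ.∣_∣
      (solve 4 (λ a b c d → (a :+ b) :- (c :+ d) := (a :- c) :+ (b :- d)) refl a b c d)))
    (ℚ.∣p+q∣≤∣p∣+∣q∣ (a ℚ.- c) (b ℚ.- d))

  dist-neg : ∀ a b → ℚ.∣ ℚ.- a ℚ.- ℚ.- b ∣ ≡ ℚ.∣ a ℚ.- b ∣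
  dist-neg a b = ≡.trans
    (cong ℚ.∣_∣ (solve 2 (λ a b → :- a :- :- b := :- (a :- b)) refl a b))
    (ℚ.∣-p∣≡∣p∣ (a ℚ.- b))

  ∣a∣-∣b∣≤ : ∀ a b → ℚ.∣ a ∣ ℚ.- ℚ.∣ b ∣ ℚ.≤ ℚ.∣ a ℚ.- b ∣
  ∣a∣-∣b∣≤ a b = begin
    ℚ.∣ a ∣ ℚ.- ℚ.∣ b ∣
      ≡⟨ cong (λ z → ℚ.∣ z ∣ ℚ.- ℚ.∣ b ∣) (solve 2 (λ a b → a := (a :- b) :+ b) refl a b) ⟩
    ℚ.∣ (a ℚ.- b) ℚ.+ b ∣ ℚ.- ℚ.∣ b ∣
      ≤⟨ ℚ.+-monoˡ-≤ (ℚ.- ℚ.∣ b ∣) (ℚ.∣p+q∣≤∣p∣+∣q∣ (a ℚ.- b) b) ⟩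
    (ℚ.∣ a ℚ.- b ∣ ℚ.+ ℚ.∣ b ∣) ℚ.- ℚ.∣ b ∣
      ≡⟨ solve 2 (λ x y → (x :+ y) :- y := x) refl ℚ.∣ a ℚ.- b ∣ ℚ.∣ b ∣ ⟩
    ℚ.∣ a ℚ.- b ∣ ∎
    where open ℚ.≤-Reasoning

  dist-abs : ∀ a b → ℚ.∣ ℚ.∣ a ∣ ℚ.- ℚ.∣ b ∣ ∣ ℚ.≤ ℚ.∣ a ℚ.- b ∣
  dist-abs a b with ℚ.∣p∣≡p∨∣p∣≡-p (ℚ.∣ a ∣ ℚ.- ℚ.∣ b ∣)
  ... | inj₁ eq = ℚ.≤-trans (ℚ.≤-reflexive eq) (∣a∣-∣b∣≤ a b)
  ... | inj₂ eq = begin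
    ℚ.∣ ℚ.∣ a ∣ ℚ.- ℚ.∣ b ∣ ∣  ≡⟨ eq ⟩
    ℚ.- (ℚ.∣ a ∣ ℚ.- ℚ.∣ b ∣)  ≡⟨ solve 2 (λ x y → :- (x :- y) := y :- x) refl ℚ.∣ a ∣ ℚ.∣ b ∣ ⟩
    ℚ.∣ b ∣ ℚ.- ℚ.∣ a ∣        ≤⟨ ∣a∣-∣b∣≤ b a ⟩
    ℚ.∣ b ℚ.- a ∣              ≡⟨ dist-sym b a ⟩
    ℚ.∣ a ℚ.- b ∣              ∎
    where open ℚ.≤-Reasoning

  half : ∀ ε → 0ℚ ℚ.< ε → 0ℚ ℚ.< ε ℚ.* ½
  half ε ε>0 = ℚ.positive⁻¹ (ε ℚ.* ½) {{ℚ.pos*pos⇒pos ε {{ℚ.positive ε>0}} ½}}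

  half+half : ∀ ε → ε ℚ.* ½ ℚ.+ ε ℚ.* ½ ≡ ε
  half+half ε = ≡.trans (≡.sym (ℚ.*-distribˡ-+ ε ½ ½)) (ℚ.*-identityʳ ε)

  <-halves : ∀ {p q r} ε → p ℚ.≤ q ℚ.+ r → q ℚ.< ε ℚ.* ½ → r ℚ.< ε ℚ.* ½ → p ℚ.< ε
  <-halves ε p≤ q< r< = ℚ.≤-<-trans p≤ (subst (_ ℚ.<_) (half+half ε) (ℚ.+-mono-< q< r<))

  -- If ∣ a ∣ < A, ∣ d ∣ < B and a, b are δ-close to c, d, then a b is
  -- (A + B) δ-close to c d.
  product-bound : ∀ {A B δ} a b c d → 0ℚ ℚ.< A → 0ℚ ℚ.< B →
    ℚ.∣ a ∣ ℚ.< A → ℚ.∣ d ∣ ℚ.< B → ℚ.∣ a ℚ.- c ∣ ℚ.< δ → ℚ.∣ b ℚ.- d ∣ ℚ.< δ →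
    ℚ.∣ a ℚ.* b ℚ.- c ℚ.* d ∣ ℚ.< (A ℚ.+ B) ℚ.* δ
  product-bound {A} {B} {δ} a b c d A>0 B>0 a< d< ac< bd< = begin-strict
    ℚ.∣ a ℚ.* b ℚ.- c ℚ.* d ∣
      ≡⟨ cong ℚ.∣_∣ (solve 4 (λ a b c d → a :* b :- c :* d := a :* (b :- d) :+ d :* (a :- c)) refl a b c d) ⟩
    ℚ.∣ a ℚ.* (b ℚ.- d) ℚ.+ d ℚ.* (a ℚ.- c) ∣
      ≤⟨ ℚ.∣p+q∣≤∣p∣+∣q∣ (a ℚ.* (b ℚ.- d)) (d ℚ.* (a ℚ.- c)) ⟩
    ℚ.∣ a ℚ.* (b ℚ.- d) ∣ ℚ.+ ℚ.∣ d ℚ.* (a ℚ.- c) ∣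
      ≡⟨ cong₂ ℚ._+_ (ℚ.∣p*q∣≡∣p∣*∣q∣ a (b ℚ.- d)) (ℚ.∣p*q∣≡∣p∣*∣q∣ d (a ℚ.- c)) ⟩
    ℚ.∣ a ∣ ℚ.* ℚ.∣ b ℚ.- d ∣ ℚ.+ ℚ.∣ d ∣ ℚ.* ℚ.∣ a ℚ.- c ∣
      <⟨ ℚ.+-mono-< (lemma a (b ℚ.- d) A>0 a< bd<) (lemma d (a ℚ.- c) B>0 d< ac<) ⟩
    A ℚ.* δ ℚ.+ B ℚ.* δ
      ≡⟨ ℚ.*-distribʳ-+ δ A B ⟨
    (A ℚ.+ B) ℚ.* δ ∎
    where
    open ℚ.≤-Reasoning
    lemma : ∀ {A} x y → 0ℚ ℚ.< A → ℚ.∣ x ∣ ℚ.< A → ℚ.∣ y ∣ ℚ.< δ →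
            ℚ.∣ x ∣ ℚ.* ℚ.∣ y ∣ ℚ.< A ℚ.* δ
    lemma {A} x y A>0 x< y< = ℚ.≤-<-trans
      (ℚ.*-monoʳ-≤-nonNeg ℚ.∣ y ∣ {{ℚ.∣-∣-nonNeg y}} (ℚ.<⇒≤ x<))
      (ℚ.*-monoʳ-<-pos A {{ℚ.positive A>0}} y<)

  divide : ∀ C ε → 0ℚ ℚ.< C → 0ℚ ℚ.< ε → ∃ λ δ → 0ℚ ℚ.< δ × C ℚ.* δ ≡ ε
  divide C ε C>0 ε>0 = ε ℚ.* 1/C
    , ℚ.positive⁻¹ (ε ℚ.* 1/C) {{ℚ.pos*pos⇒pos ε {{ℚ.positive ε>0}} 1/C {{ℚ.1/pos⇒pos C {{pos}}}}}}
    , ≡.trans (solve 3 (λ c e i → c :* (e :* i) := e :* (c :* i)) refl C ε 1/C)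
        (≡.trans (cong (ε ℚ.*_) (ℚ.*-inverseʳ C {{nz}})) (ℚ.*-identityʳ ε))
    where
    pos : ℚ.Positive C
    pos = ℚ.positive C>0
    nz : ℚ.NonZero C
    nz = ℚ.pos⇒nonZero C {{pos}}
    1/C : ℚ
    1/C = (ℚ.1/ C) {{nz}}

  eventually₂ : ∀ {P Q R : ℕ → Set} → (∀ n → P n → Q n → R n) →
                Eventually P → Eventually Q → Eventually R
  eventually₂ f (M , p) (N , q) = M ℕ.⊔ N , λ n h →
    f n (p n (ℕ.≤-trans (ℕ.m≤m⊔n M N) h)) (q n (ℕ.≤-trans (ℕ.m≤n⊔m M N) h))

  bounded : ∀ x → ∃ λ B → 0ℚ ℚ.< B × Eventually λ n → ℚ.∣ seq x n ∣ ℚ.< B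
  bounded x with cauchy x 1ℚ (ℚ.positive⁻¹ 1ℚ)
  ... | N , close = 1ℚ ℚ.+ ℚ.∣ seq x N ∣
      , ℚ.+-mono-<-≤ (ℚ.positive⁻¹ 1ℚ) (ℚ.0≤∣p∣ (seq x N))
      , N , λ n N≤n → ℚ.≤-<-trans
          (ℚ.≤-trans
            (ℚ.≤-reflexive (cong ℚ.∣_∣ (solve 2 (λ a b → a := (a :- b) :+ b) refl (seq x n) (seq x N))))
            (ℚ.∣p+q∣≤∣p∣+∣q∣ (seq x n ℚ.- seq x N) (seq x N)))
          (ℚ.+-monoˡ-< ℚ.∣ seq x N ∣ (close n N N≤n ℕ.≤-refl))

  0<+ : ∀ {p q} → 0ℚ ℚ.< p → 0ℚ ℚ.< q → 0ℚ ℚ.< p ℚ.+ q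
  0<+ = ℚ.+-mono-<

fromℚ : ℚ → ℝ
fromℚ q = record
  { seq    = λ _ → q
  ; cauchy = λ ε ε>0 → 0 , λ _ _ _ _ → subst (ℚ._< ε) (≡.sym (dist-refl q)) ε>0
  }

fromℤ : ℤ → ℝ
fromℤ z = fromℚ (z ℚ./ 1)

fromℕ : ℕ → ℝ
fromℕ n = fromℤ (+ n)

infixl 6 _+_
infixl 7 _*_
infix  8 -_

_+_ : ℝ → ℝ → ℝ
x + y = record
  { seq    = λ n → seq x n ℚ.+ seq y n
  ; cauchy = λ ε ε>0 →
      let (M , p) = cauchy x (ε ℚ.* ½) (half ε ε>0)
          (N , q) = cauchy y (ε ℚ.* ½) (half ε ε>0)
      in M ℕ.⊔ N , λ m n hm hn → <-halves ε
           (dist-+ (seq x m) (seq y m) (seq x n) (seq y n))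
           (p m n (ℕ.≤-trans (ℕ.m≤m⊔n M N) hm) (ℕ.≤-trans (ℕ.m≤m⊔n M N) hn))
           (q m n (ℕ.≤-trans (ℕ.m≤n⊔m M N) hm) (ℕ.≤-trans (ℕ.m≤n⊔m M N) hn))
  }

-_ : ℝ → ℝ
- x = record
  { seq    = λ n → ℚ.- seq x n
  ; cauchy = λ ε ε>0 →
      let (N , p) = cauchy x ε ε>0
      in N , λ m n hm hn → subst (ℚ._< ε) (≡.sym (dist-neg (seq x m) (seq x n))) (p m n hm hn)
  }

∣_∣ : ℝ → ℝ
∣ x ∣ = record
  { seq    = λ n → ℚ.∣ seq x n ∣
  ; cauchy = λ ε ε>0 →
      let (N , p) = cauchy x ε ε>0
      in N , λ m n hm hn → ℚ.≤-<-trans (dist-abs (seq x m) (seq x n)) (p m n hm hn)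
  }

_*_ : ℝ → ℝ → ℝ
x * y = record
  { seq    = λ n → seq x n ℚ.* seq y n
  ; cauchy = λ ε ε>0 →
      let (A , A>0 , K , a<) = bounded x
          (B , B>0 , L , b<) = bounded y
          (δ , δ>0 , Cδ≡ε)   = divide (A ℚ.+ B) ε (0<+ A>0 B>0) ε>0
          (M , p)            = cauchy x δ δ>0
          (N , q)            = cauchy y δ δ>0
          K≤ = λ {m} (h : (K ℕ.⊔ L) ℕ.⊔ (M ℕ.⊔ N) ℕ.≤ m) → ℕ.m⊔n≤o⇒m≤o K L (ℕ.m⊔n≤o⇒m≤o (K ℕ.⊔ L) (M ℕ.⊔ N) h)
          L≤ = λ {m} (h : (K ℕ.⊔ L) ℕ.⊔ (M ℕ.⊔ N) ℕ.≤ m) → ℕ.m⊔n≤o⇒n≤o K L (ℕ.m⊔n≤o⇒m≤o (K ℕ.⊔ L) (M ℕ.⊔ N) h)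
          M≤ = λ {m} (h : (K ℕ.⊔ L) ℕ.⊔ (M ℕ.⊔ N) ℕ.≤ m) → ℕ.m⊔n≤o⇒m≤o M N (ℕ.m⊔n≤o⇒n≤o (K ℕ.⊔ L) (M ℕ.⊔ N) h)
          N≤ = λ {m} (h : (K ℕ.⊔ L) ℕ.⊔ (M ℕ.⊔ N) ℕ.≤ m) → ℕ.m⊔n≤o⇒n≤o M N (ℕ.m⊔n≤o⇒n≤o (K ℕ.⊔ L) (M ℕ.⊔ N) h)
      in (K ℕ.⊔ L) ℕ.⊔ (M ℕ.⊔ N) , λ m n hm hn → subst (_ ℚ.<_) Cδ≡ε
           (product-bound (seq x m) (seq y m) (seq x n) (seq y n) A>0 B>0
             (a< m (K≤ hm)) (b< n (L≤ hn)) (p m n (M≤ hm) (M≤ hn)) (q m n (N≤ hm) (N≤ hn)))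
  }

private
  pointwise : ∀ {x y} → (∀ n → seq x n ≡ seq y n) → x ≈ y
  pointwise {x} {y} eq ε ε>0 = 0 , λ n _ →
    subst (ℚ._< ε) (≡.sym (≡.trans (cong (λ z → ℚ.∣ z ℚ.- seq y n ∣) (eq n)) (dist-refl (seq y n)))) ε>0

  ≈-sym : ∀ {x y} → x ≈ y → y ≈ x
  ≈-sym {x} {y} x≈y ε ε>0 =
    let (N , p) = x≈y ε ε>0
    in N , λ n h → subst (ℚ._< ε) (dist-sym (seq x n) (seq y n)) (p n h)

  ≈-trans : ∀ {x y z} → x ≈ y → y ≈ z → x ≈ z
  ≈-trans {x} {y} {z} x≈y y≈z ε ε>0 = eventually₂
    (λ n p q → <-halves ε (dist-triangle (seq x n) (seq y n) (seq z n)) p q)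
    (x≈y (ε ℚ.* ½) (half ε ε>0)) (y≈z (ε ℚ.* ½) (half ε ε>0))

  +-cong : ∀ {x y u v} → x ≈ y → u ≈ v → x + u ≈ y + v
  +-cong {x} {y} {u} {v} x≈y u≈v ε ε>0 = eventually₂
    (λ n p q → <-halves ε (dist-+ (seq x n) (seq u n) (seq y n) (seq v n)) p q)
    (x≈y (ε ℚ.* ½) (half ε ε>0)) (u≈v (ε ℚ.* ½) (half ε ε>0))

  -‿cong : ∀ {x y} → x ≈ y → - x ≈ - y
  -‿cong {x} {y} x≈y ε ε>0 =
    let (N , p) = x≈y ε ε>0
    in N , λ n h → subst (ℚ._< ε) (≡.sym (dist-neg (seq x n) (seq y n))) (p n h)

  *-cong : ∀ {x y u v} → x ≈ y → u ≈ v → x * u ≈ y * v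
  *-cong {x} {y} {u} {v} x≈y u≈v ε ε>0 =
    let (A , A>0 , ev-a) = bounded x
        (B , B>0 , ev-b) = bounded v
        (δ , δ>0 , Cδ≡ε) = divide (A ℚ.+ B) ε (0<+ A>0 B>0) ε>0
    in eventually₂ (λ n (a< , b<) (p , q) → subst (_ ℚ.<_) Cδ≡ε
           (product-bound (seq x n) (seq u n) (seq y n) (seq v n) A>0 B>0 a< b< p q))
         (eventually₂ (λ _ → _,_) ev-a ev-b)
         (eventually₂ (λ _ → _,_) (x≈y δ δ>0) (u≈v δ δ>0))

ℝ-ring : CommutativeRing 0ℓ 0ℓ
ℝ-ring = record
  { Carrier = ℝ
  ; _≈_     = _≈_
  ; _+_     = _+_
  ; _*_     = _*_
  ; -_      = -_
  ; 0#      = fromℕ 0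
  ; 1#      = fromℕ 1
  ; isCommutativeRing = record
    { isRing = record
      { +-isAbelianGroup = record
        { isGroup = record
          { isMonoid = record
            { isSemigroup = record
              { isMagma = record
                { isEquivalence = record
                  { refl  = λ {x} → pointwise {x} {x} (λ _ → refl)
                  ; sym   = λ {x} {y} → ≈-sym {x} {y}
                  ; trans = λ {x} {y} {z} → ≈-trans {x} {y} {z}
                  }
                ; ∙-cong = λ {x} {y} {u} {v} → +-cong {x} {y} {u} {v}
                }
              ; assoc = λ x y z → pointwise {(x + y) + z} {x + (y + z)}
                          λ n → ℚ.+-assoc (seq x n) (seq y n) (seq z n)
              }
            ; identity = (λ x → pointwise {fromℕ 0 + x} {x} λ n → ℚ.+-identityˡ (seq x n))
                       , (λ x → pointwise {x + fromℕ 0} {x} λ n → ℚ.+-identityʳ (seq x n))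
            }
          ; inverse = (λ x → pointwise {(- x) + x} {fromℕ 0} λ n → ℚ.+-inverseˡ (seq x n))
                    , (λ x → pointwise {x + (- x)} {fromℕ 0} λ n → ℚ.+-inverseʳ (seq x n))
          ; ⁻¹-cong = λ {x} {y} → -‿cong {x} {y}
          }
        ; comm = λ x y → pointwise {x + y} {y + x} λ n → ℚ.+-comm (seq x n) (seq y n)
        }
      ; *-cong = λ {x} {y} {u} {v} → *-cong {x} {y} {u} {v}
      ; *-assoc = λ x y z → pointwise {(x * y) * z} {x * (y * z)}
                    λ n → ℚ.*-assoc (seq x n) (seq y n) (seq z n)
      ; *-identity = (λ x → pointwise {fromℕ 1 * x} {x} λ n → ℚ.*-identityˡ (seq x n))
                   , (λ x → pointwise {x * fromℕ 1} {x} λ n → ℚ.*-identityʳ (seq x n))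
      ; distrib = (λ x y z → pointwise {x * (y + z)} {x * y + x * z}
                    λ n → ℚ.*-distribˡ-+ (seq x n) (seq y n) (seq z n))
                , (λ x y z → pointwise {(y + z) * x} {y * x + z * x}
                    λ n → ℚ.*-distribʳ-+ (seq x n) (seq y n) (seq z n))
      }
    ; *-comm = λ x y → pointwise {x * y} {y * x} λ n → ℚ.*-comm (seq x n) (seq y n)
    }
  }

open import Algebra.Properties.Monoid.Sum (CommutativeRing.+-monoid ℝ-ring) using (sum)

Matrix : ℕ → Set
Matrix N = Fin N → Fin N → ℝ

module _ {N : ℕ} where

  infix 4 _≋_
  infixl 7 _·_

  _≋_ : Rel (Vector ℝ N) 0ℓ
  v ≋ w = ∀ i → v i ≈ w i

  𝟎 : Vector ℝ N
  𝟎 _ = fromℕ 0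

  _·_ : Matrix N → Vector ℝ N → Vector ℝ N
  (A · v) i = sum λ j → A i j * v j

  linearCombination : ∀ {m} → Vector ℝ m → (Fin m → Vector ℝ N) → Vector ℝ N
  linearCombination c b i = sum λ k → c k * b k i

  record IsBasisOf (P : Vector ℝ N → Set) {m : ℕ} (b : Fin m → Vector ℝ N) : Set where
    field
      inside      : ∀ k → P (b k)
      independent : ∀ c → linearCombination c b ≋ 𝟎 → ∀ k → c k ≈ fromℕ 0
      spanning    : ∀ v → P v → ∃ λ c → v ≋ linearCombination c b

  InEigenspace : Matrix N → ℝ → Vector ℝ N → Set
  InEigenspace A μ v = A · v ≋ λ i → μ * v i

  IsEigenvalue : Matrix N → ℝ → Set
  IsEigenvalue A μ = ∃ λ v → ¬ (v ≋ 𝟎) × InEigenspace A μ v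

  -- The multiplicity of μ is the dimension of its eigenspace (0 when μ is
  -- not an eigenvalue).  All matrices below are real symmetric, so this
  -- agrees with the multiplicity of μ as a root of the characteristic
  -- polynomial, and there are no eigenvalues outside ℝ.
  HasMultiplicity : Matrix N → ℝ → ℕ → Set
  HasMultiplicity A μ m = ∃ λ (b : Fin m → Vector ℝ N) → IsBasisOf (InEigenspace A μ) b

  -- The list consists of the distinct eigenvalues of A, each paired with
  -- its multiplicity.
  record IsSpectrum (A : Matrix N) (s : List (ℝ × ℕ)) : Set where
    field
      distinct    : AllPairs (λ p q → ¬ (proj₁ p ≈ proj₁ q)) s
      eigenvalues : All (λ (μ , m) → IsEigenvalue A μ × HasMultiplicity A μ m) s
      complete    : ∀ μ → IsEigenvalue A μ → Any (λ p → μ ≈ proj₁ p) s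

record SimpleGraph : Set₁ where
  field
    vertices    : Setoid 0ℓ 0ℓ
    order       : ℕ
    enumeration : Inverse (≡.setoid (Fin order)) vertices
  open Setoid vertices public using () renaming (Carrier to Vertex; _≈_ to _≈ᵥ_)
  field
    _~_       : Rel Vertex 0ℓ
    ~-resp    : _~_ Respects₂ _≈ᵥ_
    _~?_      : Decidable _~_
    symmetric : Symmetric _~_
    loopless  : ∀ {u} → ¬ (u ~ u)

  vertex : Fin order → Vertex
  vertex = Inverse.to enumeration

  adjacencyMatrix : Matrix order
  adjacencyMatrix i j = if does (vertex i ~? vertex j) then fromℕ 1 else fromℕ 0

module _ (Γ : SimpleGraph) where
  open SimpleGraph Γ

  IsIntegral : Set
  IsIntegral = ∀ μ → IsEigenvalue adjacencyMatrix μ → ∃ λ z → μ ≈ fromℤ z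

  HasEnergy : ℝ → Set
  HasEnergy e = ∃ λ s → IsSpectrum adjacencyMatrix s ×
    e ≈ foldr (λ (μ , m) t → fromℕ m * ∣ μ ∣ + t) (fromℕ 0) s

  IsHyperenergetic : Set
  IsHyperenergetic = ∃ λ e → HasEnergy e × fromℤ (+ 2 ℤ.* + order ℤ.- + 2) < e

  HasNullity : ℕ → Set
  HasNullity η = HasMultiplicity adjacencyMatrix (fromℕ 0) η

record FiniteGroup : Set₁ where
  field
    group       : Group 0ℓ 0ℓ
    order       : ℕ
    enumeration : Inverse (≡.setoid (Fin order)) (Group.setoid group)
  open Group group public

record ConnectionSet (G : FiniteGroup) : Set₁ where
  open FiniteGroup G using (Carrier; ε; _⁻¹) renaming (_≈_ to _≈ᵍ_)
  field
    S              : U.Pred Carrier 0ℓ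
    S-resp         : S Respects _≈ᵍ_
    S?             : U.Decidable S
    inverse-closed : ∀ {a} → S a → S (a ⁻¹)
    no-identity    : ¬ S ε

module _ (G : FiniteGroup) (C : ConnectionSet G) where
  open FiniteGroup G renaming (_≈_ to _≈ᵍ_; refl to refl′; sym to sym′; trans to trans′)
  open ConnectionSet C
  open import Algebra.Properties.Group group using (identityˡ-unique)

  private
    _~_ : Rel Carrier 0ℓ
    u ~ v = ∃ λ a → S a × v ≈ᵍ a ∙ u

    quotient : ∀ {u v a} → v ≈ᵍ a ∙ u → v ∙ u ⁻¹ ≈ᵍ a
    quotient {u} {v} {a} v≈au = trans′ (∙-congʳ v≈au) (trans′ (assoc a u (u ⁻¹))
      (trans′ (∙-congˡ (inverseʳ u)) (identityʳ a)))

    quotient⁻ : ∀ u v → v ≈ᵍ (v ∙ u ⁻¹) ∙ u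
    quotient⁻ u v = sym′ (trans′ (assoc v (u ⁻¹) u) (trans′ (∙-congˡ (inverseˡ u)) (identityʳ v)))

    invert : ∀ {u v a} → v ≈ᵍ a ∙ u → u ≈ᵍ a ⁻¹ ∙ v
    invert {u} {v} {a} v≈au = sym′ (trans′ (∙-congˡ v≈au) (trans′ (sym′ (assoc (a ⁻¹) a u))
      (trans′ (∙-congʳ (inverseˡ a)) (identityˡ u))))

  Cay : SimpleGraph
  Cay = record
    { vertices    = setoid
    ; order       = order
    ; enumeration = enumeration
    ; _~_         = _~_
    ; ~-resp      = (λ v≈w (a , a∈S , v≈au) → a , a∈S , trans′ (sym′ v≈w) v≈au)
                  , (λ u≈w (a , a∈S , v≈au) → a , a∈S , trans′ v≈au (∙-congˡ u≈w))
    ; _~?_        = λ u v → map′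
                      (λ vu⁻¹∈S → v ∙ u ⁻¹ , vu⁻¹∈S , quotient⁻ u v)
                      (λ (a , a∈S , v≈au) → S-resp (sym′ (quotient v≈au)) a∈S)
                      (S? (v ∙ u ⁻¹))
    ; symmetric   = λ (a , a∈S , v≈au) → a ⁻¹ , inverse-closed a∈S , invert v≈au
    ; loopless    = λ {u} (a , a∈S , u≈au) →
                      no-identity (S-resp (identityˡ-unique a u (sym′ u≈au)) a∈S)
    }

private
  resp-ˡ : ∀ {n} {π ρ : Permutation′ n} → π Perm.≈ ρ → ∀ i → π ⟨$⟩ˡ i ≡ ρ ⟨$⟩ˡ i
  resp-ˡ {π = π} {ρ} π≈ρ i = ≡.trans
    (≡.sym (Perm.inverseˡ ρ))
    (cong (ρ ⟨$⟩ˡ_) (≡.trans (≡.sym (π≈ρ (π ⟨$⟩ˡ i))) (Perm.inverseʳ π)))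

-- stdlib's π ∘ₚ ρ applies π first, hence the flip: (π ∙ ρ) i = π (ρ i).
Sym-group : ℕ → Group 0ℓ 0ℓ
Sym-group n = record
  { Carrier = Permutation′ n
  ; _≈_     = Perm._≈_
  ; _∙_     = λ π ρ → ρ ∘ₚ π
  ; ε       = Perm.id
  ; _⁻¹     = Perm.flip
  ; isGroup = record
    { isMonoid = record
      { isSemigroup = record
        { isMagma = record
          { isEquivalence = record
            { refl  = λ _ → refl
            ; sym   = λ p i → ≡.sym (p i)
            ; trans = λ p q i → ≡.trans (p i) (q i)
            }
          ; ∙-cong = λ {π} {π′} {ρ} {ρ′} p q i → ≡.trans (cong (π ⟨$⟩ʳ_) (q i)) (p (ρ′ ⟨$⟩ʳ i))
          }
        ; assoc = λ _ _ _ _ → refl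
        }
      ; identity = (λ _ _ → refl) , (λ _ _ → refl)
      }
    ; inverse = (λ π _ → Perm.inverseˡ π) , (λ π _ → Perm.inverseʳ π)
    ; ⁻¹-cong = λ {π} {ρ} → resp-ˡ {π = π} {ρ}
    }
  }

-- A permutation of Fin (suc n) is coded by its value at 0 together with
-- the permutation of Fin n left after deleting 0 and that value.
decode : ∀ n → Fin (n !) → Permutation′ n
decode zero    _ = Perm.id
decode (suc n) k =
  let (j , l) = remQuot {suc n} (n !) k in insert zero j (decode n l)

encode : ∀ n → Permutation′ n → Fin (n !)
encode zero    _ = zero
encode (suc n) π = combine (π ⟨$⟩ʳ zero) (encode n (remove zero π))

private
  insert-cong : ∀ {n} j {π ρ : Permutation′ n} → π Perm.≈ ρ → insert zero j π Perm.≈ insert zero j ρ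
  insert-cong j π≈ρ zero    = refl
  insert-cong j π≈ρ (suc i) = cong (punchIn j) (π≈ρ i)

  remove-cong : ∀ {n} {π ρ : Permutation′ (suc n)} → π Perm.≈ ρ → remove zero π Perm.≈ remove zero ρ
  remove-cong {π = π} {ρ} π≈ρ i = Fin.punchIn-injective (π ⟨$⟩ʳ zero) _ _ (begin
    punchIn (π ⟨$⟩ʳ zero) (remove zero π ⟨$⟩ʳ i) ≡⟨ Fin.punchIn-punchOut _ ⟩
    π ⟨$⟩ʳ suc i                                               ≡⟨ π≈ρ (suc i) ⟩
    ρ ⟨$⟩ʳ suc i                                               ≡⟨ Fin.punchIn-punchOut _ ⟨
    punchIn (ρ ⟨$⟩ʳ zero) (remove zero ρ ⟨$⟩ʳ i) ≡⟨ cong (λ z → punchIn z (remove zero ρ ⟨$⟩ʳ i)) (π≈ρ zero) ⟨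
    punchIn (π ⟨$⟩ʳ zero) (remove zero ρ ⟨$⟩ʳ i) ∎)
    where open ≡.≡-Reasoning

  encode-cong : ∀ n {π ρ : Permutation′ n} → π Perm.≈ ρ → encode n π ≡ encode n ρ
  encode-cong zero    π≈ρ = refl
  encode-cong (suc n) {π} {ρ} π≈ρ = cong₂ combine (π≈ρ zero)
    (encode-cong n {remove zero π} {remove zero ρ} (remove-cong {π = π} {ρ} π≈ρ))

  decode-encode : ∀ n π → decode n (encode n π) Perm.≈ π
  decode-encode (suc n) π i = begin
    decode (suc n) (combine j k) ⟨$⟩ʳ i
      ≡⟨ cong (λ (j , l) → insert zero j (decode n l) ⟨$⟩ʳ i) (Fin.remQuot-combine j k) ⟩
    insert zero j (decode n k) ⟨$⟩ʳ i
      ≡⟨ insert-cong j {decode n k} {remove zero π} (decode-encode n (remove zero π)) i ⟩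
    insert zero j (remove zero π) ⟨$⟩ʳ i
      ≡⟨ Perm.insert-remove zero π i ⟩
    π ⟨$⟩ʳ i ∎
    where
    open ≡.≡-Reasoning
    j : Fin (suc n)
    j = π ⟨$⟩ʳ zero
    k : Fin (n !)
    k = encode n (remove zero π)

  encode-decode : ∀ n k → encode n (decode n k) ≡ k
  encode-decode zero    zero = refl
  encode-decode (suc n) k = ≡.trans
    (cong (combine j) (≡.trans
      (encode-cong n {remove zero (insert zero j (decode n l))} {decode n l}
        (Perm.remove-insert zero j (decode n l)))
      (encode-decode n l)))
    (Fin.combine-remQuot {suc n} (n !) k)
    where
    j : Fin (suc n)
    j = proj₁ (remQuot {suc n} (n !) k)
    l : Fin (n !)
    l = proj₂ (remQuot {suc n} (n !) k)

Sym : ℕ → FiniteGroup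
Sym n = record
  { group       = Sym-group n
  ; order       = n !
  ; enumeration = record
    { to        = decode n
    ; from      = encode n
    ; to-cong   = λ { refl _ → refl }
    ; from-cong = λ {π} {ρ} → encode-cong n {π} {ρ}
    ; inverse   = (λ { {π} refl → decode-encode n π })
                , (λ {k} {π} π≈ → ≡.trans (encode-cong n {π} {decode n k} π≈) (encode-decode n k))
    }
  }

next : ∀ {n} → Fin n → Fin n
next {suc n} i = suc (toℕ i) mod suc n

-- π = (σ 0  σ 1  …  σ (n - 1)); an n-cycle moves all n letters, so the
-- listing σ of its entries is a bijection.
IsNCycle : ∀ {n} → Permutation′ n → Set
IsNCycle {n} π = ∃ λ (σ : Permutation′ n) → ∀ i → π ⟨$⟩ʳ (σ ⟨$⟩ʳ i) ≡ σ ⟨$⟩ʳ next i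

private
  toℕ-next : ∀ {n} (i : Fin (suc n)) → toℕ (next i) ≡ suc (toℕ i) % suc n
  toℕ-next i = Fin.toℕ-fromℕ< _

  next-opposite-next : ∀ {n} (i : Fin n) → next (opposite (next i)) ≡ opposite i
  next-opposite-next {suc n} i = Fin.toℕ-injective (begin
    toℕ (next (opposite (next i)))           ≡⟨ toℕ-next (opposite (next i)) ⟩
    suc (toℕ (opposite (next i))) % suc n    ≡⟨ cong (λ z → suc z % suc n) (Fin.opposite-prop (next i)) ⟩
    suc (n ℕ.∸ toℕ (next i)) % suc n         ≡⟨ cong (λ z → suc (n ℕ.∸ z) % suc n) (toℕ-next i) ⟩
    suc (n ℕ.∸ suc (toℕ i) % suc n) % suc n  ≡⟨ lemma (ℕ.m≤n⇒m<n∨m≡n (ℕ.s≤s⁻¹ (Fin.toℕ<n i))) ⟩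
    n ℕ.∸ toℕ i                              ≡⟨ Fin.opposite-prop i ⟨
    toℕ (opposite i)                         ∎)
    where
    open ≡.≡-Reasoning
    lemma : toℕ i ℕ.< n ⊎ toℕ i ≡ n → suc (n ℕ.∸ suc (toℕ i) % suc n) % suc n ≡ n ℕ.∸ toℕ i
    lemma (inj₁ i<n) = begin
      suc (n ℕ.∸ suc (toℕ i) % suc n) % suc n  ≡⟨ cong (λ z → suc (n ℕ.∸ z) % suc n) (m<n⇒m%n≡m (s≤s i<n)) ⟩
      suc (n ℕ.∸ suc (toℕ i)) % suc n          ≡⟨ cong (_% suc n) (ℕ.+-∸-assoc 1 i<n) ⟨
      (n ℕ.∸ toℕ i) % suc n                    ≡⟨ m<n⇒m%n≡m (s≤s (ℕ.m∸n≤m n (toℕ i))) ⟩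
      n ℕ.∸ toℕ i                              ∎
    lemma (inj₂ i≡n) = begin
      suc (n ℕ.∸ suc (toℕ i) % suc n) % suc n  ≡⟨ cong (λ z → suc (n ℕ.∸ suc z % suc n) % suc n) i≡n ⟩
      suc (n ℕ.∸ suc n % suc n) % suc n        ≡⟨ cong (λ z → suc (n ℕ.∸ z) % suc n) (n%n≡0 (suc n)) ⟩
      suc n % suc n                            ≡⟨ n%n≡0 (suc n) ⟩
      0                                        ≡⟨ ℕ.n∸n≡0 n ⟨
      n ℕ.∸ n                                  ≡⟨ cong (n ℕ.∸_) i≡n ⟨
      n ℕ.∸ toℕ i                              ∎

  isNCycle? : ∀ {n} → U.Decidable (IsNCycle {n})
  isNCycle? {n} π = map′
    (λ (k , h) → decode n k , h)
    (λ (σ , h) → encode n σ , λ i → ≡.trans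
      (cong (π ⟨$⟩ʳ_) (decode-encode n σ i))
      (≡.trans (h i) (≡.sym (decode-encode n σ (next i)))))
    (Fin.any? λ k → Fin.all? λ i →
      π ⟨$⟩ʳ (decode n k ⟨$⟩ʳ i) Fin.≟ decode n k ⟨$⟩ʳ next i)

  isNCycle-flip : ∀ {n} {π : Permutation′ n} → IsNCycle π → IsNCycle (Perm.flip π)
  isNCycle-flip {π = π} (σ , h) = Perm.reverse ∘ₚ σ , λ i → begin
    π ⟨$⟩ˡ (σ ⟨$⟩ʳ opposite i)                       ≡⟨ cong (λ j → π ⟨$⟩ˡ (σ ⟨$⟩ʳ j)) (next-opposite-next i) ⟨
    π ⟨$⟩ˡ (σ ⟨$⟩ʳ next (opposite (next i)))         ≡⟨ cong (π ⟨$⟩ˡ_) (h (opposite (next i))) ⟨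
    π ⟨$⟩ˡ (π ⟨$⟩ʳ (σ ⟨$⟩ʳ opposite (next i)))       ≡⟨ Perm.inverseˡ π ⟩
    σ ⟨$⟩ʳ opposite (next i)                         ∎
    where open ≡.≡-Reasoning

  id-not-nCycle : ∀ {n} → 2 ℕ.≤ n → ¬ IsNCycle (Perm.id {n})
  id-not-nCycle {suc (suc n)} (s≤s (s≤s z≤n)) (σ , h) =
    contradiction (cong toℕ 0≡next0) λ ()
    where
    0≡next0 : zero ≡ next {suc (suc n)} zero
    0≡next0 = ≡.trans (≡.sym (Perm.inverseˡ σ)) (≡.trans (cong (σ ⟨$⟩ˡ_) (h zero)) (Perm.inverseˡ σ))

-- 2 ≤ n because for n = 1 the identity is an n-cycle.
nCycles : ∀ n → 2 ℕ.≤ n → ConnectionSet (Sym n)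
nCycles n 2≤n = record
  { S              = IsNCycle
  ; S-resp         = λ π≈ρ (σ , h) → σ , λ i → ≡.trans (≡.sym (π≈ρ (σ ⟨$⟩ʳ i))) (h i)
  ; S?             = isNCycle?
  ; inverse-closed = λ {π} → isNCycle-flip {π = π}
  ; no-identity    = id-not-nCycle 2≤n
  }

Γ : ∀ n → 4 ℕ.≤ n → SimpleGraph
Γ n 4≤n = Cay (Sym n) (nCycles n (ℕ.≤-trans (s≤s (s≤s z≤n)) 4≤n))

module Submission where

-- The sum of all n-cycles is the product of the Jucys–Murphy elements. In the
-- exterior powers of the standard representation (the hooks) the latter act
-- diagonally, by contents, on the exterior products of an orthogonal basis
-- adapted to the chain of symmetric groups, because a transposition is a
-- reflection. The matrix coefficients at two such vectors I and J are therefore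
-- eigenfunctions of the graph, of eigenvalue ± k! (n-1-k)! with k = |I| = |J|;
-- the left and right Jucys–Murphy elements separate them, so they are
-- orthogonal. There are C(n-1,k)² of them for each k, and the squares of their
-- eigenvalues add up to n! (n-1)!, which is the squared Frobenius norm of the
-- adjacency matrix: hence all other eigenvalues vanish. Over the constructive
-- reals, an eigenvalue is compared with the integer eigenvalues by
-- approximation, and a basis of the kernel is found by pivoting over ℚ.

open import Algebra.Bundles using (CommutativeRing)
open import Algebra.Morphism.Structures using (IsRingHomomorphism)
open import Data.Bool.Base using (Bool; true; false; if_then_else_)
import Data.Bool.Properties as Bool
open import Data.Fin.Base using (Fin; zero; suc; toℕ; inject₁; punchIn; combine; _↑ˡ_; _↑ʳ_)
open import Data.Fin.Induction using (<-weakInduction)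
import Data.Fin.Permutation as Perm
open Perm using (Permutation′; _⟨$⟩ʳ_; _⟨$⟩ˡ_; _∘ₚ_; transpose; lift₀; insert; remove)
import Data.Fin.Permutation.Components as Components
import Data.Fin.Properties as Fin
open import Data.Integer.Base as ℤ using (ℤ; +_; -[1+_]; 0ℤ; 1ℤ)
import Data.Integer.Properties as ℤ
open import Data.List.Base using (List; []; _∷_; _++_; concatMap; deduplicate; filter; foldr; length; lookup; map)
open import Data.List.Membership.Propositional using (_∈_)
open import Data.List.Membership.Propositional.Properties using (∈-map⁺; ∈-map⁻; ∈-deduplicate⁺; ∈-deduplicate⁻)
import Data.List.Properties as List
open import Data.List.Relation.Binary.Pointwise.Base using (Pointwise; []; _∷_)
open import Data.List.Relation.Unary.All as All using (All; []; _∷_)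
import Data.List.Relation.Unary.All.Properties as All
open import Data.List.Relation.Unary.AllPairs as AllPairs using (AllPairs; []; _∷_)
import Data.List.Relation.Unary.AllPairs.Properties as AllPairs
open import Data.List.Relation.Unary.Any as Any using (Any; here; there)
import Data.List.Relation.Unary.Any.Properties as Any
open import Data.List.Relation.Unary.Unique.DecPropositional.Properties using (deduplicate-!)
open import Data.Nat.Base as ℕ using (ℕ; zero; suc; _!; z≤n; s≤s; NonZero)
open import Data.Nat.Combinatorics using (_C_; nCk+nC[k+1]≡[n+1]C[k+1]; nCk≡n!/k![n-k]!; k![n∸k]!∣n!)
open import Data.Nat.DivMod using (_/_; _%_; n%n≡0; m<n⇒m%n≡m; m/n*n≡m)
import Data.Nat.Properties as ℕ
open import Data.Product.Base using (∃; ∃-syntax; _×_; _,_; proj₁; proj₂)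
open import Data.Rational.Base as ℚ using (ℚ; 0ℚ; 1ℚ; ½)
import Data.Rational.Properties as ℚ
open import Data.Rational.Solver using (module +-*-Solver)
open import Data.Rational.Unnormalised.Base as ℚᵘ using (ℚᵘ; mkℚᵘ; *≡*; *≤*)
import Data.Rational.Unnormalised.Properties as ℚᵘ
open import Data.Sum.Base using (_⊎_; inj₁; inj₂; [_,_]′)
open import Data.Vec.Base using (Vec; []; _∷_)
open import Data.Vec.Functional using (insertAt)
open import Data.Vec.Functional.Properties using (insertAt-lookup; insertAt-punchIn)
import Data.Vec.Properties as Vec
open import Defs using (ℝ; seq; cauchy; ℝ-ring; fromℚ; fromℤ; fromℕ; Eventually; Matrix; _·_; linearCombination; IsBasisOf; InEigenspace; IsEigenvalue; HasMultiplicity; IsSpectrum; module SimpleGraph; IsIntegral; HasEnergy; IsHyperenergetic; HasNullity; module FiniteGroup; module ConnectionSet; Sym; decode; encode; next; IsNCycle; nCycles; Γ)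
open import Function.Base using (_∘_; id)
open import Function.Bundles using (Inverse; Injection; _⇔_; mk⇔; Equivalence)
open import Function.Construct.Symmetry using (⇔-sym)
open import Function.Properties.Inverse using (↔⇒↣)
open import Level using (0ℓ)
open import Relation.Binary.PropositionalEquality as ≡ using (_≡_; _≢_; _≗_; refl; sym; trans; cong; cong₂; subst; subst₂)
open import Relation.Nullary.Decidable using (Dec; yes; no; does; map′; does-⇔; dec-false; ¬?; decidable-stable)
open import Relation.Nullary.Negation using (¬_; contradiction)
import Relation.Unary as U

-- The exterior powers never appear as modules. They are seen through alternating forms `Φ`, given
-- by their values on lists of vectors and evaluated on translates of `basis I`; eigenvector
-- statements are proved for all `Φ` at once, which lets the induction replace `Φ` by a restriction
-- to fewer letters.
--
-- The Frobenius count needs nonzero eigenfunctions. That the coefficient at `I` and `J` does not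
-- vanish identically is the irreducibility of a hook; it comes from Young's seminormal relations
-- between neighbouring letters, which carry vanishing on the orbit of `basis I` over to `basis J`.
--
-- The bound n ≥ 4 enters the counting twice, with d = n - 1 ≥ 3: C(2d, d) < (d + 1)! makes the
-- kernel nontrivial, so that 0 belongs in the list of eigenvalues, and 2 (d + 1) ≤ 2^d, an equality
-- at d = 3, makes the energy at least 2 n!.
--
-- Being zero is undecidable for a real number. Pivots, norms and the grouping by eigenvalue are
-- therefore decided in ℚ, and the linear algebra is done over an arbitrary ring receiving ℚ, in
-- which only the vectors and the coefficients of combinations need be real.

-- Finite sums and dot products over a commutative ring

module Sums {c ℓ} (R : CommutativeRing c ℓ) where
  open CommutativeRing R hiding (zero) renaming (refl to ≈-refl; sym to ≈-sym; trans to ≈-trans)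
  open import Algebra.Properties.Semiring.Sum semiring public
    using (sum; sum-cong-≋; sum-cong-≗; ∑-distrib-+; ∑-comm; sum-permute; sum-remove;
           sum-replicate-zero; *-distribˡ-sum; *-distribʳ-sum)
  open import Relation.Binary.Reasoning.Setoid setoid

  dot : ∀ {n} → (Fin n → Carrier) → (Fin n → Carrier) → Carrier
  dot x y = sum λ i → x i * y i

  δ : ∀ {n} → Fin n → Fin n → Carrier
  δ i j = if does (i Fin.≟ j) then 1# else 0#

  sum-zero : ∀ {n} (f : Fin n → Carrier) → (∀ i → f i ≈ 0#) → sum f ≈ 0#
  sum-zero {n} f f≈0 = ≈-trans (sum-cong-≋ {n} f≈0) (sum-replicate-zero n)

  sum-linear : ∀ {n} a b (f g h : Fin n → Carrier) → (∀ i → h i ≈ a * f i + b * g i) →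
               sum h ≈ a * sum f + b * sum g
  sum-linear {n} a b f g h eq = begin
    sum h                                              ≈⟨ sum-cong-≋ {n} eq ⟩
    sum (λ i → a * f i + b * g i)                      ≈⟨ ∑-distrib-+ (λ i → a * f i) (λ i → b * g i) ⟩
    sum (λ i → a * f i) + sum (λ i → b * g i)          ≈⟨ +-cong (*-distribˡ-sum a f) (*-distribˡ-sum b g) ⟨
    a * sum f + b * sum g                              ∎

  dot-comm : ∀ {n} (x y : Fin n → Carrier) → dot x y ≈ dot y x
  dot-comm {n} x y = sum-cong-≋ {n} λ i → *-comm (x i) (y i)

  dot-linearˡ : ∀ {n} a b (x y z w : Fin n → Carrier) → (∀ i → z i ≈ a * x i + b * y i) →
                dot z w ≈ a * dot x w + b * dot y w
  dot-linearˡ a b x y z w eq = sum-linear a b _ _ _ λ i → begin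
    z i * w i                          ≈⟨ *-congʳ (eq i) ⟩
    (a * x i + b * y i) * w i          ≈⟨ distribʳ _ _ _ ⟩
    a * x i * w i + b * y i * w i      ≈⟨ +-cong (*-assoc _ _ _) (*-assoc _ _ _) ⟩
    a * (x i * w i) + b * (y i * w i)  ∎

  dot-linearʳ : ∀ {n} a b (x y z w : Fin n → Carrier) → (∀ i → z i ≈ a * x i + b * y i) →
                dot w z ≈ a * dot w x + b * dot w y
  dot-linearʳ a b x y z w eq = begin
    dot w z                    ≈⟨ dot-comm w z ⟩
    dot z w                    ≈⟨ dot-linearˡ a b x y z w eq ⟩
    a * dot x w + b * dot y w  ≈⟨ +-cong (*-congˡ (dot-comm x w)) (*-congˡ (dot-comm y w)) ⟩
    a * dot w x + b * dot w y  ∎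

  dot-δˡ : ∀ {n} (i : Fin n) x → dot (δ i) x ≈ x i
  dot-δˡ {suc n} zero x = begin
    1# * x zero + dot {n} (λ _ → 0#) (λ j → x (suc j)) ≈⟨ +-cong (*-identityˡ _) (sum-zero {n} (λ j → 0# * x (suc j)) λ _ → zeroˡ _) ⟩
    x zero + 0#                                        ≈⟨ +-identityʳ _ ⟩
    x zero                                             ∎
  dot-δˡ {suc n} (suc i) x = begin
    0# * x zero + dot (δ i) (λ j → x (suc j))  ≈⟨ +-cong (zeroˡ _) (dot-δˡ i _) ⟩
    0# + x (suc i)                             ≈⟨ +-identityˡ _ ⟩
    x (suc i)                                  ∎

  dot-δʳ : ∀ {n} x (i : Fin n) → sum (λ k → x k * δ k i) ≈ x i
  dot-δʳ {suc n} x zero = begin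
    x zero * 1# + sum (λ k → x (suc k) * 0#)  ≈⟨ +-cong (*-identityʳ _) (sum-zero (λ k → x (suc k) * 0#) λ k → zeroʳ _) ⟩
    x zero + 0#                               ≈⟨ +-identityʳ _ ⟩
    x zero                                    ∎
  dot-δʳ {suc n} x (suc i) = begin
    x zero * 0# + sum (λ k → x (suc k) * δ k i)  ≈⟨ +-cong (zeroʳ _) (dot-δʳ (λ k → x (suc k)) i) ⟩
    0# + x (suc i)                               ≈⟨ +-identityˡ _ ⟩
    x (suc i)                                    ∎

  combination : ∀ {m n} → (Fin m → Carrier) → (Fin m → Fin n → Carrier) → Fin n → Carrier
  combination c b i = sum λ k → c k * b k i

  dot-cong : ∀ {n} {x x′ y y′ : Fin n → Carrier} → (∀ i → x i ≈ x′ i) → (∀ i → y i ≈ y′ i) → dot x y ≈ dot x′ y′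
  dot-cong {n} x≈ y≈ = sum-cong-≋ {n} λ i → *-cong (x≈ i) (y≈ i)

  dot-combination : ∀ {m n} (x : Fin n → Carrier) c (b : Fin m → Fin n → Carrier) →
                    dot x (combination c b) ≈ sum (λ k → c k * dot x (b k))
  dot-combination {m} {n} x c b = begin
    sum (λ i → x i * sum (λ k → c k * b k i))    ≈⟨ sum-cong-≋ {n} (λ i → *-distribˡ-sum (x i) (λ k → c k * b k i)) ⟩
    sum (λ i → sum (λ k → x i * (c k * b k i)))  ≈⟨ ∑-comm (λ i k → x i * (c k * b k i)) ⟩
    sum (λ k → sum (λ i → x i * (c k * b k i)))
      ≈⟨ sum-cong-≋ {m} (λ k → begin
           sum (λ i → x i * (c k * b k i))  ≈⟨ sum-cong-≋ {n} (λ i → begin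
             x i * (c k * b k i)              ≈⟨ *-assoc _ _ _ ⟨
             x i * c k * b k i                ≈⟨ *-congʳ (*-comm _ _) ⟩
             c k * x i * b k i                ≈⟨ *-assoc _ _ _ ⟩
             c k * (x i * b k i)              ∎) ⟩
           sum (λ i → c k * (x i * b k i))  ≈⟨ *-distribˡ-sum (c k) (λ i → x i * b k i) ⟨
           c k * dot x (b k)                ∎) ⟩
    sum (λ k → c k * dot x (b k))                ∎

-- Alternating forms on lists of vectors, Gram determinants and reflections

module Exterior where
  open import Data.Integer.Tactic.RingSolver using (solve-∀)
  open import Data.Integer.Base using (_+_; _*_; _-_; -_)
  open Sums ℤ.+-*-commutativeRing
  open import Algebra.Properties.AbelianGroup ℤ.+-0-abelianGroup using (inverseˡ-unique)
  open ≡.≡-Reasoning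

  V : ℕ → Set
  V n = Fin n → ℤ

  -- The product of the linear form ⟨ x , _ ⟩ with F, where a multilinear form
  -- is given by its values on lists of arguments.
  wedge : ∀ {n} → V n → (List (V n) → ℤ) → List (V n) → ℤ
  wedge x F []       = 0ℤ
  wedge x F (y ∷ ys) = dot x y * F ys - wedge x (λ zs → F (y ∷ zs)) ys

  -- The Gram determinant det ⟨x , y⟩ (0 if the lengths differ).
  gram : ∀ {n} → List (V n) → List (V n) → ℤ
  gram []       []      = 1ℤ
  gram []       (_ ∷ _) = 0ℤ
  gram (x ∷ xs)         = wedge x (gram xs)

  wedge-linear : ∀ {n} a b (x : V n) {F G H} → (∀ zs → H zs ≡ a * F zs + b * G zs) →
                 ∀ ys → wedge x H ys ≡ a * wedge x F ys + b * wedge x G ys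
  wedge-linear a b x eq [] = lemma a b
    where
    lemma : ∀ a b → 0ℤ ≡ a * 0ℤ + b * 0ℤ
    lemma = solve-∀
  wedge-linear a b x {F} {G} {H} eq (y ∷ ys) = trans
    (cong₂ (λ s t → dot x y * s - t) (eq ys) (wedge-linear a b x (λ zs → eq (y ∷ zs)) ys))
    (lemma a b (dot x y) (F ys) (G ys) _ _)
    where
    lemma : ∀ a b d f g s t → d * (a * f + b * g) - (a * s + b * t) ≡ a * (d * f - s) + b * (d * g - t)
    lemma = solve-∀

  wedge-zero : ∀ {n} (x : V n) {F} → (∀ zs → F zs ≡ 0ℤ) → ∀ ys → wedge x F ys ≡ 0ℤ
  -- `0ℤ * i` computes to `0ℤ`, so a vanishing `F` is the combination of itself with coefficients 0
  -- and 0.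
  wedge-zero x {F} eq = wedge-linear 0ℤ 0ℤ x {F} {F} eq

  wedge-linearˡ : ∀ {n} a b {x y z : V n} → (∀ i → z i ≡ a * x i + b * y i) →
                  ∀ F ws → wedge z F ws ≡ a * wedge x F ws + b * wedge y F ws
  wedge-linearˡ a b eq F [] = lemma a b
    where
    lemma : ∀ a b → 0ℤ ≡ a * 0ℤ + b * 0ℤ
    lemma = solve-∀
  wedge-linearˡ a b {x} {y} {z} eq F (w ∷ ws) = trans
    (cong₂ (λ s t → s * F ws - t) (dot-linearˡ a b x y z w eq) (wedge-linearˡ a b eq _ ws))
    (lemma a b (dot x w) (dot y w) (F ws) _ _)
    where
    lemma : ∀ a b d e f s t → (a * d + b * e) * f - (a * s + b * t) ≡ a * (d * f - s) + b * (e * f - t)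
    lemma = solve-∀

  -- Pairing the first factor with `y` leaves `dot x y * wedge x F ys`, pairing the second leaves
  -- the same with the opposite sign, and the terms in which neither meets `y` vanish by induction.
  wedge-wedge : ∀ {n} (x : V n) F ys → wedge x (wedge x F) ys ≡ 0ℤ
  wedge-wedge x F []       = refl
  wedge-wedge x F (y ∷ ys) = trans
    (cong (λ t → dot x y * wedge x F ys - t) (trans
      (wedge-linear (dot x y) (ℤ.-1ℤ) x {G = wedge x (λ zs → F (y ∷ zs))} (λ zs → lemma₁ (dot x y) (F zs) _) ys)
      (cong (λ t → dot x y * wedge x F ys + ℤ.-1ℤ * t) (wedge-wedge x (λ zs → F (y ∷ zs)) ys))))
    (lemma₂ (dot x y) (wedge x F ys))
    where
    lemma₁ : ∀ d f t → d * f - t ≡ d * f + ℤ.-1ℤ * t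
    lemma₁ = solve-∀
    lemma₂ : ∀ d f → d * f - (d * f + ℤ.-1ℤ * 0ℤ) ≡ 0ℤ
    lemma₂ = solve-∀

  -- Alternation is demanded for adjacent equal arguments only, since linearity then yields
  -- antisymmetry. Linearity takes `z` up to pointwise equality, so that a form respects `≗` without
  -- function extensionality (see `congruent`).
  record Alternating {n} (Φ : List (V n) → ℤ) : Set where
    field
      linear : ∀ ps {x y z} a b qs → (∀ i → z i ≡ a * x i + b * y i) →
               Φ (ps ++ z ∷ qs) ≡ a * Φ (ps ++ x ∷ qs) + b * Φ (ps ++ y ∷ qs)
      alternating : ∀ ps x qs → Φ (ps ++ x ∷ x ∷ qs) ≡ 0ℤ

  open Alternating

  alternating-∷ : ∀ {n Φ} → Alternating {n} Φ → ∀ x → Alternating (λ xs → Φ (x ∷ xs))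
  alternating-∷ alt x = record
    { linear      = λ ps → linear alt (x ∷ ps)
    ; alternating = λ ps → alternating alt (x ∷ ps)
    }

  alternating-map : ∀ {m n Φ} → Alternating {n} Φ → (f : V m → V n) →
    (∀ {x y z} a b → (∀ i → z i ≡ a * x i + b * y i) → ∀ i → f z i ≡ a * f x i + b * f y i) →
    Alternating (λ xs → Φ (map f xs))
  alternating-map {Φ = Φ} alt f f-linear = record
    { linear = λ ps {x} {y} {z} a b qs eq → begin
        Φ (map f (ps ++ z ∷ qs))        ≡⟨ cong Φ (List.map-++ f ps _) ⟩
        Φ (map f ps ++ f z ∷ map f qs)  ≡⟨ linear alt (map f ps) a b (map f qs) (f-linear a b eq) ⟩
        a * Φ (map f ps ++ f x ∷ map f qs) + b * Φ (map f ps ++ f y ∷ map f qs)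
          ≡⟨ cong₂ (λ s t → a * Φ s + b * Φ t) (List.map-++ f ps _) (List.map-++ f ps _) ⟨
        a * Φ (map f (ps ++ x ∷ qs)) + b * Φ (map f (ps ++ y ∷ qs)) ∎
    ; alternating = λ ps x qs → trans (cong Φ (List.map-++ f ps _)) (alternating alt (map f ps) (f x) (map f qs))
    }

  alternating-∘ : ∀ {m n Φ} → Alternating {n} Φ → (σ : Fin n → Fin m) →
                  Alternating (λ xs → Φ (map (_∘ σ) xs))
  alternating-∘ alt σ = alternating-map alt (_∘ σ) λ a b eq i → eq (σ i)

  congruent : ∀ {n Φ} → Alternating {n} Φ → ∀ {xs ys} → Pointwise _≗_ xs ys → Φ xs ≡ Φ ys
  congruent         alt []                         = refl
  congruent {Φ = Φ} alt {x ∷ xs} {y ∷ ys} (x≗y ∷ xs≗ys) = begin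
    Φ (x ∷ xs)                          ≡⟨ linear alt [] {y} {y} 1ℤ 0ℤ xs (λ i → trans (x≗y i) (lemma (y i))) ⟩
    1ℤ * Φ (y ∷ xs) + 0ℤ * Φ (y ∷ xs)   ≡⟨ lemma _ ⟨
    Φ (y ∷ xs)                          ≡⟨ congruent (alternating-∷ alt y) xs≗ys ⟩
    Φ (y ∷ ys)                          ∎
    where
    lemma : ∀ s → s ≡ 1ℤ * s + 0ℤ * s
    lemma = solve-∀

  -- Polarisation: the form is expanded at the repeated argument `x + y`.
  antisymmetric : ∀ {n Φ} → Alternating {n} Φ → ∀ x y qs → Φ (x ∷ y ∷ qs) ≡ - Φ (y ∷ x ∷ qs)
  antisymmetric {Φ = Φ} alt x y qs = inverseˡ-unique _ _ (begin
    Φ (x ∷ y ∷ qs) + Φ (y ∷ x ∷ qs)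
      ≡⟨ lemma (Φ (x ∷ y ∷ qs)) (Φ (y ∷ x ∷ qs)) ⟩
    1ℤ * (1ℤ * 0ℤ + 1ℤ * Φ (x ∷ y ∷ qs)) + 1ℤ * (1ℤ * Φ (y ∷ x ∷ qs) + 1ℤ * 0ℤ)
      ≡⟨ cong₂ (λ s t → 1ℤ * (1ℤ * s + 1ℤ * Φ (x ∷ y ∷ qs)) + 1ℤ * (1ℤ * Φ (y ∷ x ∷ qs) + 1ℤ * t))
           (alternating alt [] x qs) (alternating alt [] y qs) ⟨
    1ℤ * (1ℤ * Φ (x ∷ x ∷ qs) + 1ℤ * Φ (x ∷ y ∷ qs)) + 1ℤ * (1ℤ * Φ (y ∷ x ∷ qs) + 1ℤ * Φ (y ∷ y ∷ qs))
      ≡⟨ cong₂ (λ s t → 1ℤ * s + 1ℤ * t) (linear alt (x ∷ []) 1ℤ 1ℤ qs x+y) (linear alt (y ∷ []) 1ℤ 1ℤ qs x+y) ⟨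
    1ℤ * Φ (x ∷ z ∷ qs) + 1ℤ * Φ (y ∷ z ∷ qs)
      ≡⟨ linear alt [] 1ℤ 1ℤ (z ∷ qs) x+y ⟨
    Φ (z ∷ z ∷ qs)
      ≡⟨ alternating alt [] z qs ⟩
    0ℤ ∎)
    where
    z : V _
    z i = x i + y i
    x+y : ∀ i → z i ≡ 1ℤ * x i + 1ℤ * y i
    x+y i = cong₂ _+_ (sym (ℤ.*-identityˡ (x i))) (sym (ℤ.*-identityˡ (y i)))
    lemma : ∀ s t → s + t ≡ 1ℤ * (1ℤ * 0ℤ + 1ℤ * s) + 1ℤ * (1ℤ * t + 1ℤ * 0ℤ)
    lemma = solve-∀

  alternating-wedge : ∀ {n F} → Alternating F → (x : V n) → Alternating (wedge x F)
  alternating-wedge {F = F} alt x = record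
    { linear      = λ ps → wedge-lin ps alt
    ; alternating = λ ps → wedge-alt ps alt
    }
    where
    wedge-lin : ∀ ps {F} → Alternating F → ∀ {y z w} a b qs → (∀ i → w i ≡ a * y i + b * z i) →
                wedge x F (ps ++ w ∷ qs) ≡ a * wedge x F (ps ++ y ∷ qs) + b * wedge x F (ps ++ z ∷ qs)
    wedge-lin [] {F} alt {y} {z} {w} a b qs eq = trans
      (cong₂ (λ s t → s * F qs - t) (dot-linearʳ a b y z w x eq)
        (wedge-linear a b x (λ zs → linear alt [] a b zs eq) qs))
      (lemma a b (dot x y) (dot x z) (F qs) _ _)
      where
      lemma : ∀ a b d e f s t → (a * d + b * e) * f - (a * s + b * t) ≡ a * (d * f - s) + b * (e * f - t)
      lemma = solve-∀
    wedge-lin (p ∷ ps) {F} alt {y} {z} {w} a b qs eq = trans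
      (cong₂ (λ s t → dot x p * s - t) (linear alt ps a b qs eq)
        (wedge-lin ps (alternating-∷ alt p) a b qs eq))
      (lemma a b (dot x p) (F (ps ++ y ∷ qs)) (F (ps ++ z ∷ qs)) _ _)
      where
      lemma : ∀ a b d f g s t → d * (a * f + b * g) - (a * s + b * t) ≡ a * (d * f - s) + b * (d * g - t)
      lemma = solve-∀

    wedge-alt : ∀ ps {F} → Alternating F → ∀ y qs → wedge x F (ps ++ y ∷ y ∷ qs) ≡ 0ℤ
    wedge-alt [] {F} alt y qs = trans
      (cong (λ t → dot x y * F (y ∷ qs) - (dot x y * F (y ∷ qs) - t))
        (wedge-zero x (λ zs → alternating alt [] y zs) qs))
      (lemma (dot x y * F (y ∷ qs)))
      where
      lemma : ∀ s → s - (s - 0ℤ) ≡ 0ℤ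
      lemma = solve-∀
    wedge-alt (p ∷ ps) {F} alt y qs = trans
      (cong₂ (λ s t → dot x p * s - t) (alternating alt ps y qs) (wedge-alt ps (alternating-∷ alt p) y qs))
      (lemma (dot x p))
      where
      lemma : ∀ d → d * 0ℤ - 0ℤ ≡ 0ℤ
      lemma = solve-∀

  gram-alternatingʳ : ∀ {n} (xs : List (V n)) → Alternating (gram xs)
  gram-alternatingʳ [] = record
    { linear      = λ { [] a b qs eq → lemma a b ; (_ ∷ _) a b qs eq → lemma a b }
    ; alternating = λ { [] x qs → refl ; (_ ∷ _) x qs → refl }
    }
    where
    lemma : ∀ a b → 0ℤ ≡ a * 0ℤ + b * 0ℤ
    lemma = solve-∀
  gram-alternatingʳ (x ∷ xs) = alternating-wedge (gram-alternatingʳ xs) x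

  gram-alternatingˡ : ∀ {n} (ys : List (V n)) → Alternating (λ xs → gram xs ys)
  gram-alternatingˡ ys = record
    { linear      = λ ps a b qs eq → gram-lin ps a b qs eq ys
    ; alternating = λ ps x qs → gram-alt ps x qs ys
    }
    where
    gram-lin : ∀ ps {x y z} a b qs → (∀ i → z i ≡ a * x i + b * y i) → ∀ ys →
               gram (ps ++ z ∷ qs) ys ≡ a * gram (ps ++ x ∷ qs) ys + b * gram (ps ++ y ∷ qs) ys
    gram-lin []       a b qs eq ys = wedge-linearˡ a b eq (gram qs) ys
    gram-lin (p ∷ ps) a b qs eq ys = wedge-linear a b p (gram-lin ps a b qs eq) ys

    gram-alt : ∀ ps x qs ys → gram (ps ++ x ∷ x ∷ qs) ys ≡ 0ℤ
    gram-alt []       x qs ys = wedge-wedge x (gram qs) ys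
    gram-alt (p ∷ ps) x qs ys = wedge-zero p (gram-alt ps x qs) ys

  -- Only the pairings enter the determinant, so one map of an adjoint pair can be traded for the
  -- other across it.
  gram-map : ∀ {m n} (f : V m → V n) (g : V n → V m) → (∀ x y → dot (f x) y ≡ dot x (g y)) →
             ∀ xs ys → gram (map f xs) ys ≡ gram xs (map g ys)
  gram-map f g adj []       []      = refl
  gram-map f g adj []       (_ ∷ _) = refl
  gram-map f g adj (x ∷ xs) ys      = wedge-map (gram-map f g adj xs) ys
    where
    wedge-map : ∀ {F G} → (∀ ys → F ys ≡ G (map g ys)) → ∀ ys → wedge (f x) F ys ≡ wedge x G (map g ys)
    wedge-map eq []       = refl
    wedge-map eq (y ∷ ys) = cong₂ _-_ (cong₂ _*_ (adj x y) (eq ys)) (wedge-map (λ zs → eq (y ∷ zs)) ys)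

  wedge-orthogonal : ∀ {n} (x : V n) F {ys} → All (λ y → dot x y ≡ 0ℤ) ys → wedge x F ys ≡ 0ℤ
  wedge-orthogonal x F []                   = refl
  wedge-orthogonal x F {y ∷ ys} (x⊥y ∷ x⊥ys) =
    cong₂ (λ s t → s * F ys - t) x⊥y (wedge-orthogonal x _ x⊥ys)

  -- The derivation extending the rank-one operator that sends `x` to `α x` times `s`: one argument
  -- at a time is replaced.
  substitute : ∀ {n} → (V n → ℤ) → V n → (List (V n) → ℤ) → List (V n) → ℤ
  substitute α s Φ []       = 0ℤ
  substitute α s Φ (x ∷ xs) = α x * Φ (s ∷ xs) + substitute α s (λ zs → Φ (x ∷ zs)) xs

  module _ {n} (α : V n → ℤ) (s : V n) (r : V n → V n) (r-reflects : ∀ x i → r x i ≡ x i - α x * s i) where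

    private
      expand : ∀ {Φ} → Alternating Φ → ∀ x xs → Φ (r x ∷ xs) ≡ Φ (x ∷ xs) - α x * Φ (s ∷ xs)
      expand {Φ} alt x xs = trans
        (linear alt [] {x} {s} 1ℤ (- α x) xs (λ i → trans (r-reflects x i) (lemma (x i) (α x) (s i))))
        (sym (lemma (Φ (x ∷ xs)) (α x) (Φ (s ∷ xs))))
        where
        lemma : ∀ u a v → u - a * v ≡ 1ℤ * u + (- a) * v
        lemma = solve-∀

      -- By antisymmetry a form that kills `s` in the first place kills it in every place, so moving
      -- arguments along `s` changes nothing. This applies once `s` already stands at the head.
      fixed : ∀ {Φ} → Alternating Φ → (∀ qs → Φ (s ∷ qs) ≡ 0ℤ) → ∀ xs → Φ (map r xs) ≡ Φ xs
      fixed {Φ} alt s-null []       = refl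
      fixed {Φ} alt s-null (x ∷ xs) = begin
        Φ (r x ∷ map r xs)                          ≡⟨ expand alt x (map r xs) ⟩
        Φ (x ∷ map r xs) - α x * Φ (s ∷ map r xs)   ≡⟨ cong (λ t → Φ (x ∷ map r xs) - α x * t) (s-null (map r xs)) ⟩
        Φ (x ∷ map r xs) - α x * 0ℤ                 ≡⟨ lemma _ (α x) ⟩
        Φ (x ∷ map r xs)
          ≡⟨ fixed (alternating-∷ alt x)
               (λ qs → trans (antisymmetric alt x s qs) (cong -_ (s-null (x ∷ qs)))) xs ⟩
        Φ (x ∷ xs)                                  ∎
        where
        lemma : ∀ t a → t - a * 0ℤ ≡ t
        lemma = solve-∀

    -- Every term containing s twice vanishes, so the expansion stops at first order.
    reflection : ∀ {Φ} → Alternating Φ → ∀ xs → Φ (map r xs) ≡ Φ xs - substitute α s Φ xs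
    reflection {Φ} alt [] = sym (ℤ.+-identityʳ (Φ []))
    reflection {Φ} alt (x ∷ xs) = begin
      Φ (r x ∷ map r xs)                          ≡⟨ expand alt x (map r xs) ⟩
      Φ (x ∷ map r xs) - α x * Φ (s ∷ map r xs)
        ≡⟨ cong₂ (λ u v → u - α x * v) (reflection (alternating-∷ alt x) xs)
             (fixed (alternating-∷ alt s) (alternating alt [] s) xs) ⟩
      Φ (x ∷ xs) - substitute α s (λ zs → Φ (x ∷ zs)) xs - α x * Φ (s ∷ xs)
        ≡⟨ lemma (Φ (x ∷ xs)) _ (α x * Φ (s ∷ xs)) ⟩
      Φ (x ∷ xs) - (α x * Φ (s ∷ xs) + substitute α s (λ zs → Φ (x ∷ zs)) xs) ∎
      where
      lemma : ∀ u v w → u - v - w ≡ u - (w + v)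
      lemma = solve-∀

  linear-sum : ∀ {n k Φ} → Alternating {n} Φ → (c : Fin k → ℤ) (s : Fin k → V n) → ∀ z qs →
               (∀ i → z i ≡ sum (λ j → c j * s j i)) → Φ (z ∷ qs) ≡ sum (λ j → c j * Φ (s j ∷ qs))
  linear-sum {k = zero}  alt c s z qs eq = linear alt [] {z} {z} 0ℤ 0ℤ qs eq
  linear-sum {k = suc k} {Φ} alt c s z qs eq = begin
    Φ (z ∷ qs)
      ≡⟨ linear alt [] {s zero} {z′} (c zero) 1ℤ qs (λ i → trans (eq i) (cong (λ t → c zero * s zero _ + t) (sym (ℤ.*-identityˡ _)))) ⟩
    c zero * Φ (s zero ∷ qs) + 1ℤ * Φ (z′ ∷ qs)
      ≡⟨ cong (λ t → c zero * Φ (s zero ∷ qs) + t) (trans (ℤ.*-identityˡ _) (linear-sum alt (c ∘ suc) (s ∘ suc) z′ qs (λ _ → refl))) ⟩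
    sum (λ j → c j * Φ (s j ∷ qs)) ∎
    where
    z′ : V _
    z′ i = sum λ j → c (suc j) * s (suc j) i

  -- The sum of these derivations extends the sum of the rank-one operators, and a derivation acts
  -- on a product of eigenvectors by the sum of their eigenvalues.
  sum-substitute : ∀ {n k} (α : Fin k → V n → ℤ) (s : Fin k → V n) (w : V n → ℤ) {Φ} → Alternating Φ → ∀ {xs} →
    All (λ x → ∀ i → sum (λ j → α j x * s j i) ≡ w x * x i) xs →
    sum (λ j → substitute (α j) (s j) Φ xs) ≡ foldr (λ x t → w x + t) 0ℤ xs * Φ xs
  sum-substitute {k = k} α s w {Φ} alt {[]} [] = sum-zero {k} (λ _ → 0ℤ) (λ _ → refl)
  sum-substitute α s w {Φ} alt {x ∷ xs} (eq ∷ eqs) = begin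
    sum (λ j → α j x * Φ (s j ∷ xs) + substitute (α j) (s j) (λ zs → Φ (x ∷ zs)) xs)
      ≡⟨ ∑-distrib-+ (λ j → α j x * Φ (s j ∷ xs)) _ ⟩
    sum (λ j → α j x * Φ (s j ∷ xs)) + sum (λ j → substitute (α j) (s j) (λ zs → Φ (x ∷ zs)) xs)
      ≡⟨ cong₂ _+_
           (trans (sym (linear-sum alt (λ j → α j x) s (λ i → w x * x i) xs (λ i → sym (eq i))))
                  (linear alt [] {x} {x} (w x) 0ℤ xs (λ i → lemma₀ (w x) (x i))))
           (sum-substitute α s w (alternating-∷ alt x) eqs) ⟩
    w x * Φ (x ∷ xs) + 0ℤ * Φ (x ∷ xs) + total * Φ (x ∷ xs)
      ≡⟨ lemma (w x) total (Φ (x ∷ xs)) ⟩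
    (w x + total) * Φ (x ∷ xs) ∎
    where
    total : ℤ
    total = foldr (λ x t → w x + t) 0ℤ xs
    lemma₀ : ∀ a u → a * u ≡ a * u + 0ℤ * u
    lemma₀ = solve-∀
    lemma : ∀ a t u → a * u + 0ℤ * u + t * u ≡ (a + t) * u
    lemma = solve-∀

-- Jucys-Murphy elements and their product on the adapted basis

module JucysMurphy where
  open import Data.Integer.Tactic.RingSolver using (solve-∀)
  open import Data.Integer.Base using (_+_; _*_; _-_; -_)
  open Sums ℤ.+-*-commutativeRing
  open Exterior
  open ≡.≡-Reasoning

  sum-const : ∀ k c → sum {k} (λ _ → c) ≡ + k * c
  sum-const zero    c = sym (ℤ.*-zeroˡ c)
  sum-const (suc k) c = trans (cong (λ t → c + t) (sum-const k c)) (sym (ℤ.suc-* (+ k) c))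

  trues falses : ∀ {d} → Vec Bool d → ℕ
  trues []          = 0
  trues (true  ∷ I) = suc (trues I)
  trues (false ∷ I) = trues I
  falses []          = 0
  falses (true  ∷ I) = falses I
  falses (false ∷ I) = suc (falses I)

  trues+falses : ∀ {d} (I : Vec Bool d) → trues I ℕ.+ falses I ≡ d
  trues+falses []          = refl
  trues+falses (true  ∷ I) = cong suc (trues+falses I)
  trues+falses (false ∷ I) = trans (ℕ.+-suc (trues I) (falses I)) (cong suc (trues+falses I))

  extend : ∀ {n} → V n → V (suc n)
  extend y zero    = 0ℤ
  extend y (suc i) = y i

  extend-linear : ∀ {n} {x y z : V n} a b → (∀ i → z i ≡ a * x i + b * y i) →
                  ∀ i → extend z i ≡ a * extend x i + b * extend y i
  extend-linear a b eq zero    = sym (cong₂ _+_ (ℤ.*-zeroʳ a) (ℤ.*-zeroʳ b))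
  extend-linear a b eq (suc i) = eq i

  -- The sum-zero vector invariant under all permutations that fix the letter 0, scaled to have
  -- integer entries.
  apex : ∀ k → V (suc k)
  apex k zero    = - + k
  apex k (suc _) = 1ℤ

  -- An orthogonal basis of the standard representation of Sym (suc d), adapted
  -- to the chain of subgroups fixing the letters 0, 1, …; I selects a part of it.
  basis : ∀ {d} → Vec Bool d → List (V (suc d))
  basis         []          = []
  basis {suc d} (true  ∷ I) = apex (suc d) ∷ map extend (basis I)
  basis         (false ∷ I) = map extend (basis I)

  -- The content of the box of the letter m in the hook tableau whose leg is
  -- given by I.
  content : ∀ {d} → Vec Bool d → Fin d → ℤ
  content (_     ∷ I) (suc m) = content I m
  content (false ∷ I) zero    = + suc (falses I)
  content (true  ∷ I) zero    = -[1+ trues I ]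

  above : ∀ {d} → Fin d → ℕ
  above {suc d} zero    = suc d
  above         (suc m) = above m

  -- The transpositions of m with the letters above it, whose sum is a
  -- Jucys–Murphy element.
  swaps : ∀ {d} (m : Fin d) → Fin (above m) → Permutation′ (suc d)
  swaps zero    j = transpose zero (suc j)
  swaps (suc m) j = lift₀ (swaps m j)

  act : ∀ {n} → Permutation′ n → List (V n) → List (V n)
  act σ = map (_∘ (σ ⟨$⟩ʳ_))

  act-∘ : ∀ {n} (σ τ : Permutation′ n) xs → act (σ ∘ₚ τ) xs ≡ act σ (act τ xs)
  act-∘ σ τ = List.map-∘ {g = _∘ (σ ⟨$⟩ʳ_)} {f = _∘ (τ ⟨$⟩ʳ_)}

  basis-sum : ∀ {d} (I : Vec Bool d) → All (λ x → sum x ≡ 0ℤ) (basis I)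
  basis-sum [] = []
  basis-sum {suc d} (b ∷ I) with All.map⁺ {P = λ x → sum x ≡ 0ℤ} {f = extend} (All.map (trans (ℤ.+-identityˡ _)) (basis-sum I))
  basis-sum {suc d} (false ∷ I) | rest = rest
  basis-sum {suc d} (true ∷ I)  | rest = apex-sum ∷ rest
    where
    apex-sum : sum (apex (suc d)) ≡ 0ℤ
    apex-sum = begin
      - + suc d + sum {suc d} (λ _ → 1ℤ)  ≡⟨ cong (λ t → - + suc d + t) (sum-const (suc d) 1ℤ) ⟩
      - + suc d + + suc d * 1ℤ            ≡⟨ lemma (+ suc d) ⟩
      0ℤ                                  ∎
      where
      lemma : ∀ u → - u + u * 1ℤ ≡ 0ℤ
      lemma = solve-∀

  private
    length-basis : ∀ {d} (I : Vec Bool d) → length (basis I) ≡ trues I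
    length-basis []          = refl
    length-basis (true  ∷ I) = cong suc (trans (List.length-map extend (basis I)) (length-basis I))
    length-basis (false ∷ I) = trans (List.length-map extend (basis I)) (length-basis I)

    module _ {k : ℕ} where
      -- `root j` is e_0 - e_(j+1) and `α j` is the pairing with it. The squared length of a root is
      -- 2, so the reflection formula needs no denominator.
      α : Fin k → V (suc k) → ℤ
      α j x = x zero - x (suc j)

      root : Fin k → V (suc k)
      root j zero    = 1ℤ
      root j (suc i) = - δ i j

      reflects : ∀ j x i → x (transpose zero (suc j) ⟨$⟩ʳ i) ≡ x i - α j x * root j i
      reflects j x zero    = lemma (x zero) (x (suc j))
        where
        lemma : ∀ u v → v ≡ u - (u - v) * 1ℤ
        lemma = solve-∀
      reflects j x (suc i) with i Fin.≟ j
      ... | yes refl = lemma (x zero) (x (suc i))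
        where
        lemma : ∀ u v → u ≡ v - (u - v) * (- 1ℤ)
        lemma = solve-∀
      ... | no _     = lemma (x (suc i)) (α j x)
        where
        lemma : ∀ u v → u ≡ u - v * (- 0ℤ)
        lemma = solve-∀

      casimir-zero : ∀ (x : V (suc k)) → sum (λ j → α j x * root j zero) ≡ + suc k * x zero - sum x
      casimir-zero x = begin
        sum (λ j → (x zero - x (suc j)) * 1ℤ)
          ≡⟨ sum-linear {k} 1ℤ (- 1ℤ) (λ _ → x zero) (λ j → x (suc j)) _ (λ j → lemma₁ (x zero) (x (suc j))) ⟩
        1ℤ * sum {k} (λ _ → x zero) + (- 1ℤ) * sum (λ j → x (suc j))
          ≡⟨ cong (λ t → 1ℤ * t + (- 1ℤ) * sum (λ j → x (suc j))) (sum-const k (x zero)) ⟩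
        1ℤ * (+ k * x zero) + (- 1ℤ) * sum (λ j → x (suc j))
          ≡⟨ lemma₂ (+ k) (x zero) _ ⟩
        (1ℤ + + k) * x zero - (x zero + sum (λ j → x (suc j))) ∎
        where
        lemma₁ : ∀ u v → (u - v) * 1ℤ ≡ 1ℤ * u + (- 1ℤ) * v
        lemma₁ = solve-∀
        lemma₂ : ∀ k u s → 1ℤ * (k * u) + (- 1ℤ) * s ≡ (1ℤ + k) * u - (u + s)
        lemma₂ = solve-∀

      casimir-suc : ∀ (x : V (suc k)) i → sum (λ j → α j x * root j (suc i)) ≡ x (suc i) - x zero
      casimir-suc x i = begin
        sum (λ j → α j x * (- δ i j))  ≡⟨ sum-cong-≋ {k} (λ j → lemma₁ (x zero) (x (suc j)) (δ i j)) ⟩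
        dot (δ i) (λ j → x (suc j) - x zero)  ≡⟨ dot-δˡ i (λ j → x (suc j) - x zero) ⟩
        x (suc i) - x zero                    ∎
        where
        lemma₁ : ∀ u v w → (u - v) * (- w) ≡ w * (v - u)
        lemma₁ = solve-∀

    -- The eigenvalue on a basis vector of the sum of r rᵀ over the roots r: it is
    -- suc k on the apex and 1 on the extended vectors.
    level : ∀ {k} → V (suc k) → ℤ
    level x = 1ℤ - x zero

    total : ∀ {k} → List (V (suc k)) → ℤ
    total = foldr (λ x t → level x + t) 0ℤ

    total-extend : ∀ {k} (xs : List (V k)) → total (map extend xs) ≡ + length xs
    total-extend []       = refl
    total-extend (x ∷ xs) = cong (λ t → 1ℤ + t) (total-extend xs)

    casimir-extend : ∀ {d} (I : Vec Bool d) →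
      All (λ x → ∀ i → sum (λ j → α j x * root j i) ≡ level x * x i) (map extend (basis I))
    casimir-extend {d} I = All.map⁺ (All.map (λ {y} → eigen y) (basis-sum I))
      where
      lemma₁ : ∀ k → k * 0ℤ - (0ℤ + 0ℤ) ≡ (1ℤ - 0ℤ) * 0ℤ
      lemma₁ = solve-∀
      lemma₂ : ∀ u → u - 0ℤ ≡ (1ℤ - 0ℤ) * u
      lemma₂ = solve-∀
      eigen : ∀ y → sum y ≡ 0ℤ → ∀ i → sum (λ j → α j (extend y) * root j i) ≡ level (extend y) * extend y i
      eigen y Σy≡0 zero    = trans (casimir-zero (extend y))
        (trans (cong (λ t → + suc (suc d) * 0ℤ - (0ℤ + t)) Σy≡0) (lemma₁ (+ suc (suc d))))
      eigen y Σy≡0 (suc i) = trans (casimir-suc (extend y) i) (lemma₂ (y i))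

    casimir : ∀ {d} (I : Vec Bool (suc d)) →
      All (λ x → ∀ i → sum (λ j → α j x * root j i) ≡ level x * x i) (basis I)
    casimir         (false ∷ I) = casimir-extend I
    casimir {d}     (true  ∷ I) = eigen ∷ casimir-extend I
      where
      lemma₁ : ∀ k → (1ℤ + k) * (- k) - 0ℤ ≡ (1ℤ - (- k)) * (- k)
      lemma₁ = solve-∀
      lemma₂ : ∀ k → 1ℤ - (- k) ≡ (1ℤ - (- k)) * 1ℤ
      lemma₂ = solve-∀
      eigen : ∀ i → sum (λ j → α j (apex (suc d)) * root j i) ≡ level (apex (suc d)) * apex (suc d) i
      eigen zero    = trans (casimir-zero (apex (suc d)))
        (trans (cong (λ t → + suc (suc d) * (- + suc d) - t) (All.head (basis-sum (true ∷ I))))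
          (lemma₁ (+ suc d)))
      eigen (suc i) = trans (casimir-suc (apex (suc d)) i) (lemma₂ (+ suc d))

    -- Extended vectors have level 1 and the apex has level `suc (suc d)`, so the difference is
    -- `suc d - trues I` or `-1 - trues I`; the former equals `suc (falses I)` because the two
    -- counts add up to `d`.
    content-total : ∀ {d} b (I : Vec Bool d) → + suc d - total (basis (b ∷ I)) ≡ content (b ∷ I) zero
    content-total {d} b I = go b
      where
      d≡ : + d ≡ + trues I + + falses I
      d≡ = trans (cong +_ (sym (trues+falses I))) (ℤ.pos-+ (trues I) (falses I))
      tail≡ : total (map extend (basis I)) ≡ + trues I
      tail≡ = trans (total-extend (basis I)) (cong +_ (length-basis I))
      lemma-f : ∀ t f → (1ℤ + (t + f)) - t ≡ 1ℤ + f
      lemma-f = solve-∀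
      lemma-t : ∀ d t → (1ℤ + d) - ((1ℤ - (- (1ℤ + d))) + t) ≡ - (1ℤ + t)
      lemma-t = solve-∀
      go : ∀ b → + suc d - total (basis (b ∷ I)) ≡ content (b ∷ I) zero
      go false = trans (cong₂ (λ u v → (1ℤ + u) - v) d≡ tail≡) (lemma-f (+ trues I) (+ falses I))
      go true  = trans (cong (λ v → + suc d - ((1ℤ - (- + suc d)) + v)) tail≡) (lemma-t (+ d) (+ trues I))

    swaps-zero : ∀ {d} b (I : Vec Bool d) {Φ} → Alternating Φ →
      sum (λ j → Φ (act (transpose zero (suc j)) (basis (b ∷ I)))) ≡ content (b ∷ I) zero * Φ (basis (b ∷ I))
    swaps-zero {d} b I {Φ} alt = begin
      sum (λ j → Φ (act (transpose zero (suc j)) B))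
        ≡⟨ sum-linear 1ℤ (- 1ℤ) (λ _ → Φ B) (λ j → substitute (α j) (root j) Φ B) _ (λ j →
             trans (reflection (α j) (root j) _ (reflects j) alt B) (lemma₁ (Φ B) _)) ⟩
      1ℤ * sum {suc d} (λ _ → Φ B) + (- 1ℤ) * sum (λ j → substitute (α j) (root j) Φ B)
        ≡⟨ cong₂ (λ s t → 1ℤ * s + (- 1ℤ) * t) (sum-const (suc d) (Φ B))
             (sum-substitute α root level alt (casimir (b ∷ I))) ⟩
      1ℤ * (+ suc d * Φ B) + (- 1ℤ) * (total B * Φ B)
        ≡⟨ lemma₂ (+ suc d) (total B) (Φ B) ⟩
      (+ suc d - total B) * Φ B
        ≡⟨ cong (_* Φ B) (content-total b I) ⟩
      content (b ∷ I) zero * Φ B ∎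
      where
      B : List (V (suc (suc d)))
      B = basis (b ∷ I)
      lemma₁ : ∀ u v → u - v ≡ 1ℤ * u + (- 1ℤ) * v
      lemma₁ = solve-∀
      lemma₂ : ∀ k t u → 1ℤ * (k * u) + (- 1ℤ) * (t * u) ≡ (k - t) * u
      lemma₂ = solve-∀

  alternating-extend : ∀ {n Φ} → Alternating {suc n} Φ → Alternating (λ xs → Φ (map extend xs))
  alternating-extend alt = alternating-map alt extend extend-linear

  -- The form with the contribution of the letter 0 filled in. Permutations fixing 0 leave the apex
  -- alone, so on the remaining arguments they act as permutations of one letter fewer.
  restrict : ∀ {d} → Bool → (List (V (suc (suc d))) → ℤ) → List (V (suc d)) → ℤ
  restrict {d} true  Φ xs = Φ (apex (suc d) ∷ map extend xs)
  restrict     false Φ xs = Φ (map extend xs)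

  restrict-alternating : ∀ {d Φ} b → Alternating Φ → Alternating (restrict {d} b Φ)
  restrict-alternating true  alt = alternating-extend (alternating-∷ alt (apex _))
  restrict-alternating false alt = alternating-extend alt

  restrict-basis : ∀ {d} b (I : Vec Bool d) Φ → restrict b Φ (basis I) ≡ Φ (basis (b ∷ I))
  restrict-basis true  I Φ = refl
  restrict-basis false I Φ = refl

  act-extend : ∀ {n} (σ : Permutation′ n) xs → Pointwise _≗_ (act (lift₀ σ) (map extend xs)) (map extend (act σ xs))
  act-extend σ []       = []
  act-extend σ (x ∷ xs) = (λ { zero → refl ; (suc i) → refl }) ∷ act-extend σ xs

  restrict-act : ∀ {d Φ} b (I : Vec Bool d) → Alternating Φ → (σ : Permutation′ (suc d)) →
                 Φ (act (lift₀ σ) (basis (b ∷ I))) ≡ restrict b Φ (act σ (basis I))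
  restrict-act true  I alt σ = congruent alt ((λ { zero → refl ; (suc i) → refl }) ∷ act-extend σ (basis I))
  restrict-act false I alt σ = congruent alt (act-extend σ (basis I))

  swaps-eigen : ∀ {d} (I : Vec Bool d) m {Φ} → Alternating Φ →
    sum (λ j → Φ (act (swaps m j) (basis I))) ≡ content I m * Φ (basis I)
  swaps-eigen (b ∷ I) zero    alt = swaps-zero b I alt
  swaps-eigen (b ∷ I) (suc m) {Φ} alt = begin
    sum (λ j → Φ (act (lift₀ (swaps m j)) (basis (b ∷ I))))
      ≡⟨ sum-cong-≋ {above m} (λ j → restrict-act b I alt (swaps m j)) ⟩
    sum (λ j → restrict b Φ (act (swaps m j) (basis I)))
      ≡⟨ swaps-eigen I m (restrict-alternating b alt) ⟩
    content I m * restrict b Φ (basis I)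
      ≡⟨ cong (content I m *_) (restrict-basis b I Φ) ⟩
    content (b ∷ I) (suc m) * Φ (basis (b ∷ I)) ∎

  -- The sum over the cycles of length suc d, as the product of the
  -- Jucys–Murphy elements.
  cycleSum : ∀ d → (Permutation′ (suc d) → ℤ) → ℤ
  cycleSum zero    F = F Perm.id
  cycleSum (suc d) F = cycleSum d λ σ → sum λ j → F (lift₀ σ ∘ₚ transpose zero (suc j))

  cycleSum-cong : ∀ d {F G} → (∀ σ → F σ ≡ G σ) → cycleSum d F ≡ cycleSum d G
  cycleSum-cong zero    eq = eq Perm.id
  cycleSum-cong (suc d) eq = cycleSum-cong d λ σ → sum-cong-≋ {suc d} λ j → eq (lift₀ σ ∘ₚ transpose zero (suc j))

  cycleSum-scale : ∀ d a F → cycleSum d (λ σ → a * F σ) ≡ a * cycleSum d F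
  cycleSum-scale zero    a F = refl
  cycleSum-scale (suc d) a F = trans
    (cycleSum-cong d λ σ → sym (*-distribˡ-sum {suc d} a λ j → F (lift₀ σ ∘ₚ transpose zero (suc j))))
    (cycleSum-scale d a _)

  eigenvalue : ∀ {d} → Vec Bool d → ℤ
  eigenvalue []      = 1ℤ
  eigenvalue (b ∷ I) = content (b ∷ I) zero * eigenvalue I

  -- For fixed `σ` the form `Φ ∘ act (lift₀ σ)` is again alternating, so the inner sum over
  -- transpositions contributes the content of 0 as a scalar. What remains involves only
  -- permutations fixing 0 and is the same statement for a restricted form.
  cycleSum-eigen : ∀ {d} (I : Vec Bool d) {Φ} → Alternating Φ →
    cycleSum d (λ σ → Φ (act σ (basis I))) ≡ eigenvalue I * Φ (basis I)
  cycleSum-eigen []      {Φ} alt = sym (ℤ.*-identityˡ (Φ []))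
  cycleSum-eigen {suc d} (b ∷ I) {Φ} alt = begin
    cycleSum d (λ σ → sum λ j → Φ (act (lift₀ σ ∘ₚ transpose zero (suc j)) (basis (b ∷ I))))
      ≡⟨ cycleSum-cong d (λ σ → trans
           (sum-cong-≋ {suc d} λ j → cong Φ (act-∘ (lift₀ σ) (transpose zero (suc j)) (basis (b ∷ I))))
           (swaps-eigen (b ∷ I) zero (alternating-∘ alt (lift₀ σ ⟨$⟩ʳ_)))) ⟩
    cycleSum d (λ σ → c * Φ (act (lift₀ σ) (basis (b ∷ I))))
      ≡⟨ cycleSum-scale d c _ ⟩
    c * cycleSum d (λ σ → Φ (act (lift₀ σ) (basis (b ∷ I))))
      ≡⟨ cong (c *_) (cycleSum-cong d (restrict-act b I alt)) ⟩
    c * cycleSum d (λ σ → restrict b Φ (act σ (basis I)))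
      ≡⟨ cong (c *_) (cycleSum-eigen I (restrict-alternating b alt)) ⟩
    c * (eigenvalue I * restrict b Φ (basis I))
      ≡⟨ ℤ.*-assoc c (eigenvalue I) _ ⟨
    c * eigenvalue I * restrict b Φ (basis I)
      ≡⟨ cong (c * eigenvalue I *_) (restrict-basis b I Φ) ⟩
    eigenvalue (b ∷ I) * Φ (basis (b ∷ I)) ∎
    where
    c : ℤ
    c = content (b ∷ I) zero

-- Sums over the symmetric group and over its long cycles

module GroupSums where
  open import Data.Integer.Base using (_+_; _*_)
  open Sums ℤ.+-*-commutativeRing
  open JucysMurphy using (cycleSum; cycleSum-cong)
  open ≡.≡-Reasoning

  Invariant : ∀ {n} → (Permutation′ n → ℤ) → Set
  Invariant F = ∀ π ρ → π Perm.≈ ρ → F π ≡ F ρ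

  groupSum : ∀ n → (Permutation′ n → ℤ) → ℤ
  groupSum n F = sum λ k → F (decode n k)

  groupSum-cong : ∀ n {F G} → (∀ π → F π ≡ G π) → groupSum n F ≡ groupSum n G
  groupSum-cong n eq = sum-cong-≋ {n !} λ k → eq (decode n k)

  decode-encode : ∀ n π → decode n (encode n π) Perm.≈ π
  decode-encode n π = Inverse.inverseˡ (FiniteGroup.enumeration (Sym n)) refl

  private
    encode-cong : ∀ n {π ρ} → π Perm.≈ ρ → encode n π ≡ encode n ρ
    encode-cong n {π} {ρ} = Inverse.from-cong (FiniteGroup.enumeration (Sym n)) {π} {ρ}

    encode-decode : ∀ n k → encode n (decode n k) ≡ k
    encode-decode n k = Inverse.inverseʳ (FiniteGroup.enumeration (Sym n)) {y = decode n k} λ _ → refl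

  groupSum-reindex : ∀ n {F} → Invariant F → (f g : Permutation′ n → Permutation′ n) →
    (∀ π ρ → π Perm.≈ ρ → f π Perm.≈ f ρ) → (∀ π ρ → π Perm.≈ ρ → g π Perm.≈ g ρ) →
    (∀ π → f (g π) Perm.≈ π) → (∀ π → g (f π) Perm.≈ π) →
    groupSum n F ≡ groupSum n (F ∘ f)
  groupSum-reindex n {F} F-inv f g f-cong g-cong fg gf = begin
    groupSum n F
      ≡⟨ sum-permute (λ k → F (decode n k)) (Perm.permutation
           (λ k → encode n (f (decode n k))) (λ k → encode n (g (decode n k)))
           (cancel f g f-cong fg) (cancel g f g-cong gf)) ⟩
    groupSum n (λ π → F (decode n (encode n (f π))))
      ≡⟨ groupSum-cong n (λ π → F-inv (decode n (encode n (f π))) (f π) (decode-encode n (f π))) ⟩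
    groupSum n (F ∘ f) ∎
    where
    cancel : ∀ (f g : Permutation′ n → Permutation′ n) → (∀ π ρ → π Perm.≈ ρ → f π Perm.≈ f ρ) →
             (∀ π → f (g π) Perm.≈ π) → ∀ k → encode n (f (decode n (encode n (g (decode n k))))) ≡ k
    cancel f g f-cong fg k = trans
      (encode-cong n {ρ = decode n k} λ i → trans
        (f-cong (decode n (encode n (g (decode n k)))) (g (decode n k)) (decode-encode n (g (decode n k))) i)
        (fg (decode n k) i))
      (encode-decode n k)

  groupSum-∘ₚʳ : ∀ n {F} → Invariant F → ∀ κ → groupSum n F ≡ groupSum n (λ π → F (π ∘ₚ κ))
  groupSum-∘ₚʳ n {F} F-inv κ = groupSum-reindex n {F} F-inv (_∘ₚ κ) (_∘ₚ Perm.flip κ)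
    (λ _ _ π≈ρ i → cong (κ ⟨$⟩ʳ_) (π≈ρ i)) (λ _ _ π≈ρ i → cong (κ ⟨$⟩ˡ_) (π≈ρ i))
    (λ π i → Perm.inverseʳ κ) (λ π i → Perm.inverseˡ κ)

  groupSum-∘ₚˡ : ∀ n {F} → Invariant F → ∀ κ → groupSum n F ≡ groupSum n (λ π → F (κ ∘ₚ π))
  groupSum-∘ₚˡ n {F} F-inv κ = groupSum-reindex n {F} F-inv (κ ∘ₚ_) (Perm.flip κ ∘ₚ_)
    (λ _ _ π≈ρ i → π≈ρ (κ ⟨$⟩ʳ i)) (λ _ _ π≈ρ i → π≈ρ (κ ⟨$⟩ˡ i))
    (λ π i → cong (π ⟨$⟩ʳ_) (Perm.inverseˡ κ)) (λ π i → cong (π ⟨$⟩ʳ_) (Perm.inverseʳ κ))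

  transpose-comm : ∀ {n} (i j k : Fin n) → transpose i j ⟨$⟩ʳ k ≡ transpose j i ⟨$⟩ʳ k
  transpose-comm i j k with k Fin.≟ i in k≟i | k Fin.≟ j in k≟j
  ... | yes refl | yes refl = refl
  ... | yes refl | no _     rewrite k≟i = refl
  ... | no _     | yes refl rewrite k≟j = refl
  ... | no _     | no _     rewrite k≟i | k≟j = refl

  transpose-involutive : ∀ {n} (i j k : Fin n) → transpose i j ⟨$⟩ʳ (transpose i j ⟨$⟩ʳ k) ≡ k
  transpose-involutive i j k = trans (cong (transpose i j ⟨$⟩ʳ_) (transpose-comm i j k))
    (Components.transpose-inverse i j)

  transpose-matchʳ : ∀ {n} (i j : Fin n) → transpose i j ⟨$⟩ʳ j ≡ i
  transpose-matchʳ i j with j Fin.≟ i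
  ... | yes j≡i = j≡i
  ... | no _ with j Fin.≟ j
  ...   | yes _   = refl
  ...   | no  j≢j = contradiction refl j≢j

  transpose-fix : ∀ {n} (i j k : Fin n) → k ≢ i → k ≢ j → transpose i j ⟨$⟩ʳ k ≡ k
  transpose-fix i j k k≢i k≢j with k Fin.≟ i
  ... | yes k≡i = contradiction k≡i k≢i
  ... | no _ with k Fin.≟ j
  ...   | yes k≡j = contradiction k≡j k≢j
  ...   | no _    = refl

  sum-++ : ∀ m {n} (f : Fin (m ℕ.+ n) → ℤ) → sum f ≡ sum (λ i → f (i ↑ˡ n)) + sum (λ j → f (m ↑ʳ j))
  sum-++ zero    f = sym (ℤ.+-identityˡ (sum f))
  sum-++ (suc m) f = trans (cong (λ t → f zero + t) (sum-++ m (f ∘ suc))) (sym (ℤ.+-assoc (f zero) _ _))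

  sum-combine : ∀ m n (f : Fin (m ℕ.* n) → ℤ) → sum f ≡ sum (λ i → sum (λ j → f (combine {m} i j)))
  sum-combine zero    n f = refl
  sum-combine (suc m) n f = trans (sum-++ n f)
    (cong (λ t → sum (λ j → f (j ↑ˡ (m ℕ.* n))) + t) (sum-combine m n (λ k → f (n ↑ʳ k))))

  -- Decomposition into cosets by the value at 0. The coding relabels the other letters by the
  -- monotone `punchIn j`, which the transposition does not; the discrepancy `κ j` does not depend
  -- on `π` and is absorbed by a translation.
  groupSum-suc : ∀ n {F} → Invariant F →
    groupSum (suc n) F ≡ sum λ j → groupSum n λ π → F (lift₀ π ∘ₚ transpose zero j)
  groupSum-suc n {F} F-inv = trans (sum-combine (suc n) (n !) _) (sum-cong-≋ {suc n} λ j → begin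
    sum (λ l → F (decode (suc n) (combine {suc n} j l)))
      ≡⟨ sum-cong-≋ {n !} (λ l → cong (λ (j , l) → F (insert zero j (decode n l))) (Fin.remQuot-combine {suc n} j l)) ⟩
    groupSum n (λ π → F (insert zero j π))
      ≡⟨ groupSum-cong n (λ π → F-inv (insert zero j π) (lift₀ (π ∘ₚ κ j) ∘ₚ transpose zero j) (factor j π)) ⟩
    groupSum n (λ π → F (lift₀ (π ∘ₚ κ j) ∘ₚ transpose zero j))
      ≡⟨ groupSum-∘ₚʳ n {λ π → F (lift₀ π ∘ₚ transpose zero j)}
           (λ π ρ π≈ρ → F-inv (lift₀ π ∘ₚ transpose zero j) (lift₀ ρ ∘ₚ transpose zero j) λ i → cong (transpose zero j ⟨$⟩ʳ_) (Perm.lift₀-cong π ρ π≈ρ i)) (κ j) ⟨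
    groupSum n (λ π → F (lift₀ π ∘ₚ transpose zero j)) ∎)
    where
    γ : Fin (suc n) → Permutation′ (suc n)
    γ j = insert zero j Perm.id ∘ₚ transpose zero j
    κ : Fin (suc n) → Permutation′ n
    κ j = remove zero (γ j)
    factor : ∀ j (π : Permutation′ n) → insert zero j π Perm.≈ lift₀ (π ∘ₚ κ j) ∘ₚ transpose zero j
    factor j π zero    = refl
    factor j π (suc i) = begin
      punchIn j (π ⟨$⟩ʳ i)
        ≡⟨ transpose-involutive zero j _ ⟨
      transpose zero j ⟨$⟩ʳ (γ j ⟨$⟩ʳ suc (π ⟨$⟩ʳ i))
        ≡⟨ cong (transpose zero j ⟨$⟩ʳ_) (Perm.lift₀-remove (γ j) (transpose-matchʳ zero j) (suc (π ⟨$⟩ʳ i))) ⟨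
      transpose zero j ⟨$⟩ʳ suc (κ j ⟨$⟩ʳ (π ⟨$⟩ʳ i)) ∎

  Lists : ∀ {n} → Permutation′ n → Permutation′ n → Set
  Lists π σ = ∀ i → π ⟨$⟩ʳ (σ ⟨$⟩ʳ i) ≡ σ ⟨$⟩ʳ next i

  private
    toℕ-next : ∀ {n} (i : Fin (suc n)) → toℕ (next i) ≡ suc (toℕ i) % suc n
    toℕ-next i = Fin.toℕ-fromℕ< _

    toℕ-next-< : ∀ {n} (i : Fin (suc n)) → toℕ i ℕ.< n → toℕ (next i) ≡ suc (toℕ i)
    toℕ-next-< i i<n = trans (toℕ-next i) (m<n⇒m%n≡m (ℕ.s≤s i<n))

    toℕ-next-≡ : ∀ {n} (i : Fin (suc n)) → toℕ i ≡ n → toℕ (next i) ≡ 0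
    toℕ-next-≡ {n} i i≡n = trans (toℕ-next i) (trans (cong (λ t → suc t % suc n) i≡n) (n%n≡0 (suc n)))

    next-inject₁ : ∀ {n} (i : Fin n) → next (inject₁ i) ≡ suc i
    next-inject₁ i = Fin.toℕ-injective (trans
      (toℕ-next-< (inject₁ i) (subst (ℕ._< _) (sym (Fin.toℕ-inject₁ i)) (Fin.toℕ<n i)))
      (cong suc (Fin.toℕ-inject₁ i)))

    next-suc : ∀ {n} (k : Fin (suc n)) →
      (next k ≡ zero × next (suc k) ≡ zero) ⊎ (next k ≢ zero × next (suc k) ≡ suc (next k))
    next-suc {n} k with ℕ.m≤n⇒m<n∨m≡n (ℕ.s≤s⁻¹ (Fin.toℕ<n k))
    ... | inj₂ k≡n = inj₁ (Fin.toℕ-injective (toℕ-next-≡ k k≡n) , Fin.toℕ-injective (toℕ-next-≡ (suc k) (cong suc k≡n)))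
    ... | inj₁ k<n = inj₂ ((λ eq → ℕ.1+n≢0 (trans (sym (toℕ-next-< k k<n)) (cong toℕ eq))) ,
                           Fin.toℕ-injective (trans (toℕ-next-< (suc k) (ℕ.s≤s k<n)) (cong suc (sym (toℕ-next-< k k<n)))))

  -- The listing advanced by one step is `ρ ∘ₚ π`, so induction over the position of `a` in the
  -- given listing reaches every starting letter.
  rotate : ∀ {n} π → IsNCycle {suc n} π → ∀ a → ∃ λ σ → Lists π σ × σ ⟨$⟩ʳ zero ≡ a
  rotate π (σ , π-lists-σ) a =
    let (ρ , lists , eq) = <-weakInduction (λ b → ∃ λ ρ → Lists π ρ × ρ ⟨$⟩ʳ zero ≡ σ ⟨$⟩ʳ b)
          (σ , π-lists-σ , refl)
          (λ i (ρ , lists , eq) → ρ ∘ₚ π , (λ k → cong (π ⟨$⟩ʳ_) (lists k)) , (begin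
            π ⟨$⟩ʳ (ρ ⟨$⟩ʳ zero)       ≡⟨ cong (π ⟨$⟩ʳ_) eq ⟩
            π ⟨$⟩ʳ (σ ⟨$⟩ʳ inject₁ i)  ≡⟨ π-lists-σ (inject₁ i) ⟩
            σ ⟨$⟩ʳ next (inject₁ i)    ≡⟨ cong (σ ⟨$⟩ʳ_) (next-inject₁ i) ⟩
            σ ⟨$⟩ʳ suc i               ∎))
          (σ ⟨$⟩ˡ a)
    in ρ , lists , trans eq (Perm.inverseʳ σ)

  -- Composing with the transposition inserts 0 into the cycle just before `suc j`. With the listing
  -- of `π` begun at `j`, and the longer one begun at 0, the insertion is a prefix: the longer
  -- listing is `lift₀ σ`.
  nCycle-extend : ∀ {n} (π : Permutation′ (suc n)) j →
                  IsNCycle π ⇔ IsNCycle (lift₀ π ∘ₚ transpose zero (suc j))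
  nCycle-extend π j = mk⇔ to from
    where
    τ : Permutation′ _
    τ = transpose zero (suc j)
    σ≢ : ∀ (σ : Permutation′ _) {k l} → k ≢ l → σ ⟨$⟩ʳ k ≢ σ ⟨$⟩ʳ l
    σ≢ σ k≢l = k≢l ∘ Injection.injective (↔⇒↣ σ)

    to : IsNCycle π → IsNCycle (lift₀ π ∘ₚ τ)
    to π-cycle with rotate π π-cycle j
    ... | σ , lists , refl = lift₀ σ , λ
      { zero    → refl
      ; (suc k) → trans (cong (λ l → τ ⟨$⟩ʳ suc l) (lists k)) (step k (next-suc k)) }
      where
      step : ∀ k → (next k ≡ zero × next (suc k) ≡ zero) ⊎ (next k ≢ zero × next (suc k) ≡ suc (next k)) →
             τ ⟨$⟩ʳ suc (σ ⟨$⟩ʳ next k) ≡ lift₀ σ ⟨$⟩ʳ next (suc k)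
      step k (inj₁ (eq , eq′)) rewrite eq | eq′ = transpose-matchʳ zero (suc j)
      step k (inj₂ (≢0 , eq′)) rewrite eq′ = transpose-fix zero (suc j) _ (λ ()) (σ≢ σ ≢0 ∘ Fin.suc-injective)

    from : IsNCycle (lift₀ π ∘ₚ τ) → IsNCycle π
    from cycle with rotate (lift₀ π ∘ₚ τ) cycle zero
    ... | σ̂ , lists , σ̂0≡0 = σ , λ k → Fin.suc-injective (begin
      suc (π ⟨$⟩ʳ (σ ⟨$⟩ʳ k))
        ≡⟨ transpose-involutive zero (suc j) _ ⟨
      τ ⟨$⟩ʳ (τ ⟨$⟩ʳ (lift₀ π ⟨$⟩ʳ suc (σ ⟨$⟩ʳ k)))
        ≡⟨ cong (λ l → τ ⟨$⟩ʳ (τ ⟨$⟩ʳ (lift₀ π ⟨$⟩ʳ l))) (lift-σ (suc k)) ⟩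
      τ ⟨$⟩ʳ (τ ⟨$⟩ʳ (lift₀ π ⟨$⟩ʳ (σ̂ ⟨$⟩ʳ suc k)))
        ≡⟨ cong (τ ⟨$⟩ʳ_) (trans (lists (suc k)) (sym (lift-σ (next (suc k))))) ⟩
      τ ⟨$⟩ʳ (lift₀ σ ⟨$⟩ʳ next (suc k))
        ≡⟨ step k (next-suc k) ⟩
      suc (σ ⟨$⟩ʳ next k) ∎)
      where
      σ : Permutation′ _
      σ = remove zero σ̂
      lift-σ : lift₀ σ Perm.≈ σ̂
      lift-σ = Perm.lift₀-remove σ̂ σ̂0≡0
      σ0≡j : σ ⟨$⟩ʳ zero ≡ j
      σ0≡j = Fin.suc-injective (begin
        suc (σ ⟨$⟩ʳ zero)                       ≡⟨ lift-σ (suc zero) ⟩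
        σ̂ ⟨$⟩ʳ suc zero                         ≡⟨ lists zero ⟨
        τ ⟨$⟩ʳ (lift₀ π ⟨$⟩ʳ (σ̂ ⟨$⟩ʳ zero))      ≡⟨ cong (λ l → τ ⟨$⟩ʳ (lift₀ π ⟨$⟩ʳ l)) σ̂0≡0 ⟩
        suc j                                   ∎)
      step : ∀ k → (next k ≡ zero × next (suc k) ≡ zero) ⊎ (next k ≢ zero × next (suc k) ≡ suc (next k)) →
             τ ⟨$⟩ʳ (lift₀ σ ⟨$⟩ʳ next (suc k)) ≡ suc (σ ⟨$⟩ʳ next k)
      step k (inj₁ (eq , eq′)) rewrite eq | eq′ = cong suc (sym σ0≡j)
      step k (inj₂ (≢0 , eq′)) rewrite eq′ =
        transpose-fix zero (suc j) _ (λ ()) (λ eq → σ≢ σ ≢0 (trans (Fin.suc-injective eq) (sym σ0≡j)))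

  indicator : ∀ {P : Set} → Dec P → ℤ
  indicator P? = if does P? then 1ℤ else 0ℤ

  cycleSum-sum : ∀ d {k} (F : Fin k → Permutation′ (suc d) → ℤ) →
                 sum (λ j → cycleSum d (F j)) ≡ cycleSum d (λ σ → sum (λ j → F j σ))
  cycleSum-sum zero        F = refl
  cycleSum-sum (suc d) {k} F = trans
    (cycleSum-sum d (λ j σ → sum λ i → F j (lift₀ σ ∘ₚ transpose zero (suc i))))
    (cycleSum-cong d λ σ → ∑-comm λ j i → F j (lift₀ σ ∘ₚ transpose zero (suc i)))

  IsNCycle-resp : ∀ {n} (π ρ : Permutation′ n) → π Perm.≈ ρ → IsNCycle π → IsNCycle ρ
  IsNCycle-resp π ρ π≈ρ (σ , lists) = σ , λ i → trans (sym (π≈ρ _)) (lists i)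

  indicator-cong : ∀ {n} (cycle? : ∀ π → Dec (IsNCycle {n} π)) π ρ → π Perm.≈ ρ →
                   indicator (cycle? π) ≡ indicator (cycle? ρ)
  indicator-cong cycle? π ρ π≈ρ = cong (if_then 1ℤ else 0ℤ)
    (does-⇔ (mk⇔ (IsNCycle-resp π ρ π≈ρ) (IsNCycle-resp ρ π (sym ∘ π≈ρ))) (cycle? π) (cycle? ρ))

  -- The trivial coset of the stabiliser of 0 contains no long cycle, as its members fix 0; on every
  -- other coset `nCycle-extend` reduces to one letter fewer.
  groupSum-nCycles : ∀ d (cycle? : ∀ π → Dec (IsNCycle {suc d} π)) {F} → Invariant F →
    groupSum (suc d) (λ π → indicator (cycle? π) * F π) ≡ cycleSum d F
  groupSum-nCycles zero cycle? {F} F-inv = trans (ℤ.+-identityʳ _)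
    (trans (cong (_* F π) ind≡1) (trans (ℤ.*-identityˡ _) (F-inv π Perm.id λ { zero → refl })))
    where
    π : Permutation′ 1
    π = decode 1 zero
    ind≡1 : indicator (cycle? π) ≡ 1ℤ
    ind≡1 with cycle? π
    ... | yes _ = refl
    ... | no ¬c = contradiction (Perm.id , λ { zero → refl }) ¬c
  groupSum-nCycles (suc d) cycle? {F} F-inv = begin
    groupSum (suc (suc d)) (λ π → indicator (cycle? π) * F π)
      ≡⟨ groupSum-suc (suc d) {λ π → indicator (cycle? π) * F π} (λ π ρ π≈ρ → cong₂ _*_
           (indicator-cong cycle? π ρ π≈ρ)
           (F-inv π ρ π≈ρ)) ⟩
    groupSum (suc d) (λ π → term zero π) + sum (λ j → groupSum (suc d) (term (suc j)))
      ≡⟨ cong₂ _+_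
           (sum-zero {suc d !} (λ k → term zero (decode (suc d) k)) (λ k → fixed (decode (suc d) k)))
           (sum-cong-≋ {suc d} λ j → trans (groupSum-cong (suc d) (cycle j))
             (groupSum-nCycles d cycle?′ {λ π → F (lift₀ π ∘ₚ transpose zero (suc j))}
               λ π ρ π≈ρ → F-inv (lift₀ π ∘ₚ transpose zero (suc j)) (lift₀ ρ ∘ₚ transpose zero (suc j)) λ i → cong (transpose zero (suc j) ⟨$⟩ʳ_) (Perm.lift₀-cong π ρ π≈ρ i))) ⟩
    0ℤ + sum (λ j → cycleSum d λ π → F (lift₀ π ∘ₚ transpose zero (suc j)))
      ≡⟨ ℤ.+-identityˡ _ ⟩
    sum (λ j → cycleSum d λ π → F (lift₀ π ∘ₚ transpose zero (suc j)))
      ≡⟨ cycleSum-sum d {suc d} (λ j π → F (lift₀ π ∘ₚ transpose zero (suc j))) ⟩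
    cycleSum (suc d) F ∎
    where
    term : Fin (suc (suc d)) → Permutation′ (suc d) → ℤ
    term j π = indicator (cycle? (lift₀ π ∘ₚ transpose zero j)) * F (lift₀ π ∘ₚ transpose zero j)

    -- A decision one degree lower, read off from the given one at `j = zero`; by `does-⇔` it has
    -- the right value at every other `j` as well.
    cycle?′ : ∀ π → Dec (IsNCycle {suc d} π)
    cycle?′ π = map′ (Equivalence.from (nCycle-extend π zero)) (Equivalence.to (nCycle-extend π zero))
                     (cycle? (lift₀ π ∘ₚ transpose zero (suc zero)))

    cycle : ∀ j π → term (suc j) π ≡ indicator (cycle?′ π) * F (lift₀ π ∘ₚ transpose zero (suc j))
    cycle j π = cong (λ b → (if b then 1ℤ else 0ℤ) * F (lift₀ π ∘ₚ transpose zero (suc j)))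
      (does-⇔ (⇔-sym (nCycle-extend π j)) (cycle? (lift₀ π ∘ₚ transpose zero (suc j))) (cycle?′ π))

    fixed : ∀ π → term zero π ≡ 0ℤ
    fixed π = cong (λ b → (if b then 1ℤ else 0ℤ) * F (lift₀ π ∘ₚ transpose zero zero)) (dec-false (cycle? (lift₀ π ∘ₚ transpose zero zero)) ¬cycle)
      where
      ¬cycle : ¬ IsNCycle (lift₀ π ∘ₚ transpose zero zero)
      ¬cycle c with rotate (lift₀ π ∘ₚ transpose zero zero) c zero
      ... | σ , lists , σ0≡0 = Fin.0≢1+n (begin
        zero                                                          ≡⟨ Perm.inverseˡ σ ⟨
        σ ⟨$⟩ˡ (σ ⟨$⟩ʳ zero)                                          ≡⟨ cong (σ ⟨$⟩ˡ_) σ0≡0 ⟩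
        σ ⟨$⟩ˡ zero                                                   ≡⟨ cong (λ l → σ ⟨$⟩ˡ (transpose zero zero ⟨$⟩ʳ (lift₀ π ⟨$⟩ʳ l))) σ0≡0 ⟨
        σ ⟨$⟩ˡ (transpose zero zero ⟨$⟩ʳ (lift₀ π ⟨$⟩ʳ (σ ⟨$⟩ʳ zero)))  ≡⟨ cong (σ ⟨$⟩ˡ_) (lists zero) ⟩
        σ ⟨$⟩ˡ (σ ⟨$⟩ʳ suc zero)                                      ≡⟨ Perm.inverseˡ σ ⟩
        suc zero                                                      ∎)

-- Matrix coefficients of the hooks: eigenvalues, orthogonality, nonvanishing

module MatrixCoefficients where
  open import Data.Integer.Tactic.RingSolver using (solve-∀)
  open import Data.Integer.Base using (_+_; _*_; _-_; -_)
  open Sums ℤ.+-*-commutativeRing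
  open Exterior
  open Alternating
  open JucysMurphy
  open GroupSums
  open ≡.≡-Reasoning

  -- The matrix coefficient of an exterior power of the standard representation
  -- (a hook representation) at the Gelfand–Tsetlin vectors I and J.
  coefficient : ∀ {d} → Vec Bool d → Vec Bool d → Permutation′ (suc d) → ℤ
  coefficient I J σ = gram (act σ (basis I)) (basis J)

  act-cong : ∀ {n} {σ τ : Permutation′ n} → σ Perm.≈ τ → ∀ xs → Pointwise _≗_ (act σ xs) (act τ xs)
  act-cong         σ≈τ []       = []
  act-cong {σ = σ} {τ} σ≈τ (x ∷ xs) = (λ i → cong x (σ≈τ i)) ∷ act-cong {σ = σ} {τ} σ≈τ xs

  coefficient-invariant : ∀ {d} (I J : Vec Bool d) → Invariant (coefficient I J)
  coefficient-invariant I J σ τ σ≈τ = congruent (gram-alternatingˡ (basis J)) (act-cong {σ = σ} {τ} σ≈τ (basis I))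

  private
    translate : ∀ {d} (J : Vec Bool d) (u : Permutation′ (suc d)) → Alternating (λ xs → gram (act u xs) (basis J))
    translate J u = alternating-∘ (gram-alternatingˡ (basis J)) (u ⟨$⟩ʳ_)

    coefficient-∘ₚ : ∀ {d} (I J : Vec Bool d) u σ → coefficient I J (u ∘ₚ σ) ≡ gram (act u (act σ (basis I))) (basis J)
    coefficient-∘ₚ I J u σ = cong (λ xs → gram xs (basis J)) (act-∘ u σ (basis I))

  coefficient-cycleSum : ∀ {d} (I J : Vec Bool d) u →
    cycleSum d (λ σ → coefficient I J (u ∘ₚ σ)) ≡ eigenvalue I * coefficient I J u
  coefficient-cycleSum {d} I J u = trans
    (cycleSum-cong d (coefficient-∘ₚ I J u)) (cycleSum-eigen I (translate J u))

  coefficient-swapsˡ : ∀ {d} (I J : Vec Bool d) m u →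
    sum (λ j → coefficient I J (u ∘ₚ swaps m j)) ≡ content I m * coefficient I J u
  coefficient-swapsˡ I J m u = trans
    (sum-cong-≋ {above m} λ j → coefficient-∘ₚ I J u (swaps m j)) (swaps-eigen I m (translate J u))

  swaps-involutive : ∀ {d} (m : Fin d) j i → swaps m j ⟨$⟩ʳ (swaps m j ⟨$⟩ʳ i) ≡ i
  swaps-involutive zero    j i       = transpose-involutive zero (suc j) i
  swaps-involutive (suc m) j zero    = refl
  swaps-involutive (suc m) j (suc i) = cong suc (swaps-involutive m j i)

  dot-involution : ∀ {n} (τ : Permutation′ n) → (∀ i → τ ⟨$⟩ʳ (τ ⟨$⟩ʳ i) ≡ i) →
                   ∀ x y → dot (x ∘ (τ ⟨$⟩ʳ_)) y ≡ dot x (y ∘ (τ ⟨$⟩ʳ_))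
  dot-involution {n} τ invol x y = trans
    (sum-permute (λ i → x (τ ⟨$⟩ʳ i) * y i) τ)
    (sum-cong-≋ {n} λ i → cong (λ l → x l * y (τ ⟨$⟩ʳ i)) (invol i))

  -- A transposition is self-adjoint for `dot`, so it passes from the translate of `basis I` to
  -- `basis J`, on which the sum acts by the content of `J`.
  coefficient-swapsʳ : ∀ {d} (I J : Vec Bool d) m u →
    sum (λ j → coefficient I J (swaps m j ∘ₚ u)) ≡ content J m * coefficient I J u
  coefficient-swapsʳ I J m u = trans
    (sum-cong-≋ {above m} λ j → trans (coefficient-∘ₚ I J (swaps m j) u)
      (gram-map _ _ (dot-involution (swaps m j) (swaps-involutive m j)) (act u (basis I)) (basis J)))
    (swaps-eigen J m (gram-alternatingʳ (act u (basis I))))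

  -- Contents are positive at `false` and negative at `true`, hence already differ at the first
  -- place where `I` and `J` do.
  content-separates : ∀ {d} {I J : Vec Bool d} → I ≢ J → ∃ λ m → content I m ≢ content J m
  content-separates {I = []}        {[]}        I≢J = contradiction refl I≢J
  content-separates {I = true ∷ I}  {false ∷ J} I≢J = zero , λ ()
  content-separates {I = false ∷ I} {true ∷ J}  I≢J = zero , λ ()
  content-separates {I = true ∷ I}  {true ∷ J}  I≢J =
    let (m , c≢) = content-separates (I≢J ∘ cong (true ∷_)) in suc m , c≢
  content-separates {I = false ∷ I} {false ∷ J} I≢J =
    let (m , c≢) = content-separates (I≢J ∘ cong (false ∷_)) in suc m , c≢

  private
    cancel-difference : ∀ {a b} s → a ≢ b → a * s ≡ b * s → s ≡ 0ℤ
    cancel-difference {a} {b} s a≢b eq with ℤ.i*j≡0⇒i≡0∨j≡0 (a - b) (trans (lemma a b s) (ℤ.i≡j⇒i-j≡0 eq))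
      where
      lemma : ∀ a b s → (a - b) * s ≡ a * s - b * s
      lemma = solve-∀
    ... | inj₁ a-b≡0 = contradiction (ℤ.i-j≡0⇒i≡j a b a-b≡0) a≢b
    ... | inj₂ s≡0   = s≡0

    -- Since the `f j` are involutions, the operator sending `F` to the sum of the `F ∘ f j` is
    -- self-adjoint for the group sum; its eigenfunctions for distinct eigenvalues are orthogonal.
    eigenfunctions-orthogonal : ∀ n {k} {F G} → Invariant F → Invariant G →
      (f : Fin k → Permutation′ n → Permutation′ n) → (∀ j π ρ → π Perm.≈ ρ → f j π Perm.≈ f j ρ) →
      (∀ j π → f j (f j π) Perm.≈ π) → ∀ {a b} → a ≢ b →
      (∀ u → sum (λ j → F (f j u)) ≡ a * F u) → (∀ u → sum (λ j → G (f j u)) ≡ b * G u) →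
      groupSum n (λ u → F u * G u) ≡ 0ℤ
    eigenfunctions-orthogonal n {k} {F} {G} F-inv G-inv f f-cong ff {a} {b} a≢b F-eigen G-eigen =
      cancel-difference {a} {b} (groupSum n (λ u → F u * G u)) a≢b (begin
        a * groupSum n (λ u → F u * G u)
          ≡⟨ *-distribˡ-sum a (λ l → F (decode n l) * G (decode n l)) ⟩
        groupSum n (λ u → a * (F u * G u))
          ≡⟨ groupSum-cong n (λ u → trans (sym (ℤ.*-assoc a (F u) (G u)))
               (trans (cong (_* G u) (sym (F-eigen u))) (*-distribʳ-sum (G u) (λ j → F (f j u))))) ⟩
        groupSum n (λ u → sum (λ j → F (f j u) * G u))
          ≡⟨ ∑-comm (λ l j → F (f j (decode n l)) * G (decode n l)) ⟩
        sum (λ j → groupSum n (λ u → F (f j u) * G u))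
          ≡⟨ sum-cong-≋ {k} (λ j → trans
               (groupSum-reindex n {λ u → F (f j u) * G u}
                 (λ π ρ π≈ρ → cong₂ _*_ (F-inv (f j π) (f j ρ) (f-cong j π ρ π≈ρ)) (G-inv π ρ π≈ρ))
                 (f j) (f j) (f-cong j) (f-cong j) (ff j) (ff j))
               (groupSum-cong n λ u → cong (_* G (f j u)) (F-inv (f j (f j u)) u (ff j u)))) ⟩
        sum (λ j → groupSum n (λ u → F u * G (f j u)))
          ≡⟨ ∑-comm (λ j l → F (decode n l) * G (f j (decode n l))) ⟩
        groupSum n (λ u → sum (λ j → F u * G (f j u)))
          ≡⟨ groupSum-cong n (λ u → trans (sym (*-distribˡ-sum (F u) (λ j → G (f j u))))
               (trans (cong (F u *_) (G-eigen u)) (lemma (F u) b (G u)))) ⟩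
        groupSum n (λ u → b * (F u * G u))
          ≡⟨ *-distribˡ-sum b (λ l → F (decode n l) * G (decode n l)) ⟨
        b * groupSum n (λ u → F u * G u) ∎)
      where
      lemma : ∀ u b v → u * (b * v) ≡ b * (u * v)
      lemma = solve-∀

  orthogonalˡ : ∀ {d} (I J I′ J′ : Vec Bool d) → I ≢ I′ →
                groupSum (suc d) (λ u → coefficient I J u * coefficient I′ J′ u) ≡ 0ℤ
  orthogonalˡ I J I′ J′ I≢I′ = let (m , c≢) = content-separates I≢I′ in
    eigenfunctions-orthogonal _ (coefficient-invariant I J) (coefficient-invariant I′ J′)
      (λ j u → u ∘ₚ swaps m j) (λ j π ρ π≈ρ i → cong (swaps m j ⟨$⟩ʳ_) (π≈ρ i))
      (λ j π i → swaps-involutive m j (π ⟨$⟩ʳ i)) c≢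
      (coefficient-swapsˡ I J m) (coefficient-swapsˡ I′ J′ m)

  orthogonalʳ : ∀ {d} (I J I′ J′ : Vec Bool d) → J ≢ J′ →
                groupSum (suc d) (λ u → coefficient I J u * coefficient I′ J′ u) ≡ 0ℤ
  orthogonalʳ I J I′ J′ J≢J′ = let (m , c≢) = content-separates J≢J′ in
    eigenfunctions-orthogonal _ (coefficient-invariant I J) (coefficient-invariant I′ J′)
      (λ j u → swaps m j ∘ₚ u) (λ j π ρ π≈ρ i → π≈ρ (swaps m j ⟨$⟩ʳ i))
      (λ j π i → cong (π ⟨$⟩ʳ_) (swaps-involutive m j i)) c≢
      (coefficient-swapsʳ I J m) (coefficient-swapsʳ I′ J′ m)

  infix  4 _⇝_
  infixr 5 _⨾_
  -- Exchanges of a neighbouring `true` and `false`. Each is realised by a linear relation between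
  -- one basis vector and the translates of another, and together they connect all subsets of a
  -- given size.
  data _⇝_ : ∀ {d} → Vec Bool d → Vec Bool d → Set where
    stay  : ∀ {d} {I : Vec Bool d} → I ⇝ I
    prep  : ∀ {d} b {I J : Vec Bool d} → I ⇝ J → b ∷ I ⇝ b ∷ J
    down  : ∀ {d} {I : Vec Bool d} → true ∷ false ∷ I ⇝ false ∷ true ∷ I
    up    : ∀ {d} {I : Vec Bool d} → false ∷ true ∷ I ⇝ true ∷ false ∷ I
    _⨾_   : ∀ {d} {I J K : Vec Bool d} → I ⇝ J → J ⇝ K → I ⇝ K

  ⇝-sym : ∀ {d} {I J : Vec Bool d} → I ⇝ J → J ⇝ I
  ⇝-sym stay       = stay
  ⇝-sym (prep b p) = prep b (⇝-sym p)
  ⇝-sym down       = up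
  ⇝-sym up         = down
  ⇝-sym (p ⨾ q)    = ⇝-sym q ⨾ ⇝-sym p

  private
    pull : ∀ {d k} (J : Vec Bool (suc d)) → trues J ≡ suc k → ∃ λ J′ → (true ∷ J′ ⇝ J) × trues J′ ≡ k
    pull (true ∷ J)          eq = J , stay , ℕ.suc-injective eq
    pull {zero}  (false ∷ []) ()
    pull {suc d} (false ∷ J) eq =
      let (J′ , p , eq′) = pull J eq in false ∷ J′ , down ⨾ prep false p , eq′

  ⇝-connected : ∀ d (I J : Vec Bool d) → trues I ≡ trues J → I ⇝ J
  ⇝-connected zero          []          []          eq = stay
  ⇝-connected (suc d)       (true ∷ I)  (true ∷ J)  eq = prep true (⇝-connected d I J (ℕ.suc-injective eq))
  ⇝-connected (suc d)       (false ∷ I) (false ∷ J) eq = prep false (⇝-connected d I J eq)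
  ⇝-connected (suc (suc d)) (true ∷ I)  (false ∷ J) eq =
    let (J′ , p , eq′) = pull J (sym eq) in
    prep true (⇝-connected (suc d) I (false ∷ J′) (sym eq′)) ⨾ (down ⨾ prep false p)
  ⇝-connected (suc (suc d)) (false ∷ I) (true ∷ J)  eq =
    let (I′ , p , eq′) = pull I eq in
    prep false (⇝-sym p) ⨾ (up ⨾ prep true (⇝-connected (suc d) (false ∷ I′) J eq′))
  ⇝-connected (suc zero)    (true ∷ [])  (false ∷ []) ()
  ⇝-connected (suc zero)    (false ∷ []) (true ∷ [])  ()

  -- Vanishing on the whole orbit, that is, on the subrepresentation generated by the product of
  -- `xs`.
  Null : ∀ {n} → (List (V n) → ℤ) → List (V n) → Set
  Null Φ xs = ∀ ρ → Φ (act ρ xs) ≡ 0ℤ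

  private
    -- A multiple of `y` is a combination of `x` and its translate by `τ`. As `τ` fixes the other
    -- arguments, translating `x` alone is the same as translating the whole list, which stays in
    -- the orbit; the nonzero factor `k` then cancels in ℤ.
    exchange : ∀ {n Φ} → Alternating {n} Φ → (τ : Permutation′ n) → ∀ x y {R} k a b → k ≢ 0ℤ →
      (∀ i → k * y i ≡ a * x i + b * x (τ ⟨$⟩ʳ i)) → Pointwise _≗_ (act τ R) R →
      Null Φ (x ∷ R) → Null Φ (y ∷ R)
    exchange {Φ = Φ} alt τ x y {R} k a b k≢0 eq R-fixed null ρ =
      [ (λ k≡0 → contradiction k≡0 k≢0) , id ]′ (ℤ.i*j≡0⇒i≡0∨j≡0 k (begin
        k * Φρ (y ∷ R)                             ≡⟨ lemma₁ k _ ⟩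
        k * Φρ (y ∷ R) + 0ℤ * Φρ (y ∷ R)           ≡⟨ linear altρ [] {y} {y} k 0ℤ R (λ i → lemma₁ k (y i)) ⟨
        Φρ ((λ i → k * y i) ∷ R)                   ≡⟨ linear altρ [] a b R eq ⟩
        a * Φρ (x ∷ R) + b * Φρ (x ∘ (τ ⟨$⟩ʳ_) ∷ R)
          ≡⟨ cong₂ (λ s t → a * s + b * t) (null ρ) (begin
               Φρ (x ∘ (τ ⟨$⟩ʳ_) ∷ R)              ≡⟨ congruent altρ {act τ (x ∷ R)} {x ∘ (τ ⟨$⟩ʳ_) ∷ R} ((λ _ → refl) ∷ R-fixed) ⟨
               Φρ (act τ (x ∷ R))                  ≡⟨ cong Φ (act-∘ ρ τ (x ∷ R)) ⟨
               Φ (act (ρ ∘ₚ τ) (x ∷ R))            ≡⟨ null (ρ ∘ₚ τ) ⟩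
               0ℤ                                  ∎) ⟩
        a * 0ℤ + b * 0ℤ                            ≡⟨ lemma₂ a b ⟩
        0ℤ                                         ∎))
      where
      Φρ : List (V _) → ℤ
      Φρ xs = Φ (act ρ xs)
      altρ : Alternating Φρ
      altρ = alternating-∘ alt (ρ ⟨$⟩ʳ_)
      lemma₁ : ∀ k u → k * u ≡ k * u + 0ℤ * u
      lemma₁ = solve-∀
      lemma₂ : ∀ a b → a * 0ℤ + b * 0ℤ ≡ 0ℤ
      lemma₂ = solve-∀

    extend²-fixed : ∀ {n} (xs : List (V n)) →
      Pointwise _≗_ (act (transpose zero (suc zero)) (map extend (map extend xs))) (map extend (map extend xs))
    extend²-fixed []       = []
    extend²-fixed (x ∷ xs) = (λ { zero → refl ; (suc zero) → refl ; (suc (suc i)) → refl }) ∷ extend²-fixed xs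

  -- Irreducibility of the hook in dual form. Under `prep` the letter 0 is common to both sides, so
  -- the restricted form inherits the vanishing from the permutations that fix 0.
  Null-⇝ : ∀ {d} {I J : Vec Bool d} → I ⇝ J → ∀ {Φ} → Alternating Φ → Null Φ (basis I) → Null Φ (basis J)
  Null-⇝ stay    alt null = null
  Null-⇝ (p ⨾ q) alt null = Null-⇝ q alt (Null-⇝ p alt null)
  Null-⇝ (prep b {I} {J} p) {Φ} alt null ρ = begin
    Φρ (basis (b ∷ J))                   ≡⟨ restrict-basis b J Φρ ⟨
    restrict b Φρ (basis J)              ≡⟨ cong (restrict b Φρ) (List.map-id (basis J)) ⟨
    restrict b Φρ (act Perm.id (basis J))
      ≡⟨ Null-⇝ p (restrict-alternating b altρ) (λ σ → begin
           restrict b Φρ (act σ (basis I))        ≡⟨ restrict-act b I altρ σ ⟨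
           Φρ (act (lift₀ σ) (basis (b ∷ I)))     ≡⟨ cong Φ (act-∘ ρ (lift₀ σ) (basis (b ∷ I))) ⟨
           Φ (act (ρ ∘ₚ lift₀ σ) (basis (b ∷ I))) ≡⟨ null (ρ ∘ₚ lift₀ σ) ⟩
           0ℤ                                     ∎) Perm.id ⟩
    0ℤ ∎
    where
    Φρ : List (V _) → ℤ
    Φρ xs = Φ (act ρ xs)
    altρ : Alternating Φρ
    altρ = alternating-∘ alt (ρ ⟨$⟩ʳ_)
  Null-⇝ (down {d} {I}) alt =
    -- Young's seminormal relation for the letters 0 and 1: with `x` the apex and `y` the extended
    -- smaller apex, (d + 3) y = x + (d + 2) τx.
    exchange alt (transpose zero (suc zero)) (apex (suc (suc d))) (extend (apex (suc d))) (+ suc (suc (suc d))) 1ℤ (+ suc (suc d)) (λ ())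
      (λ { zero → lemma₀ (+ d) ; (suc zero) → lemma₁ (+ d) ; (suc (suc i)) → lemma₂ (+ d) })
      (extend²-fixed (basis I))
    where
    lemma₀ : ∀ d → (1ℤ + (1ℤ + (1ℤ + d))) * 0ℤ ≡ 1ℤ * (- (1ℤ + (1ℤ + d))) + (1ℤ + (1ℤ + d)) * 1ℤ
    lemma₀ = solve-∀
    lemma₁ : ∀ d → (1ℤ + (1ℤ + (1ℤ + d))) * (- (1ℤ + d)) ≡ 1ℤ * 1ℤ + (1ℤ + (1ℤ + d)) * (- (1ℤ + (1ℤ + d)))
    lemma₁ = solve-∀
    lemma₂ : ∀ d → (1ℤ + (1ℤ + (1ℤ + d))) * 1ℤ ≡ 1ℤ * 1ℤ + (1ℤ + (1ℤ + d)) * 1ℤ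
    lemma₂ = solve-∀
  Null-⇝ (up {d} {I}) alt =
    -- The converse relation, with the roles of `x` and `y` exchanged: (d + 1) y = - x + (d + 2) τx.
    exchange alt (transpose zero (suc zero)) (extend (apex (suc d))) (apex (suc (suc d))) (+ suc d) (- 1ℤ) (+ suc (suc d)) (λ ())
      (λ { zero → lemma₀ (+ d) ; (suc zero) → lemma₁ (+ d) ; (suc (suc i)) → lemma₂ (+ d) })
      (extend²-fixed (basis I))
    where
    lemma₀ : ∀ d → (1ℤ + d) * (- (1ℤ + (1ℤ + d))) ≡ (- 1ℤ) * 0ℤ + (1ℤ + (1ℤ + d)) * (- (1ℤ + d))
    lemma₀ = solve-∀
    lemma₁ : ∀ d → (1ℤ + d) * 1ℤ ≡ (- 1ℤ) * (- (1ℤ + d)) + (1ℤ + (1ℤ + d)) * 0ℤ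
    lemma₁ = solve-∀
    lemma₂ : ∀ d → (1ℤ + d) * 1ℤ ≡ (- 1ℤ) * 1ℤ + (1ℤ + (1ℤ + d)) * 1ℤ
    lemma₂ = solve-∀

  -- `extend` is adjoint to dropping the coordinate 0, and dropping it after extending is the
  -- identity.
  gram-extend : ∀ {n} (xs ys : List (V n)) → gram (map extend xs) (map extend ys) ≡ gram xs ys
  gram-extend xs ys = trans
    (gram-map extend (_∘ suc) (λ x y → ℤ.+-identityˡ (dot x (y ∘ suc))) xs (map extend ys))
    (cong (gram xs) (trans (sym (List.map-∘ ys)) (List.map-id ys)))

  -- The apex is orthogonal to the extended vectors, because their entries sum to 0; the determinant
  -- is thus a product of squared norms.
  gram-basis≢0 : ∀ {d} (I : Vec Bool d) → gram (basis I) (basis I) ≢ 0ℤ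
  gram-basis≢0 []          = λ ()
  gram-basis≢0 (false ∷ I) = gram-basis≢0 I ∘ trans (sym (gram-extend (basis I) (basis I)))
  gram-basis≢0 {suc d} (true ∷ I) eq =
    [ norm≢0 , gram-basis≢0 I ]′ (ℤ.i*j≡0⇒i≡0∨j≡0 (dot a a) (begin
      dot a a * gram (basis I) (basis I)    ≡⟨ cong (dot a a *_) (gram-extend (basis I) (basis I)) ⟨
      dot a a * gram B B                    ≡⟨ ℤ.+-identityʳ _ ⟨
      dot a a * gram B B - 0ℤ               ≡⟨ cong (λ t → dot a a * gram B B - t)
                                                 (wedge-orthogonal a (λ ys → gram B (a ∷ ys)) a⊥B) ⟨
      gram (a ∷ B) (a ∷ B)                  ≡⟨ eq ⟩
      0ℤ                                    ∎))
    where
    a : V _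
    a = apex (suc d)
    B : List (V _)
    B = map extend (basis I)
    a⊥B : All (λ y → dot a y ≡ 0ℤ) B
    a⊥B = All.map⁺ (All.map (λ {y} Σy≡0 → trans
      (cong₂ _+_ (ℤ.*-zeroʳ (- + suc d)) (trans (sum-cong-≋ {suc d} λ i → ℤ.*-identityˡ (y i)) Σy≡0)) refl) (basis-sum I))
    norm≢0 : dot a a ≢ 0ℤ
    norm≢0 eq with trans (sym eq) (cong (λ t → (- + suc d) * (- + suc d) + t) (sum-const (suc d) 1ℤ))
    ... | ()

  -- Otherwise the pairing with `basis J` would vanish on the orbit of `basis I`, hence on `basis J`
  -- itself.
  coefficient-nonzero : ∀ {d} (I J : Vec Bool d) → trues I ≡ trues J → ¬ (∀ σ → coefficient I J σ ≡ 0ℤ)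
  coefficient-nonzero {d} I J eq null = gram-basis≢0 J (trans
    (cong (λ xs → gram xs (basis J)) (sym (List.map-id (basis J))))
    (Null-⇝ (⇝-connected d I J eq) (gram-alternatingˡ (basis J)) null Perm.id))

-- Subsets, binomial identities and the inequalities behind n ≥ 4

module Counting where
  open import Data.Nat.ListAction using (sum)
  open import Data.Nat.ListAction.Properties using (sum-++)
  open import Data.Nat.Tactic.RingSolver using (solve-∀)
  open import Data.Nat.Base using (_+_; _*_; _∸_; _^_; _≤_; _<_)
  open JucysMurphy
  open ≡.≡-Reasoning

  ∑ : ∀ {A : Set} → (A → ℕ) → List A → ℕ
  ∑ f xs = sum (map f xs)

  ∑-cong : ∀ {A : Set} {f g : A → ℕ} → (∀ x → f x ≡ g x) → ∀ xs → ∑ f xs ≡ ∑ g xs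
  ∑-cong eq xs = cong sum (List.map-cong eq xs)

  ∑-++ : ∀ {A : Set} (f : A → ℕ) xs ys → ∑ f (xs ++ ys) ≡ ∑ f xs + ∑ f ys
  ∑-++ f xs ys = trans (cong sum (List.map-++ f xs ys)) (sum-++ (map f xs) (map f ys))

  ∑-map : ∀ {A B : Set} (f : B → ℕ) (g : A → B) xs → ∑ f (map g xs) ≡ ∑ (f ∘ g) xs
  ∑-map f g xs = cong sum (sym (List.map-∘ xs))

  ∑-+ : ∀ {A : Set} (f g : A → ℕ) xs → ∑ (λ x → f x + g x) xs ≡ ∑ f xs + ∑ g xs
  ∑-+ f g []       = refl
  ∑-+ f g (x ∷ xs) = trans (cong (λ t → f x + g x + t) (∑-+ f g xs)) (lemma (f x) (g x) (∑ f xs) (∑ g xs))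
    where
    lemma : ∀ a b c d → a + b + (c + d) ≡ (a + c) + (b + d)
    lemma = solve-∀

  ∑-* : ∀ {A : Set} a (f : A → ℕ) xs → ∑ (λ x → a * f x) xs ≡ a * ∑ f xs
  ∑-* a f []       = sym (ℕ.*-zeroʳ a)
  ∑-* a f (x ∷ xs) = trans (cong (λ t → a * f x + t) (∑-* a f xs)) (sym (ℕ.*-distribˡ-+ a (f x) (∑ f xs)))

  ∑-const : ∀ {A : Set} a (xs : List A) → ∑ (λ _ → a) xs ≡ length xs * a
  ∑-const a []       = refl
  ∑-const a (x ∷ xs) = cong (λ t → a + t) (∑-const a xs)

  ∑-concatMap : ∀ {A B : Set} (f : B → ℕ) (g : A → List B) xs → ∑ f (concatMap g xs) ≡ ∑ (λ x → ∑ f (g x)) xs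
  ∑-concatMap f g []       = refl
  ∑-concatMap f g (x ∷ xs) = trans (∑-++ f (g x) _) (cong (λ t → ∑ f (g x) + t) (∑-concatMap f g xs))

  subsets : ∀ d → List (Vec Bool d)
  subsets zero    = [] ∷ []
  subsets (suc d) = map (true ∷_) (subsets d) ++ map (false ∷_) (subsets d)

  subsetsOfSize : ∀ d → ℕ → List (Vec Bool d)
  subsetsOfSize zero    zero    = [] ∷ []
  subsetsOfSize zero    (suc k) = []
  subsetsOfSize (suc d) zero    = map (false ∷_) (subsetsOfSize d zero)
  subsetsOfSize (suc d) (suc k) = map (true ∷_) (subsetsOfSize d k) ++ map (false ∷_) (subsetsOfSize d (suc k))

  -- The index set of the eigenfunctions: pairs of standard tableaux of a common hook shape.
  pairs : ∀ d → List (Vec Bool d × Vec Bool d)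
  pairs d = concatMap (λ I → map (I ,_) (subsetsOfSize d (trues I))) (subsets d)

  private
    head≢ : ∀ {d} (xs ys : List (Vec Bool d)) → All (λ x → All (x ≢_) (map (false ∷_) ys)) (map (true ∷_) xs)
    head≢ xs ys = All.map⁺ (All.universal (λ _ → All.map⁺ (All.universal (λ _ ()) ys)) xs)

    ∷-unique : ∀ {d} b {xs : List (Vec Bool d)} → AllPairs _≢_ xs → AllPairs _≢_ (map (b ∷_) xs)
    ∷-unique b = AllPairs.map⁺ ∘ AllPairs.map (_∘ Vec.∷-injectiveʳ)

  subsets-unique : ∀ d → AllPairs _≢_ (subsets d)
  subsets-unique zero    = [] ∷ []
  subsets-unique (suc d) = AllPairs.++⁺ (∷-unique true (subsets-unique d)) (∷-unique false (subsets-unique d))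
    (head≢ (subsets d) (subsets d))

  subsetsOfSize-unique : ∀ d k → AllPairs _≢_ (subsetsOfSize d k)
  subsetsOfSize-unique zero    zero    = [] ∷ []
  subsetsOfSize-unique zero    (suc k) = []
  subsetsOfSize-unique (suc d) zero    = ∷-unique false (subsetsOfSize-unique d zero)
  subsetsOfSize-unique (suc d) (suc k) = AllPairs.++⁺
    (∷-unique true (subsetsOfSize-unique d k)) (∷-unique false (subsetsOfSize-unique d (suc k)))
    (head≢ (subsetsOfSize d k) (subsetsOfSize d (suc k)))

  subsetsOfSize-trues : ∀ d k → All (λ J → trues J ≡ k) (subsetsOfSize d k)
  subsetsOfSize-trues zero    zero    = refl ∷ []
  subsetsOfSize-trues zero    (suc k) = []
  subsetsOfSize-trues (suc d) zero    = All.map⁺ (subsetsOfSize-trues d zero)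
  subsetsOfSize-trues (suc d) (suc k) = All.++⁺
    (All.map⁺ (All.map (cong suc) (subsetsOfSize-trues d k))) (All.map⁺ (subsetsOfSize-trues d (suc k)))

  pairs-unique : ∀ d → AllPairs _≢_ (pairs d)
  pairs-unique d = AllPairs.concat⁺
    (All.map⁺ (All.universal (λ I → AllPairs.map⁺ (AllPairs.map (_∘ cong proj₂) (subsetsOfSize-unique d (trues I)))) (subsets d)))
    (AllPairs.map⁺ (AllPairs.map
      (λ {I} {I′} I≢I′ → All.map⁺ (All.universal (λ _ → All.map⁺ (All.universal (λ _ → I≢I′ ∘ cong proj₁) (subsetsOfSize d (trues I′))))
                                     (subsetsOfSize d (trues I))))
      (subsets-unique d)))

  pairs-trues : ∀ d → All (λ (I , J) → trues I ≡ trues J) (pairs d)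
  pairs-trues d = All.concat⁺ (All.map⁺ (All.universal
    (λ I → All.map⁺ (All.map sym (subsetsOfSize-trues d (trues I)))) (subsets d)))

  length-subsets : ∀ d → length (subsets d) ≡ 2 ^ d
  length-subsets zero    = refl
  length-subsets (suc d) = begin
    length (subsets (suc d))                    ≡⟨ List.length-++ (map (true ∷_) (subsets d)) ⟩
    length (map (true ∷_) (subsets d)) + length (map (false ∷_) (subsets d))
      ≡⟨ cong₂ _+_ (List.length-map (true ∷_) (subsets d)) (List.length-map (false ∷_) (subsets d)) ⟩
    length (subsets d) + length (subsets d)     ≡⟨ cong (λ t → t + t) (length-subsets d) ⟩
    2 ^ d + 2 ^ d                               ≡⟨ cong (λ t → 2 ^ d + t) (ℕ.+-identityʳ (2 ^ d)) ⟨
    2 ^ suc d                                   ∎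

  length-subsetsOfSize : ∀ d k → length (subsetsOfSize d k) ≡ d C k
  length-subsetsOfSize zero    zero    = refl
  length-subsetsOfSize zero    (suc k) = refl
  length-subsetsOfSize (suc d) zero    = trans (List.length-map (false ∷_) (subsetsOfSize d zero)) (length-subsetsOfSize d zero)
  length-subsetsOfSize (suc d) (suc k) = begin
    length (subsetsOfSize (suc d) (suc k))
      ≡⟨ List.length-++ (map (true ∷_) (subsetsOfSize d k)) ⟩
    length (map (true ∷_) (subsetsOfSize d k)) + length (map (false ∷_) (subsetsOfSize d (suc k)))
      ≡⟨ cong₂ _+_ (List.length-map (true ∷_) (subsetsOfSize d k)) (List.length-map (false ∷_) (subsetsOfSize d (suc k))) ⟩
    length (subsetsOfSize d k) + length (subsetsOfSize d (suc k))
      ≡⟨ cong₂ _+_ (length-subsetsOfSize d k) (length-subsetsOfSize d (suc k)) ⟩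
    d C k + d C suc k
      ≡⟨ nCk+nC[k+1]≡[n+1]C[k+1] d k ⟩
    suc d C suc k ∎

  ∑-pairs : ∀ d (f : Vec Bool d → ℕ) → ∑ (f ∘ proj₁) (pairs d) ≡ ∑ (λ I → (d C trues I) * f I) (subsets d)
  ∑-pairs d f = trans (∑-concatMap (f ∘ proj₁) (λ I → map (I ,_) (subsetsOfSize d (trues I))) (subsets d))
    (∑-cong (λ I → begin
      ∑ (f ∘ proj₁) (map (I ,_) (subsetsOfSize d (trues I)))  ≡⟨ ∑-map (f ∘ proj₁) (I ,_) (subsetsOfSize d (trues I)) ⟩
      ∑ (λ _ → f I) (subsetsOfSize d (trues I))               ≡⟨ ∑-const (f I) (subsetsOfSize d (trues I)) ⟩
      length (subsetsOfSize d (trues I)) * f I                ≡⟨ cong (_* f I) (length-subsetsOfSize d (trues I)) ⟩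
      (d C trues I) * f I                                     ∎) (subsets d))

  ∑-subsets : ∀ d (f : Vec Bool (suc d) → ℕ) →
              ∑ f (subsets (suc d)) ≡ ∑ (λ I → f (true ∷ I) + f (false ∷ I)) (subsets d)
  ∑-subsets d f = begin
    ∑ f (subsets (suc d))
      ≡⟨ ∑-++ f (map (true ∷_) (subsets d)) _ ⟩
    ∑ f (map (true ∷_) (subsets d)) + ∑ f (map (false ∷_) (subsets d))
      ≡⟨ cong₂ _+_ (∑-map f (true ∷_) (subsets d)) (∑-map f (false ∷_) (subsets d)) ⟩
    ∑ (f ∘ (true ∷_)) (subsets d) + ∑ (f ∘ (false ∷_)) (subsets d)
      ≡⟨ ∑-+ (f ∘ (true ∷_)) (f ∘ (false ∷_)) (subsets d) ⟨
    ∑ (λ I → f (true ∷ I) + f (false ∷ I)) (subsets d) ∎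

  -- Vandermonde's convolution, in which the summation over subsets supplies the factor C(a, k).
  -- Pascal's rule merges the two halves of the family into one with `suc b` and `suc r`, so both
  -- must vary in the induction.
  vandermonde : ∀ a b r → ∑ (λ I → b C (r + trues I)) (subsets a) ≡ (a + b) C (a + r)
  vandermonde zero    b r = trans (ℕ.+-identityʳ _) (cong (b C_) (ℕ.+-identityʳ r))
  vandermonde (suc a) b r = begin
    ∑ (λ I → b C (r + trues I)) (subsets (suc a))
      ≡⟨ ∑-subsets a (λ I → b C (r + trues I)) ⟩
    ∑ (λ I → b C (r + suc (trues I)) + b C (r + trues I)) (subsets a)
      ≡⟨ ∑-cong (λ I → begin
           b C (r + suc (trues I)) + b C (r + trues I)    ≡⟨ ℕ.+-comm (b C (r + suc (trues I))) _ ⟩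
           b C (r + trues I) + b C (r + suc (trues I))    ≡⟨ cong (λ t → b C (r + trues I) + b C t) (ℕ.+-suc r (trues I)) ⟩
           b C (r + trues I) + b C suc (r + trues I)      ≡⟨ nCk+nC[k+1]≡[n+1]C[k+1] b (r + trues I) ⟩
           suc b C suc (r + trues I)                      ∎) (subsets a) ⟩
    ∑ (λ I → suc b C (suc r + trues I)) (subsets a)
      ≡⟨ vandermonde a (suc b) (suc r) ⟩
    (a + suc b) C (a + suc r)
      ≡⟨ cong₂ _C_ (ℕ.+-suc a b) (ℕ.+-suc a r) ⟩
    (suc a + b) C (suc a + r) ∎

  length-pairs : ∀ d → length (pairs d) ≡ (2 * d) C d
  length-pairs d = begin
    length (pairs d)                                ≡⟨ ℕ.*-identityʳ _ ⟨
    length (pairs d) * 1                            ≡⟨ ∑-const 1 (pairs d) ⟨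
    ∑ (λ _ → 1) (pairs d)                           ≡⟨ ∑-pairs d (λ _ → 1) ⟩
    ∑ (λ I → (d C trues I) * 1) (subsets d)         ≡⟨ ∑-cong (λ I → ℕ.*-identityʳ _) (subsets d) ⟩
    ∑ (λ I → d C trues I) (subsets d)               ≡⟨ vandermonde d d 0 ⟩
    (d + d) C (d + 0)                               ≡⟨ cong₂ (λ m k → (d + m) C k) (sym (ℕ.+-identityʳ d)) (ℕ.+-identityʳ d) ⟩
    (2 * d) C d                                     ∎

  choose-factorials : ∀ a b → ((a + b) C a) * (a ! * b !) ≡ (a + b) !
  choose-factorials a b = begin
    ((a + b) C a) * (a ! * b !)                     ≡⟨ cong (λ c → ((a + b) C a) * (a ! * c !)) (ℕ.m+n∸m≡n a b) ⟨
    ((a + b) C a) * (a ! * (a + b ∸ a) !)           ≡⟨ cong (_* (a ! * (a + b ∸ a) !)) (nCk≡n!/k![n-k]! (ℕ.m≤m+n a b)) ⟩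
    (a + b) ! / (a ! * (a + b ∸ a) !) * (a ! * (a + b ∸ a) !)
      ≡⟨ m/n*n≡m (k![n∸k]!∣n! (ℕ.m≤m+n a b)) ⟩
    (a + b) !                                       ∎
    where
    instance
      nonZero : NonZero (a ! * (a + b ∸ a) !)
      nonZero = ℕ._!*_!≢0 a (a + b ∸ a)

  magnitude : ∀ {d} → Vec Bool d → ℕ
  magnitude I = trues I ! * falses I !

  choose-magnitude : ∀ {d} (I : Vec Bool d) → (d C trues I) * magnitude I ≡ d !
  choose-magnitude {d} I = subst (λ n → (n C trues I) * magnitude I ≡ n !) (trues+falses I)
    (choose-factorials (trues I) (falses I))

  ∣eigenvalue∣ : ∀ {d} (I : Vec Bool d) → ℤ.∣ eigenvalue I ∣ ≡ magnitude I
  ∣eigenvalue∣ []          = refl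
  ∣eigenvalue∣ (true ∷ I)  = begin
    ℤ.∣ -[1+ trues I ] ℤ.* eigenvalue I ∣     ≡⟨ ℤ.abs-* -[1+ trues I ] (eigenvalue I) ⟩
    suc (trues I) * ℤ.∣ eigenvalue I ∣        ≡⟨ cong (suc (trues I) *_) (∣eigenvalue∣ I) ⟩
    suc (trues I) * (trues I ! * falses I !)  ≡⟨ ℕ.*-assoc (suc (trues I)) (trues I !) (falses I !) ⟨
    suc (trues I) * trues I ! * falses I !    ∎
  ∣eigenvalue∣ (false ∷ I) = begin
    ℤ.∣ + suc (falses I) ℤ.* eigenvalue I ∣    ≡⟨ ℤ.abs-* (+ suc (falses I)) (eigenvalue I) ⟩
    suc (falses I) * ℤ.∣ eigenvalue I ∣        ≡⟨ cong (suc (falses I) *_) (∣eigenvalue∣ I) ⟩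
    suc (falses I) * (trues I ! * falses I !)  ≡⟨ lemma (suc (falses I)) (trues I !) (falses I !) ⟩
    trues I ! * (suc (falses I) * falses I !)  ∎
    where
    lemma : ∀ a b c → a * (b * c) ≡ b * (a * c)
    lemma = solve-∀

  eigenvalue≢0 : ∀ {d} (I : Vec Bool d) → eigenvalue I ≢ 0ℤ
  eigenvalue≢0 I eq = ℕ.≢-nonZero⁻¹ (magnitude I) {{ℕ._!*_!≢0 (trues I) (falses I)}}
    (trans (sym (∣eigenvalue∣ I)) (cong ℤ.∣_∣ eq))

  -- The C(d, k) partners of a subset of size k cancel the denominator of the binomial: every subset
  -- contributes `d !`, whatever its size.
  energy-pairs : ∀ d → ∑ (λ (I , _) → ℤ.∣ eigenvalue I ∣) (pairs d) ≡ 2 ^ d * d !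
  energy-pairs d = begin
    ∑ (λ (I , _) → ℤ.∣ eigenvalue I ∣) (pairs d)               ≡⟨ ∑-pairs d (λ I → ℤ.∣ eigenvalue I ∣) ⟩
    ∑ (λ I → (d C trues I) * ℤ.∣ eigenvalue I ∣) (subsets d)
      ≡⟨ ∑-cong (λ I → trans (cong ((d C trues I) *_) (∣eigenvalue∣ I)) (choose-magnitude I)) (subsets d) ⟩
    ∑ (λ _ → d !) (subsets d)                                 ≡⟨ ∑-const (d !) (subsets d) ⟩
    length (subsets d) * d !                                  ≡⟨ cong (_* d !) (length-subsets d) ⟩
    2 ^ d * d !                                               ∎

  -- Summing over the larger family with shifts p and q makes the induction go through.
  ∑-factorials : ∀ d p q → (suc (p + q)) ! * ∑ (λ (I : Vec Bool d) → (p + trues I) ! * (q + falses I) !) (subsets d)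
                 ≡ p ! * q ! * (suc (p + q) + d) !
  ∑-factorials zero    p q = begin
    (suc (p + q)) ! * ((p + 0) ! * (q + 0) ! + 0)
      ≡⟨ cong₂ (λ s t → (suc (p + q)) ! * (s ! * t ! + 0)) (ℕ.+-identityʳ p) (ℕ.+-identityʳ q) ⟩
    (suc (p + q)) ! * (p ! * q ! + 0)
      ≡⟨ lemma ((suc (p + q)) !) (p ! * q !) ⟩
    p ! * q ! * (suc (p + q)) !
      ≡⟨ cong (λ t → p ! * q ! * t !) (ℕ.+-identityʳ (suc (p + q))) ⟨
    p ! * q ! * (suc (p + q) + 0) ! ∎
    where
    lemma : ∀ a b → a * (b + 0) ≡ b * a
    lemma = solve-∀
  -- The two halves of the family have shifts `suc p` and `suc q`, so both instances of the
  -- induction hypothesis carry (p + q + 2)!; the cancelled factor supplies it.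
  ∑-factorials (suc d) p q = ℕ.*-cancelˡ-≡ _ _ (suc (suc (p + q))) (begin
    suc (suc (p + q)) * ((suc (p + q)) ! * ∑ (λ I → (p + trues I) ! * (q + falses I) !) (subsets (suc d)))
      ≡⟨ ℕ.*-assoc (suc (suc (p + q))) ((suc (p + q)) !) _ ⟨
    F * ∑ (λ I → (p + trues I) ! * (q + falses I) !) (subsets (suc d))
      ≡⟨ cong (F *_) (trans (∑-subsets d _) (∑-+ (λ I → (p + suc (trues I)) ! * (q + falses I) !) _ (subsets d))) ⟩
    F * (∑ (λ I → (p + suc (trues I)) ! * (q + falses I) !) (subsets d)
         + ∑ (λ I → (p + trues I) ! * (q + suc (falses I)) !) (subsets d))
      ≡⟨ ℕ.*-distribˡ-+ F _ _ ⟩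
    F * ∑ (λ I → (p + suc (trues I)) ! * (q + falses I) !) (subsets d)
      + F * ∑ (λ I → (p + trues I) ! * (q + suc (falses I)) !) (subsets d)
      ≡⟨ cong₂ _+_
           (cong (F *_) (∑-cong (λ I → cong (λ t → t ! * (q + falses I) !) (ℕ.+-suc p (trues I))) (subsets d)))
           (cong₂ _*_ (cong (λ t → (suc t) !) (sym (ℕ.+-suc p q)))
             (∑-cong (λ I → cong (λ t → (p + trues I) ! * t !) (ℕ.+-suc q (falses I))) (subsets d))) ⟩
    F * ∑ (λ I → (suc p + trues I) ! * (q + falses I) !) (subsets d)
      + (suc (p + suc q)) ! * ∑ (λ I → (p + trues I) ! * (suc q + falses I) !) (subsets d)
      ≡⟨ cong₂ _+_ (∑-factorials d (suc p) q) (∑-factorials d p (suc q)) ⟩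
    (suc p) ! * q ! * (suc (suc p + q) + d) ! + p ! * (suc q) ! * (suc (p + suc q) + d) !
      ≡⟨ cong₂ (λ s t → (suc p) ! * q ! * s ! + p ! * (suc q) ! * t !) (sym (ℕ.+-suc (suc (p + q)) d))
           (trans (cong (λ t → suc t + d) (ℕ.+-suc p q)) (sym (ℕ.+-suc (suc (p + q)) d))) ⟩
    (suc p) ! * q ! * (suc (p + q) + suc d) ! + p ! * (suc q) ! * (suc (p + q) + suc d) !
      ≡⟨ lemma p q (p !) (q !) ((suc (p + q) + suc d) !) ⟩
    suc (suc (p + q)) * (p ! * q ! * (suc (p + q) + suc d) !) ∎)
    where
    F : ℕ
    F = (suc (suc (p + q))) !
    lemma : ∀ p q a b c → (a + p * a) * b * c + a * (b + q * b) * c ≡ (2 + (p + q)) * (a * b * c)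
    lemma = solve-∀

  -- One of the two factors k! (d - k)! is absorbed by the binomial as before; `∑-factorials` with
  -- both shifts 0 sums the other.
  squares-pairs : ∀ d → ∑ (λ (I , _) → ℤ.∣ eigenvalue I ∣ * ℤ.∣ eigenvalue I ∣) (pairs d) ≡ (suc d) ! * d !
  squares-pairs d = begin
    ∑ (λ (I , _) → ℤ.∣ eigenvalue I ∣ * ℤ.∣ eigenvalue I ∣) (pairs d)
      ≡⟨ ∑-pairs d (λ I → ℤ.∣ eigenvalue I ∣ * ℤ.∣ eigenvalue I ∣) ⟩
    ∑ (λ I → (d C trues I) * (ℤ.∣ eigenvalue I ∣ * ℤ.∣ eigenvalue I ∣)) (subsets d)
      ≡⟨ ∑-cong (λ I → begin
           (d C trues I) * (ℤ.∣ eigenvalue I ∣ * ℤ.∣ eigenvalue I ∣)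
             ≡⟨ cong (λ t → (d C trues I) * (t * t)) (∣eigenvalue∣ I) ⟩
           (d C trues I) * (magnitude I * magnitude I)  ≡⟨ ℕ.*-assoc (d C trues I) _ _ ⟨
           (d C trues I) * magnitude I * magnitude I    ≡⟨ cong (_* magnitude I) (choose-magnitude I) ⟩
           d ! * magnitude I                            ∎) (subsets d) ⟩
    ∑ (λ I → d ! * magnitude I) (subsets d)             ≡⟨ ∑-* (d !) magnitude (subsets d) ⟩
    d ! * ∑ magnitude (subsets d)                       ≡⟨ cong (d ! *_) (trans (sym (ℕ.*-identityˡ _)) (∑-factorials d 0 0)) ⟩
    d ! * (1 * (suc d) !)                               ≡⟨ cong (d ! *_) (ℕ.*-identityˡ _) ⟩
    d ! * (suc d) !                                     ≡⟨ ℕ.*-comm (d !) _ ⟩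
    (suc d) ! * d !                                     ∎

  central-binomial-step : ∀ d → suc d * ((2 * suc d) C suc d) ≡ 2 * (suc (2 * d) * ((2 * d) C d))
  central-binomial-step d = ℕ.*-cancelʳ-≡ _ _ (suc d * (d ! * d !)) {{ℕ.m*n≢0 (suc d) (d ! * d !) {{_}} {{ℕ._!*_!≢0 d d}}}} (begin
    suc d * ((2 * suc d) C suc d) * (suc d * (d ! * d !))
      ≡⟨ lemma₁ (suc d) ((2 * suc d) C suc d) (d !) ⟩
    ((2 * suc d) C suc d) * ((suc d) ! * (suc d) !)
      ≡⟨ central (suc d) ⟩
    (2 * suc d) !
      ≡⟨ cong _! (ℕ.*-suc 2 d) ⟩
    suc (suc (2 * d)) * (suc (2 * d) * (2 * d) !)
      ≡⟨ cong (λ t → suc (suc (2 * d)) * (suc (2 * d) * t)) (central d) ⟨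
    suc (suc (2 * d)) * (suc (2 * d) * (((2 * d) C d) * (d ! * d !)))
      ≡⟨ lemma₂ d ((2 * d) C d) (d ! * d !) ⟩
    2 * (suc (2 * d) * ((2 * d) C d)) * (suc d * (d ! * d !)) ∎)
    where
    central : ∀ d → ((2 * d) C d) * (d ! * d !) ≡ (2 * d) !
    central d = subst (λ n → (n C d) * (d ! * d !) ≡ n !) (cong (λ t → d + t) (sym (ℕ.+-identityʳ d))) (choose-factorials d d)
    lemma₁ : ∀ s c f → s * c * (s * (f * f)) ≡ c * ((s * f) * (s * f))
    lemma₁ = solve-∀
    lemma₂ : ∀ d c f → (2 + 2 * d) * ((1 + 2 * d) * (c * f)) ≡ 2 * ((1 + 2 * d) * c) * ((1 + d) * f)
    lemma₂ = solve-∀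

  -- A step multiplies the left side by at most 4 and the right side by at least 5, starting from 20
  -- < 24. The strict inequality leaves room for a kernel.
  central-binomial<factorial : ∀ d → (2 * (3 + d)) C (3 + d) < (suc (3 + d)) !
  central-binomial<factorial zero    = ℕ.m≤m+n 21 3
  central-binomial<factorial (suc d) = ℕ.*-cancelˡ-< (4 + d) _ _ (ℕ.≤-<-trans bound
    (ℕ.<-≤-trans (ℕ.*-monoʳ-< (4 * (4 + d)) (central-binomial<factorial d)) grow))
    where
    bound : (4 + d) * ((2 * (4 + d)) C (4 + d)) ≤ 4 * (4 + d) * ((2 * (3 + d)) C (3 + d))
    bound = ℕ.≤-trans (ℕ.≤-reflexive (central-binomial-step (3 + d)))
      (ℕ.≤-trans (ℕ.*-monoʳ-≤ 2 (ℕ.*-monoˡ-≤ ((2 * (3 + d)) C (3 + d)) (ℕ.n≤1+n (suc (2 * (3 + d))))))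
        (ℕ.≤-reflexive (lemma d ((2 * (3 + d)) C (3 + d)))))
      where
      lemma : ∀ d c → 2 * ((2 + 2 * (3 + d)) * c) ≡ 4 * (4 + d) * c
      lemma = solve-∀
    grow : 4 * (4 + d) * (4 + d) ! ≤ (4 + d) * (5 + d) !
    grow = ℕ.≤-trans (ℕ.≤-reflexive (lemma (4 + d) ((4 + d) !)))
      (ℕ.*-monoʳ-≤ (4 + d) (ℕ.*-monoˡ-≤ ((4 + d) !) (ℕ.m≤m+n 4 (1 + d))))
      where
      lemma : ∀ s f → 4 * s * f ≡ s * (4 * f)
      lemma = solve-∀

  -- The base case is an equality, 8 = 8: on four letters the energy 48 exceeds the bound 46 only by
  -- the 2 subtracted there.
  double≤power : ∀ d → 2 * suc (3 + d) ≤ 2 ^ (3 + d)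
  double≤power zero    = ℕ.≤-refl
  double≤power (suc d) = ℕ.≤-trans (ℕ.≤-trans (ℕ.m≤m+n (2 * (5 + d)) (6 + 2 * d)) (ℕ.≤-reflexive (lemma d)))
    (ℕ.*-monoʳ-≤ 2 (double≤power d))
    where
    lemma : ∀ d → 2 * (5 + d) + (6 + 2 * d) ≡ 2 * (2 * (4 + d))
    lemma = solve-∀

-- The embedding of the integers into the rationals

module Rationals where

  ι : ℤ → ℚ
  ι z = z ℚ./ 1

  private
    unit : ℤ → ℚᵘ
    unit z = mkℚᵘ z 0

    toℚᵘ-ι : ∀ z → ℚ.toℚᵘ (ι z) ℚᵘ.≃ unit z
    toℚᵘ-ι z = ℚ.toℚᵘ-fromℚᵘ (unit z)

  ι-+ : ∀ a b → ι (a ℤ.+ b) ≡ ι a ℚ.+ ι b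
  ι-+ a b = ℚ.toℚᵘ-injective (ℚᵘ.≃-trans (toℚᵘ-ι (a ℤ.+ b)) (ℚᵘ.≃-sym (ℚᵘ.≃-trans
    (ℚ.toℚᵘ-homo-+ (ι a) (ι b))
    (ℚᵘ.≃-trans (ℚᵘ.+-cong (toℚᵘ-ι a) (toℚᵘ-ι b))
      (ℚᵘ.≃-reflexive (cong unit (cong₂ ℤ._+_ (ℤ.*-identityʳ a) (ℤ.*-identityʳ b))))))))

  ι-* : ∀ a b → ι (a ℤ.* b) ≡ ι a ℚ.* ι b
  ι-* a b = ℚ.toℚᵘ-injective (ℚᵘ.≃-trans (toℚᵘ-ι (a ℤ.* b)) (ℚᵘ.≃-sym (ℚᵘ.≃-trans
    (ℚ.toℚᵘ-homo-* (ι a) (ι b)) (ℚᵘ.*-cong (toℚᵘ-ι a) (toℚᵘ-ι b)))))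

  ι-injective : ∀ {a b} → ι a ≡ ι b → a ≡ b
  ι-injective {a} {b} eq with ℚ.fromℚᵘ-injective {unit a} {unit b} eq
  ... | *≡* p = ℤ.*-cancelʳ-≡ a b 1ℤ p

  ι-mono-≤ : ∀ {a b} → a ℤ.≤ b → ι a ℚ.≤ ι b
  ι-mono-≤ {a} {b} a≤b = ℚ.toℚᵘ-cancel-≤ (ℚᵘ.≤-trans (ℚᵘ.≤-reflexive (toℚᵘ-ι a))
    (ℚᵘ.≤-trans (*≤* (ℤ.*-monoʳ-≤-nonNeg 1ℤ a≤b)) (ℚᵘ.≤-reflexive (ℚᵘ.≃-sym (toℚᵘ-ι b)))))

  ι-∣∣ : ∀ a → ℚ.∣ ι a ∣ ≡ ι (+ ℤ.∣ a ∣)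
  ι-∣∣ a = ℚ.toℚᵘ-injective (ℚᵘ.≃-trans (ℚ.toℚᵘ-homo-∣-∣ (ι a))
    (ℚᵘ.≃-trans (ℚᵘ.∣-∣-cong (toℚᵘ-ι a)) (ℚᵘ.≃-sym (toℚᵘ-ι (+ ℤ.∣ a ∣)))))

  ι-neg : ∀ a → ι (ℤ.- a) ≡ ℚ.- ι a
  ι-neg a = ℚ.toℚᵘ-injective (ℚᵘ.≃-trans (toℚᵘ-ι (ℤ.- a)) (ℚᵘ.≃-sym (ℚᵘ.≃-trans
    (ℚ.toℚᵘ-homo‿- (ι a)) (ℚᵘ.-‿cong (toℚᵘ-ι a)))))

-- Rank-one expansion of a matrix whose known eigenvalues exhaust its Frobenius norm

module Deflation where
  open import Data.Rational.Base using (_+_; _*_; _-_; -_; _≤_)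
  open Sums ℚ.+-*-commutativeRing
  open ≡.≡-Reasoning
  open +-*-Solver using (solve; _:=_; _:+_; _:-_; _:*_; :-_; con)

  private
    sum≥0 : ∀ {n} (f : Fin n → ℚ) → (∀ i → 0ℚ ≤ f i) → 0ℚ ≤ sum f
    sum≥0 {zero}  f f≥0 = ℚ.≤-refl
    sum≥0 {suc n} f f≥0 = ℚ.+-mono-≤ (f≥0 zero) (sum≥0 (f ∘ suc) (f≥0 ∘ suc))

    +≡0⇒≡0 : ∀ {p q} → 0ℚ ≤ p → 0ℚ ≤ q → p + q ≡ 0ℚ → p ≡ 0ℚ × q ≡ 0ℚ
    +≡0⇒≡0 {p} {q} p≥0 q≥0 eq =
      ℚ.≤-antisym (subst (p ≤_) eq (subst (_≤ p + q) (ℚ.+-identityʳ p) (ℚ.+-monoʳ-≤ p q≥0))) p≥0 ,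
      ℚ.≤-antisym (subst (q ≤_) eq (subst (_≤ p + q) (ℚ.+-identityˡ q) (ℚ.+-monoˡ-≤ q p≥0))) q≥0

    sum≡0 : ∀ {n} (f : Fin n → ℚ) → (∀ i → 0ℚ ≤ f i) → sum f ≡ 0ℚ → ∀ i → f i ≡ 0ℚ
    sum≡0 {suc n} f f≥0 eq with +≡0⇒≡0 (f≥0 zero) (sum≥0 (f ∘ suc) (f≥0 ∘ suc)) eq
    ... | f0≡0 , rest≡0 = λ { zero → f0≡0 ; (suc i) → sum≡0 (f ∘ suc) (f≥0 ∘ suc) rest≡0 i }

    ∣∣-square : ∀ p → p * p ≡ ℚ.∣ p ∣ * ℚ.∣ p ∣
    ∣∣-square p with ℚ.∣p∣≡p∨∣p∣≡-p p
    ... | inj₁ eq = sym (cong₂ _*_ eq eq)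
    ... | inj₂ eq = trans (solve 1 (λ p → p :* p := (:- p) :* (:- p)) refl p) (sym (cong₂ _*_ eq eq))

    square≥0 : ∀ p → 0ℚ ≤ p * p
    square≥0 p = subst (0ℚ ≤_) (sym (∣∣-square p))
      (ℚ.nonNegative⁻¹ _ {{ℚ.nonNeg*nonNeg⇒nonNeg ℚ.∣ p ∣ {{ℚ.∣-∣-nonNeg p}} ℚ.∣ p ∣ {{ℚ.∣-∣-nonNeg p}}}})

    cancelˡ : ∀ p {q} .{{_ : ℚ.NonZero p}} → p * q ≡ 0ℚ → q ≡ 0ℚ
    cancelˡ p {q} eq = begin
      q                   ≡⟨ ℚ.*-identityˡ q ⟨
      1ℚ * q              ≡⟨ cong (_* q) (ℚ.*-inverseˡ p) ⟨
      ℚ.1/ p * p * q      ≡⟨ ℚ.*-assoc (ℚ.1/ p) p q ⟩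
      ℚ.1/ p * (p * q)    ≡⟨ cong (ℚ.1/ p *_) eq ⟩
      ℚ.1/ p * 0ℚ         ≡⟨ ℚ.*-zeroʳ (ℚ.1/ p) ⟩
      0ℚ                  ∎

    square≡0 : ∀ p → p * p ≡ 0ℚ → p ≡ 0ℚ
    square≡0 p eq with p ℚ.≟ 0ℚ
    ... | yes p≡0 = p≡0
    ... | no  p≢0 = cancelˡ p {{ℚ.≢-nonZero p≢0}} eq

  norm≡0 : ∀ {n} (x : Fin n → ℚ) → dot x x ≡ 0ℚ → ∀ i → x i ≡ 0ℚ
  norm≡0 x eq i = square≡0 (x i) (sum≡0 (λ i → x i * x i) (λ i → square≥0 (x i)) eq i)

  total : ∀ {K : Set} → (K → ℚ) → List K → ℚ
  total f L = sum λ t → f (lookup L t)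

  frobenius : ∀ {N} → (Fin N → Fin N → ℚ) → ℚ
  frobenius A = sum λ i → dot (A i) (A i)

  module _ {K : Set} {N : ℕ} (b : K → Fin N → ℚ) (l ν : K → ℚ) where

    -- Subtracting l ν b bᵀ for an eigenvector b of A with eigenvalue l lowers
    -- the Frobenius norm by exactly l², so nothing is left at the end.
    expansion : ∀ L (A : Fin N → Fin N → ℚ) →
      AllPairs (λ k k′ → dot (b k) (b k′) ≡ 0ℚ) L →
      All (λ k → ν k * dot (b k) (b k) ≡ 1ℚ) L →
      All (λ k → ∀ i → dot (A i) (b k) ≡ l k * b k i) L →
      frobenius A ≡ total (λ k → l k * l k) L →
      ∀ i j → A i j ≡ total (λ k → l k * ν k * (b k i * b k j)) L
    expansion [] A orth norms eigens eq i j =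
      norm≡0 (A i) (sum≡0 (λ i → dot (A i) (A i)) (λ i → sum≥0 (λ j → A i j * A i j) λ j → square≥0 (A i j)) eq i) j
    expansion (k ∷ L) A (k⊥L ∷ orth) (norm ∷ norms) (eigen ∷ eigens) eq i j = begin
      A i j
        ≡⟨ solve 2 (λ a x → a := x :+ (a :- x)) refl (A i j) (c * (b k i * b k j)) ⟩
      c * (b k i * b k j) + A′ i j
        ≡⟨ cong (λ t → c * (b k i * b k j) + t) (expansion L A′ orth norms eigens′ frobenius′ i j) ⟩
      total (λ k → l k * ν k * (b k i * b k j)) (k ∷ L) ∎
      where
      c n : ℚ
      c = l k * ν k
      n = dot (b k) (b k)

      A′ : Fin N → Fin N → ℚ
      A′ i j = A i j - c * (b k i * b k j)

      split : ∀ i j → A′ i j ≡ 1ℚ * A i j + (- (c * b k i)) * b k j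
      split i j = solve 4 (λ a c x y → a :- c :* (x :* y) := con 1ℚ :* a :+ (:- (c :* x)) :* y) refl
        (A i j) c (b k i) (b k j)

      eigens′ : All (λ k′ → ∀ i → dot (A′ i) (b k′) ≡ l k′ * b k′ i) L
      eigens′ = All.zipWith (λ {k′} (k⊥k′ , eigen′) i → begin
        dot (A′ i) (b k′)
          ≡⟨ dot-linearˡ 1ℚ (- (c * b k i)) (A i) (b k) (A′ i) (b k′) (split i) ⟩
        1ℚ * dot (A i) (b k′) + (- (c * b k i)) * dot (b k) (b k′)
          ≡⟨ cong₂ (λ s t → 1ℚ * s + (- (c * b k i)) * t) (eigen′ i) k⊥k′ ⟩
        1ℚ * (l k′ * b k′ i) + (- (c * b k i)) * 0ℚ
          ≡⟨ solve 2 (λ s t → con 1ℚ :* s :+ t :* con 0ℚ := s) refl (l k′ * b k′ i) (- (c * b k i)) ⟩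
        l k′ * b k′ i ∎) (k⊥L , eigens)

      row : ∀ i → dot (A′ i) (A′ i) ≡ 1ℚ * dot (A i) (A i) + (c * c * n - (c * l k + c * l k)) * (b k i * b k i)
      row i = begin
        dot (A′ i) (A′ i)
          ≡⟨ dot-linearˡ 1ℚ x (A i) (b k) (A′ i) (A′ i) (split i) ⟩
        1ℚ * dot (A i) (A′ i) + x * dot (b k) (A′ i)
          ≡⟨ cong₂ (λ s t → 1ℚ * s + x * t) (dot-linearʳ 1ℚ x (A i) (b k) (A′ i) (A i) (split i))
               (trans (dot-linearʳ 1ℚ x (A i) (b k) (A′ i) (b k) (split i))
                 (cong (λ t → 1ℚ * t + x * n) (trans (dot-comm (b k) (A i)) (eigen i)))) ⟩
        1ℚ * (1ℚ * dot (A i) (A i) + x * dot (A i) (b k)) + x * (1ℚ * (l k * b k i) + x * n)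
          ≡⟨ cong (λ t → 1ℚ * (1ℚ * dot (A i) (A i) + x * t) + x * (1ℚ * (l k * b k i) + x * n)) (eigen i) ⟩
        1ℚ * (1ℚ * dot (A i) (A i) + x * (l k * b k i)) + x * (1ℚ * (l k * b k i) + x * n)
          ≡⟨ solve 5 (λ f c y l n →
               con 1ℚ :* (con 1ℚ :* f :+ (:- (c :* y)) :* (l :* y)) :+ (:- (c :* y)) :* (con 1ℚ :* (l :* y) :+ (:- (c :* y)) :* n)
               := con 1ℚ :* f :+ (c :* c :* n :- (c :* l :+ c :* l)) :* (y :* y)) refl
               (dot (A i) (A i)) c (b k i) (l k) n ⟩
        1ℚ * dot (A i) (A i) + (c * c * n - (c * l k + c * l k)) * (b k i * b k i) ∎
        where
        x : ℚ
        x = - (c * b k i)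

      frobenius′ : frobenius A′ ≡ total (λ k → l k * l k) L
      frobenius′ = begin
        frobenius A′
          ≡⟨ sum-linear 1ℚ (c * c * n - (c * l k + c * l k)) (λ i → dot (A i) (A i)) (λ i → b k i * b k i) _ row ⟩
        1ℚ * frobenius A + (c * c * n - (c * l k + c * l k)) * n
          ≡⟨ cong (λ t → 1ℚ * t + (c * c * n - (c * l k + c * l k)) * n) eq ⟩
        1ℚ * (l k * l k + rest) + (c * c * n - (c * l k + c * l k)) * n
          ≡⟨ solve 4 (λ r l v n →
               con 1ℚ :* (l :* l :+ r) :+ ((l :* v) :* (l :* v) :* n :- ((l :* v) :* l :+ (l :* v) :* l)) :* n
               := r :+ (l :* l :- l :* l :* (v :* n)) :* (con 1ℚ :- v :* n)) refl rest (l k) (ν k) n ⟩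
        rest + (l k * l k - l k * l k * (ν k * n)) * (1ℚ - ν k * n)
          ≡⟨ cong (λ t → rest + (l k * l k - l k * l k * t) * (1ℚ - t)) norm ⟩
        rest + (l k * l k - l k * l k * 1ℚ) * (1ℚ - 1ℚ)
          ≡⟨ solve 2 (λ r s → r :+ (s :- s :* con 1ℚ) :* (con 1ℚ :- con 1ℚ) := r) refl rest (l k * l k) ⟩
        rest ∎
        where
        rest : ℚ
        rest = total (λ k → l k * l k) L

-- Bases of eigenspaces over a ring receiving the rationals

module Spectral (R : CommutativeRing 0ℓ 0ℓ) (φ : ℚ → CommutativeRing.Carrier R)
  (φ-homomorphism : IsRingHomomorphism (CommutativeRing.rawRing ℚ.+-*-commutativeRing) (CommutativeRing.rawRing R) φ)
  (nontrivial : ¬ CommutativeRing._≈_ R (CommutativeRing.1# R) (CommutativeRing.0# R)) where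

  open CommutativeRing R hiding (zero) renaming (refl to ≈-refl; sym to ≈-sym; trans to ≈-trans; reflexive to ≈-reflexive)
  open IsRingHomomorphism φ-homomorphism using (+-homo; *-homo; 0#-homo; 1#-homo)
  open Sums R
  open import Relation.Binary.Reasoning.Setoid setoid
  module Q = Sums ℚ.+-*-commutativeRing
  open Deflation using (total)
  open +-*-Solver using (solve; _:=_; _:+_; _:*_; :-_; con)

  infix 30 _^
  _^ : ∀ {n} → (Fin n → ℚ) → Fin n → Carrier
  (x ^) i = φ (x i)

  φ-sum : ∀ {n} (x : Fin n → ℚ) → φ (Q.sum x) ≈ sum (x ^)
  φ-sum {zero}  x = 0#-homo
  φ-sum {suc n} x = ≈-trans (+-homo (x zero) _) (+-congˡ (φ-sum (x ∘ suc)))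

  φ-dot : ∀ {n} (x y : Fin n → ℚ) → φ (Q.dot x y) ≈ dot (x ^) (y ^)
  φ-dot {n} x y = ≈-trans (φ-sum (λ i → x i ℚ.* y i)) (sum-cong-≋ {n} λ i → *-homo (x i) (y i))

  φ-δ : ∀ {n} (i j : Fin n) → φ (Q.δ i j) ≈ δ i j
  φ-δ i j with i Fin.≟ j
  ... | yes _ = 1#-homo
  ... | no _  = 0#-homo

  φ-cong : ∀ {p q} → p ≡ q → φ p ≈ φ q
  φ-cong eq = ≈-reflexive (cong φ eq)

  φ-cancel : ∀ {p q x} → q ℚ.* p ≡ 1ℚ → φ p * x ≈ 0# → x ≈ 0#
  φ-cancel {p} {q} {x} qp≡1 px≈0 = begin
    x                  ≈⟨ *-identityˡ x ⟨
    1# * x             ≈⟨ *-congʳ (≈-trans (φ-cong qp≡1) 1#-homo) ⟨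
    φ (q ℚ.* p) * x    ≈⟨ *-congʳ (*-homo q p) ⟩
    φ q * φ p * x      ≈⟨ *-assoc _ _ _ ⟩
    φ q * (φ p * x)    ≈⟨ *-congˡ px≈0 ⟩
    φ q * 0#           ≈⟨ zeroʳ _ ⟩
    0#                 ∎

  φ-cancel-≢0 : ∀ {p x} → p ≢ 0ℚ → φ p * x ≈ 0# → x ≈ 0#
  φ-cancel-≢0 {p} p≢0 = φ-cancel {p} {(ℚ.1/ p) {{ℚ.≢-nonZero p≢0}}} (ℚ.*-inverseˡ p {{ℚ.≢-nonZero p≢0}})

  difference-null : ∀ {a μ x} → a * x ≈ μ * x → (μ + - a) * x ≈ 0#
  difference-null {a} {μ} {x} eq = begin
    (μ + - a) * x        ≈⟨ distribʳ _ _ _ ⟩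
    μ * x + - a * x      ≈⟨ +-congʳ eq ⟨
    a * x + - a * x      ≈⟨ distribʳ _ _ _ ⟨
    (a + - a) * x        ≈⟨ *-congʳ (-‿inverseʳ a) ⟩
    0# * x               ≈⟨ zeroˡ x ⟩
    0#                   ∎

  difference-≈ : ∀ {a μ} → μ + - a ≈ 0# → μ ≈ a
  difference-≈ {a} {μ} eq = begin
    μ                ≈⟨ +-identityʳ μ ⟨
    μ + 0#           ≈⟨ +-congˡ (-‿inverseˡ a) ⟨
    μ + (- a + a)    ≈⟨ +-assoc _ _ _ ⟨
    μ + - a + a      ≈⟨ +-congʳ eq ⟩
    0# + a           ≈⟨ +-identityˡ a ⟩
    a                ∎

  record IsBasis {N} (P : (Fin N → Carrier) → Set) {m} (e : Fin m → Fin N → Carrier) : Set where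
    field
      inside      : ∀ k → P (e k)
      independent : ∀ c → (∀ i → combination c e i ≈ 0#) → ∀ k → c k ≈ 0#
      spanning    : ∀ v → P v → ∃ λ c → ∀ i → v i ≈ combination c e i

  open IsBasis

  module Pivot {N p} (b : Fin N → ℚ) (e : Fin (suc p) → Fin N → ℚ) (t : Fin (suc p)) (bt≢0 : Q.dot b (e t) ≢ 0ℚ) where

    f : Fin (suc p) → ℚ
    f k = Q.dot b (e k)

    g : ℚ
    g = (ℚ.1/ f t) {{ℚ.≢-nonZero bt≢0}}

    g*f≡1 : g ℚ.* f t ≡ 1ℚ
    g*f≡1 = ℚ.*-inverseˡ (f t) {{ℚ.≢-nonZero bt≢0}}

    κ : Fin p → ℚ
    κ s = (ℚ.- f (punchIn t s)) ℚ.* g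

    -- The other basis vectors, corrected along the pivot vector `e t` to be orthogonal to `b`. The
    -- factor 1 gives the shape expected by the linearity lemmas.
    e′ : Fin p → Fin N → ℚ
    e′ s i = 1ℚ ℚ.* e (punchIn t s) i ℚ.+ κ s ℚ.* e t i

    e′-linear : ∀ s i → (e′ s ^) i ≈ 1# * (e (punchIn t s) ^) i + φ (κ s) * (e t ^) i
    e′-linear s i = ≈-trans (+-homo _ _) (+-cong (≈-trans (*-homo 1ℚ _) (*-congʳ 1#-homo)) (*-homo _ _))

    combination-e′ : ∀ c i → combination c (λ s → e′ s ^) i ≈
      sum (λ s → c s * (e (punchIn t s) ^) i) + sum (λ s → c s * φ (κ s)) * (e t ^) i
    combination-e′ c i = begin
      sum (λ s → c s * (e′ s ^) i)
        ≈⟨ sum-cong-≋ {p} (λ s → begin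
             c s * (e′ s ^) i                                                     ≈⟨ *-congˡ (e′-linear s i) ⟩
             c s * (1# * (e (punchIn t s) ^) i + φ (κ s) * (e t ^) i)             ≈⟨ *-congˡ (+-congʳ (*-identityˡ _)) ⟩
             c s * ((e (punchIn t s) ^) i + φ (κ s) * (e t ^) i)                  ≈⟨ distribˡ _ _ _ ⟩
             c s * (e (punchIn t s) ^) i + c s * (φ (κ s) * (e t ^) i)            ≈⟨ +-congˡ (*-assoc _ _ _) ⟨
             c s * (e (punchIn t s) ^) i + c s * φ (κ s) * (e t ^) i              ∎) ⟩
      sum (λ s → c s * (e (punchIn t s) ^) i + c s * φ (κ s) * (e t ^) i)
        ≈⟨ ∑-distrib-+ (λ s → c s * (e (punchIn t s) ^) i) (λ s → c s * φ (κ s) * (e t ^) i) ⟩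
      sum (λ s → c s * (e (punchIn t s) ^) i) + sum (λ s → c s * φ (κ s) * (e t ^) i)
        ≈⟨ +-congˡ (*-distribʳ-sum ((e t ^) i) (λ s → c s * φ (κ s))) ⟨
      sum (λ s → c s * (e (punchIn t s) ^) i) + sum (λ s → c s * φ (κ s)) * (e t ^) i ∎

    null : ∀ s → dot (b ^) (e′ s ^) ≈ 0#
    null s = ≈-trans (≈-sym (φ-dot b (e′ s))) (≈-trans (φ-cong (≡.trans
      (Q.dot-linearʳ 1ℚ (κ s) (e (punchIn t s)) (e t) (e′ s) b (λ _ → refl))
      (≡.trans
        (solve 3 (λ x y z → con 1ℚ :* x :+ (:- x) :* y :* z := x :+ (:- x) :* (y :* z)) refl (f (punchIn t s)) g (f t))
        (≡.trans (cong (λ u → f (punchIn t s) ℚ.+ (ℚ.- f (punchIn t s)) ℚ.* u) g*f≡1)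
          (solve 1 (λ x → x :+ (:- x) :* con 1ℚ := con 0ℚ) refl (f (punchIn t s))))))) 0#-homo)

    -- A relation among the `e′` is a relation among the `e` with the coefficient `K` inserted at
    -- `t`. Conversely, orthogonality to `b` forces the coefficient of a vector at `t` to have the
    -- value that `K` takes on its other coefficients.
    basis : ∀ {P : (Fin N → Carrier) → Set} →
      (∀ {v} → P v → ∀ {w} → P w → ∀ κ {u} → (∀ i → u i ≈ 1# * v i + κ * w i) → P u) →
      IsBasis P (λ k → e k ^) → IsBasis (λ v → dot (b ^) v ≈ 0# × P v) (λ s → e′ s ^)
    basis closed B = record
      { inside      = λ s → null s , closed (inside B (punchIn t s)) (inside B t) (φ (κ s)) (e′-linear s)
      ; independent = λ c c≈0 s →
          let K = sum λ s → c s * φ (κ s) in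
          ≈-trans (≈-reflexive (≡.sym (insertAt-punchIn c t K s)))
            (independent B (insertAt c t K) (λ i → begin
              combination (insertAt c t K) (λ k → e k ^) i
                ≈⟨ sum-remove {i = t} (λ k → insertAt c t K k * (e k ^) i) ⟩
              insertAt c t K t * (e t ^) i + sum (λ s → insertAt c t K (punchIn t s) * (e (punchIn t s) ^) i)
                ≈⟨ +-cong (*-congʳ (≈-reflexive (insertAt-lookup c t K)))
                     (sum-cong-≋ {p} λ s → *-congʳ (≈-reflexive (insertAt-punchIn c t K s))) ⟩
              K * (e t ^) i + sum (λ s → c s * (e (punchIn t s) ^) i)
                ≈⟨ +-comm _ _ ⟩
              sum (λ s → c s * (e (punchIn t s) ^) i) + K * (e t ^) i
                ≈⟨ combination-e′ c i ⟨
              combination c (λ s → e′ s ^) i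
                ≈⟨ c≈0 i ⟩
              0# ∎) (punchIn t s))
      ; spanning    = λ v (b⊥v , Pv) → let (c , v≈) = spanning B v Pv in
          c ∘ punchIn t , λ i → begin
            v i
              ≈⟨ v≈ i ⟩
            combination c (λ k → e k ^) i
              ≈⟨ sum-remove {i = t} (λ k → c k * (e k ^) i) ⟩
            c t * (e t ^) i + sum (λ s → c (punchIn t s) * (e (punchIn t s) ^) i)
              ≈⟨ +-comm _ _ ⟩
            sum (λ s → c (punchIn t s) * (e (punchIn t s) ^) i) + c t * (e t ^) i
              ≈⟨ +-congˡ (*-congʳ (pivot v b⊥v c v≈)) ⟩
            sum (λ s → c (punchIn t s) * (e (punchIn t s) ^) i) + sum (λ s → c (punchIn t s) * φ (κ s)) * (e t ^) i
              ≈⟨ combination-e′ (c ∘ punchIn t) i ⟨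
            combination (c ∘ punchIn t) (λ s → e′ s ^) i ∎
      }
      where
      pivot : ∀ v → dot (b ^) v ≈ 0# → ∀ c → (∀ i → v i ≈ combination c (λ k → e k ^) i) →
              c t ≈ sum (λ s → c (punchIn t s) * φ (κ s))
      pivot v b⊥v c v≈ = begin
        c t                    ≈⟨ *-identityʳ _ ⟨
        c t * 1#               ≈⟨ *-congˡ (≈-trans (≈-sym 1#-homo) (≈-trans (φ-cong (≡.trans (≡.sym g*f≡1) (ℚ.*-comm g (f t)))) (*-homo (f t) g))) ⟩
        c t * (φ (f t) * φ g)  ≈⟨ *-assoc _ _ _ ⟨
        x * φ g                ≈⟨ *-congʳ x≈y′ ⟩
        y′ * φ g               ≈⟨ *-distribʳ-sum (φ g) (λ s → c (punchIn t s) * φ (ℚ.- f (punchIn t s))) ⟩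
        sum (λ s → c (punchIn t s) * φ (ℚ.- f (punchIn t s)) * φ g)
          ≈⟨ sum-cong-≋ {p} (λ s → ≈-trans (*-assoc _ _ _) (*-congˡ (≈-sym (*-homo _ g)))) ⟩
        sum (λ s → c (punchIn t s) * φ (κ s)) ∎
        where
        x y y′ : Carrier
        x  = c t * φ (f t)
        y  = sum (λ s → c (punchIn t s) * φ (f (punchIn t s)))
        y′ = sum (λ s → c (punchIn t s) * φ (ℚ.- f (punchIn t s)))

        y+y′≈0 : y + y′ ≈ 0#
        y+y′≈0 = ≈-trans
          (≈-sym (∑-distrib-+ (λ s → c (punchIn t s) * φ (f (punchIn t s))) (λ s → c (punchIn t s) * φ (ℚ.- f (punchIn t s)))))
          (sum-zero {p} _ λ s → begin
            c (punchIn t s) * φ (f (punchIn t s)) + c (punchIn t s) * φ (ℚ.- f (punchIn t s))  ≈⟨ distribˡ _ _ _ ⟨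
            c (punchIn t s) * (φ (f (punchIn t s)) + φ (ℚ.- f (punchIn t s)))                  ≈⟨ *-congˡ (+-homo _ _) ⟨
            c (punchIn t s) * φ (f (punchIn t s) ℚ.+ ℚ.- f (punchIn t s))
              ≈⟨ *-congˡ (≈-trans (φ-cong (ℚ.+-inverseʳ (f (punchIn t s)))) 0#-homo) ⟩
            c (punchIn t s) * 0#                                                               ≈⟨ zeroʳ _ ⟩
            0#                                                                                 ∎)

        x+y≈0 : x + y ≈ 0#
        x+y≈0 = begin
          x + y                              ≈⟨ sum-remove {i = t} (λ k → c k * φ (f k)) ⟨
          sum (λ k → c k * φ (f k))          ≈⟨ sum-cong-≋ {suc p} (λ k → *-congˡ {c k} (φ-dot b (e k))) ⟩
          sum (λ k → c k * dot (b ^) (e k ^)) ≈⟨ dot-combination (b ^) c (λ k → e k ^) ⟨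
          dot (b ^) (combination c (λ k → e k ^)) ≈⟨ dot-cong (λ _ → ≈-refl) v≈ ⟨
          dot (b ^) v                        ≈⟨ b⊥v ⟩
          0#                                 ∎

        x≈y′ : x ≈ y′
        x≈y′ = begin
          x              ≈⟨ +-identityʳ x ⟨
          x + 0#         ≈⟨ +-congˡ y+y′≈0 ⟨
          x + (y + y′)   ≈⟨ +-assoc _ _ _ ⟨
          (x + y) + y′   ≈⟨ +-congʳ x+y≈0 ⟩
          0# + y′        ≈⟨ +-identityˡ y′ ⟩
          y′             ∎

  module Family {K : Set} {N : ℕ} (b : K → Fin N → ℚ) (l ν : K → ℚ) where

    Perpendicular : List K → (Fin N → Carrier) → Set
    Perpendicular L v = All (λ k → dot (b k ^) v ≈ 0#) L

    Orthogonal : List K → Set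
    Orthogonal = AllPairs (λ k k′ → Q.dot (b k) (b k′) ≡ 0ℚ)

    Normalised : List K → Set
    Normalised = All (λ k → ν k ℚ.* Q.dot (b k) (b k) ≡ 1ℚ)

    perpendicular-closed : ∀ L {v} → Perpendicular L v → ∀ {w} → Perpendicular L w → ∀ κ {u} →
                           (∀ i → u i ≈ 1# * v i + κ * w i) → Perpendicular L u
    perpendicular-closed L ⊥v ⊥w κ eq = All.zipWith (λ {k} (bv≈0 , bw≈0) → begin
      _                                          ≈⟨ dot-linearʳ 1# κ _ _ _ (b k ^) eq ⟩
      1# * dot (b k ^) _ + κ * dot (b k ^) _     ≈⟨ +-cong (*-congˡ bv≈0) (*-congˡ bw≈0) ⟩
      1# * 0# + κ * 0#                           ≈⟨ +-cong (zeroʳ _) (zeroʳ _) ⟩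
      0# + 0#                                    ≈⟨ +-identityʳ _ ⟩
      0#                                         ∎) (⊥v , ⊥w)

    standard : IsBasis (Perpendicular []) (λ k → Q.δ {N} k ^)
    standard = record
      { inside      = λ _ → []
      ; independent = λ c c≈0 i → ≈-trans (≈-sym (coordinates c i)) (c≈0 i)
      ; spanning    = λ v _ → v , λ i → ≈-sym (coordinates v i)
      }
      where
      coordinates : ∀ c i → combination c (λ k → Q.δ k ^) i ≈ c i
      coordinates c i = ≈-trans (sum-cong-≋ {N} λ k → *-congˡ (φ-δ k i)) (dot-δʳ c i)

    -- One pivot per eigenvector, starting from the standard basis. Were there no pivot, `b k`,
    -- which lies in the complement of `L` and so in the span of the `e`, would be orthogonal to
    -- itself, against its normalisation.
    perpendicular-basis : ∀ L → Orthogonal L → Normalised L →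
      ∃ λ p → p ℕ.+ length L ≡ N × ∃ λ (e : Fin p → Fin N → ℚ) → IsBasis (Perpendicular L) (λ k → e k ^)
    perpendicular-basis []      orth norms = N , ℕ.+-identityʳ N , Q.δ , standard
    perpendicular-basis (k ∷ L) (k⊥L ∷ orth) (norm ∷ norms)
      with perpendicular-basis L orth norms
    ... | p , p+L≡N , e , B with Fin.any? (λ t → ¬? (Q.dot (b k) (e t) ℚ.≟ 0ℚ))
    ...   | no null = contradiction 1≈0 nontrivial
      where
      ⟂ : Perpendicular L (b k ^)
      ⟂ = All.map (λ {k′} kk′≡0 → ≈-trans (≈-sym (φ-dot (b k′) (b k)))
            (≈-trans (φ-cong (≡.trans (Q.dot-comm (b k′) (b k)) kk′≡0)) 0#-homo)) k⊥L
      norm≈0 : φ (Q.dot (b k) (b k)) ≈ 0#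
      norm≈0 = let (c , b≈) = spanning B (b k ^) ⟂ in begin
        φ (Q.dot (b k) (b k))                         ≈⟨ φ-dot (b k) (b k) ⟩
        dot (b k ^) (b k ^)                           ≈⟨ dot-cong (λ _ → ≈-refl) b≈ ⟩
        dot (b k ^) (combination c (λ t → e t ^))     ≈⟨ dot-combination (b k ^) c (λ t → e t ^) ⟩
        sum (λ t → c t * dot (b k ^) (e t ^))
          ≈⟨ sum-zero {p} _ (λ t → ≈-trans (*-congˡ (≈-trans (≈-sym (φ-dot (b k) (e t)))
               (≈-trans (φ-cong (decidable-stable (Q.dot (b k) (e t) ℚ.≟ 0ℚ) λ ≢0 → null (t , ≢0))) 0#-homo))) (zeroʳ _)) ⟩
        0#                                            ∎
      1≈0 : 1# ≈ 0#
      1≈0 = φ-cancel {Q.dot (b k) (b k)} {ν k} norm (≈-trans (*-identityʳ _) norm≈0)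
    perpendicular-basis (k ∷ L) (k⊥L ∷ orth) (norm ∷ norms) | suc p , p+L≡N , e , B | yes (t , bt≢0) =
      p , ≡.trans (ℕ.+-suc p (length L)) p+L≡N , P.e′ , record
        { inside      = λ s → let (x , y) = inside B′ s in x ∷ y
        ; independent = independent B′
        ; spanning    = λ { v (x ∷ y) → spanning B′ v (x , y) }
        }
      where
      module P = Pivot (b k) e t bt≢0
      B′ : IsBasis (λ v → dot (b k ^) v ≈ 0# × Perpendicular L v) (λ s → P.e′ s ^)
      B′ = P.basis (perpendicular-closed L) B

    orthogonal-independent : ∀ L → Orthogonal L → Normalised L → ∀ (c : Fin (length L) → Carrier) →
      (∀ i → combination c (λ t → b (lookup L t) ^) i ≈ 0#) → ∀ t → c t ≈ 0#
    orthogonal-independent (k ∷ L) (k⊥L ∷ orth) (norm ∷ norms) c c≈0 = λ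
      { zero    → c0≈0
      ; (suc t) → orthogonal-independent L orth norms (c ∘ suc) (λ i → begin
          combination (c ∘ suc) (λ t → b (lookup L t) ^) i                          ≈⟨ +-identityˡ _ ⟨
          0# + combination (c ∘ suc) (λ t → b (lookup L t) ^) i                     ≈⟨ +-congʳ (≈-trans (*-congʳ c0≈0) (zeroˡ _)) ⟨
          combination c (λ t → b (lookup (k ∷ L) t) ^) i                            ≈⟨ c≈0 i ⟩
          0#                                                                        ∎) t
      }
      where
      lookup-All : ∀ {P : K → Set} {L} → All P L → ∀ t → P (lookup L t)
      lookup-All (p ∷ ps) zero    = p
      lookup-All (p ∷ ps) (suc t) = lookup-All ps t

      n : ℚ
      n = Q.dot (b k) (b k)

      c0≈0 : c zero ≈ 0#
      c0≈0 = φ-cancel {n} {ν k} norm (begin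
        φ n * c zero
          ≈⟨ *-comm _ _ ⟩
        c zero * φ n
          ≈⟨ +-identityʳ _ ⟨
        c zero * φ n + 0#
          ≈⟨ +-cong (*-congˡ (φ-dot (b k) (b k))) (≈-sym (sum-zero {length L} _ λ t →
               ≈-trans (*-congˡ (≈-trans (≈-sym (φ-dot (b k) (b (lookup L t))))
                 (≈-trans (φ-cong (lookup-All k⊥L t)) 0#-homo))) (zeroʳ (c (suc t))))) ⟩
        sum (λ t → c t * dot (b k ^) (b (lookup (k ∷ L) t) ^))
          ≈⟨ dot-combination (b k ^) c (λ t → b (lookup (k ∷ L) t) ^) ⟨
        dot (b k ^) (combination c (λ t → b (lookup (k ∷ L) t) ^))
          ≈⟨ dot-cong (λ _ → ≈-refl) c≈0 ⟩
        dot (b k ^) (λ _ → 0#)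
          ≈⟨ sum-zero {N} _ (λ i → zeroʳ _) ⟩
        0# ∎)

    sum-filter : ∀ {P : K → Set} (P? : U.Decidable P) (f : K → Carrier) {L} →
      All (λ k → ¬ P k → f k ≈ 0#) L →
      sum (λ t → f (lookup L t)) ≈ sum (λ t → f (lookup (filter P? L) t))
    sum-filter P? f []                   = ≈-refl
    sum-filter P? f {k ∷ L} (null ∷ nulls) with P? k
    ... | yes _  = +-congˡ (sum-filter P? f nulls)
    ... | no ¬Pk = ≈-trans (+-cong (null ¬Pk) (sum-filter P? f nulls)) (+-identityˡ _)

    module Operator (L : List K) (A : Fin N → Fin N → ℚ) (orth : Orthogonal L) (norms : Normalised L)
      (eigens : All (λ k → ∀ i → Q.dot (A i) (b k) ≡ l k ℚ.* b k i) L)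
      (expansion : ∀ i j → A i j ≡ total (λ k → l k ℚ.* ν k ℚ.* (b k i ℚ.* b k j)) L)
      (l≢0 : All (λ k → l k ≢ 0ℚ) L) (M : Fin N → Fin N → Carrier) (M≈A : ∀ i j → M i j ≈ φ (A i j)) where

      -- Read off from the expansion, each term of which is symmetric.
      symmetric : ∀ i j → A i j ≡ A j i
      symmetric i j = ≡.trans (expansion i j) (≡.trans
        (Q.sum-cong-≗ {length L} λ t → let k = lookup L t in cong (l k ℚ.* ν k ℚ.*_) (ℚ.*-comm (b k i) (b k j)))
        (≡.sym (expansion j i)))

      apply : ∀ v i → dot (M i) v ≈ combination (λ t → φ (l (lookup L t) ℚ.* ν (lookup L t)) * dot (b (lookup L t) ^) v)
                                              (λ t → b (lookup L t) ^) i
      apply v i = begin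
        dot (M i) v
          ≈⟨ sum-cong-≋ {N} (λ j → begin
               M i j * v j                                       ≈⟨ *-congʳ (≈-trans (M≈A i j) (φ-cong (expansion i j))) ⟩
               φ (total (λ k → w k ℚ.* (b k i ℚ.* b k j)) L) * v j  ≈⟨ *-congʳ (φ-sum {length L} _) ⟩
               sum (λ t → φ (w (lookup L t) ℚ.* (b (lookup L t) i ℚ.* b (lookup L t) j))) * v j
                 ≈⟨ *-distribʳ-sum (v j) (λ t → φ (w (lookup L t) ℚ.* (b (lookup L t) i ℚ.* b (lookup L t) j))) ⟩
               sum (λ t → φ (w (lookup L t) ℚ.* (b (lookup L t) i ℚ.* b (lookup L t) j)) * v j) ∎) ⟩
        sum (λ j → sum (λ t → φ (w (lookup L t) ℚ.* (b (lookup L t) i ℚ.* b (lookup L t) j)) * v j))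
          ≈⟨ ∑-comm (λ j t → φ (w (lookup L t) ℚ.* (b (lookup L t) i ℚ.* b (lookup L t) j)) * v j) ⟩
        sum (λ t → sum (λ j → φ (w (lookup L t) ℚ.* (b (lookup L t) i ℚ.* b (lookup L t) j)) * v j))
          ≈⟨ sum-cong-≋ {length L} (λ t → term (lookup L t)) ⟩
        combination (λ t → φ (w (lookup L t)) * dot (b (lookup L t) ^) v) (λ t → b (lookup L t) ^) i ∎
        where
        w : K → ℚ
        w k = l k ℚ.* ν k
        term : ∀ k → sum (λ j → φ (w k ℚ.* (b k i ℚ.* b k j)) * v j) ≈ φ (w k) * dot (b k ^) v * (b k ^) i
        term k = begin
          sum (λ j → φ (w k ℚ.* (b k i ℚ.* b k j)) * v j)
            ≈⟨ sum-cong-≋ {N} (λ j → begin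
                 φ (w k ℚ.* (b k i ℚ.* b k j)) * v j
                   ≈⟨ *-congʳ (φ-cong (≡.sym (ℚ.*-assoc (w k) (b k i) (b k j)))) ⟩
                 φ (w k ℚ.* b k i ℚ.* b k j) * v j         ≈⟨ *-congʳ (*-homo _ _) ⟩
                 φ (w k ℚ.* b k i) * φ (b k j) * v j       ≈⟨ *-assoc _ _ _ ⟩
                 φ (w k ℚ.* b k i) * (φ (b k j) * v j)     ∎) ⟩
          sum (λ j → φ (w k ℚ.* b k i) * (φ (b k j) * v j))
            ≈⟨ *-distribˡ-sum (φ (w k ℚ.* b k i)) (λ j → φ (b k j) * v j) ⟨
          φ (w k ℚ.* b k i) * dot (b k ^) v       ≈⟨ *-congʳ (*-homo _ _) ⟩
          φ (w k) * φ (b k i) * dot (b k ^) v     ≈⟨ *-assoc _ _ _ ⟩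
          φ (w k) * (φ (b k i) * dot (b k ^) v)   ≈⟨ *-congˡ (*-comm _ _) ⟩
          φ (w k) * (dot (b k ^) v * φ (b k i))   ≈⟨ *-assoc _ _ _ ⟨
          φ (w k) * dot (b k ^) v * φ (b k i)     ∎

      apply-eigenvector : All (λ k → ∀ i → dot (M i) (b k ^) ≈ φ (l k) * (b k ^) i) L
      apply-eigenvector = All.map (λ {k} eigen i → begin
        dot (M i) (b k ^)        ≈⟨ dot-cong (M≈A i) (λ _ → ≈-refl) ⟩
        dot (A i ^) (b k ^)      ≈⟨ φ-dot (A i) (b k) ⟨
        φ (Q.dot (A i) (b k))    ≈⟨ φ-cong (eigen i) ⟩
        φ (l k ℚ.* b k i)        ≈⟨ *-homo _ _ ⟩
        φ (l k) * φ (b k i)      ∎) eigens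

      adjoint : ∀ v → All (λ k → dot (b k ^) (λ i → dot (M i) v) ≈ φ (l k) * dot (b k ^) v) L
      adjoint v = All.map (λ {k} eigen → begin
        sum (λ i → φ (b k i) * sum (λ j → M i j * v j))
          ≈⟨ sum-cong-≋ {N} (λ i → *-distribˡ-sum (φ (b k i)) (λ j → M i j * v j)) ⟩
        sum (λ i → sum (λ j → φ (b k i) * (M i j * v j)))
          ≈⟨ ∑-comm (λ i j → φ (b k i) * (M i j * v j)) ⟩
        sum (λ j → sum (λ i → φ (b k i) * (M i j * v j)))
          ≈⟨ sum-cong-≋ {N} (λ j → begin
               sum (λ i → φ (b k i) * (M i j * v j))
                 ≈⟨ sum-cong-≋ {N} (λ i → begin
                      φ (b k i) * (M i j * v j)  ≈⟨ *-assoc _ _ _ ⟨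
                      φ (b k i) * M i j * v j    ≈⟨ *-congʳ (*-comm _ _) ⟩
                      M i j * φ (b k i) * v j
                        ≈⟨ *-congʳ (*-congʳ (≈-trans (M≈A i j) (≈-trans (φ-cong (symmetric i j)) (≈-sym (M≈A j i))))) ⟩
                      M j i * φ (b k i) * v j    ∎) ⟩
               sum (λ i → M j i * φ (b k i) * v j)  ≈⟨ *-distribʳ-sum (v j) (λ i → M j i * φ (b k i)) ⟨
               dot (M j) (b k ^) * v j              ≈⟨ *-congʳ (eigen j) ⟩
               φ (l k) * φ (b k j) * v j            ≈⟨ *-assoc _ _ _ ⟩
               φ (l k) * (φ (b k j) * v j)          ∎) ⟩
        sum (λ j → φ (l k) * (φ (b k j) * v j))
          ≈⟨ *-distribˡ-sum (φ (l k)) (λ j → φ (b k j) * v j) ⟨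
        φ (l k) * dot (b k ^) v ∎) apply-eigenvector

      Eigen : Carrier → (Fin N → Carrier) → Set
      Eigen μ v = ∀ i → dot (M i) v ≈ μ * v i

      eigen-adjoint : ∀ {μ v} → Eigen μ v → All (λ k → φ (l k) * dot (b k ^) v ≈ μ * dot (b k ^) v) L
      eigen-adjoint {μ} {v} eigen = All.map (λ {k} adj → begin
        φ (l k) * dot (b k ^) v                ≈⟨ adj ⟨
        dot (b k ^) (λ i → dot (M i) v)        ≈⟨ dot-cong (λ _ → ≈-refl) eigen ⟩
        sum (λ i → φ (b k i) * (μ * v i))
          ≈⟨ sum-cong-≋ {N} (λ i → ≈-trans (≈-sym (*-assoc _ _ _)) (≈-trans (*-congʳ (*-comm _ _)) (*-assoc _ _ _))) ⟩
        sum (λ i → μ * (φ (b k i) * v i))      ≈⟨ *-distribˡ-sum μ (λ i → φ (b k i) * v i) ⟨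
        μ * dot (b k ^) v                      ∎) (adjoint v)

      apply-perpendicular : ∀ {v} → Perpendicular L v → ∀ i → dot (M i) v ≈ 0#
      apply-perpendicular {v} ⟂ i = ≈-trans (apply v i) (go L ⟂)
        where
        go : ∀ L′ → Perpendicular L′ v →
             combination (λ t → φ (l (lookup L′ t) ℚ.* ν (lookup L′ t)) * dot (b (lookup L′ t) ^) v) (λ t → b (lookup L′ t) ^) i ≈ 0#
        go []       []        = ≈-refl
        go (k ∷ L′) (≈0 ∷ ⟂) = ≈-trans (+-cong
          (≈-trans (*-congʳ (≈-trans (*-congˡ ≈0) (zeroʳ _))) (zeroˡ _)) (go L′ ⟂)) (+-identityʳ _)

      -- The kernel is the orthogonal complement of `L`: the expansion kills the complement, and a
      -- kernel vector is orthogonal to every eigenvector whose eigenvalue is not 0.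
      kernel-basis : ∃ λ p → p ℕ.+ length L ≡ N × ∃ λ (e : Fin p → Fin N → Carrier) → IsBasis (Eigen 0#) e
      kernel-basis with perpendicular-basis L orth norms
      ... | p , eq , e , B = p , eq , (λ k → e k ^) , record
        { inside      = λ k i → ≈-trans (apply-perpendicular (inside B k) i) (≈-sym (zeroˡ _))
        ; independent = independent B
        ; spanning    = λ v eigen → spanning B v (All.zipWith
            (λ {k} (≢0 , eq) → φ-cancel-≢0 ≢0 (≈-trans eq (zeroˡ _))) (l≢0 , eigen-adjoint eigen))
        }

      -- For spanning, `v` is recovered as the inverse of `μ` times its image, and the image is
      -- expanded over `L`; an eigenvector of another eigenvalue is orthogonal to `v`, so its term
      -- drops out.
      eigenspace-basis : ∀ μ → μ ≢ 0ℚ →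
        let L′ = filter (λ k → l k ℚ.≟ μ) L in IsBasis (Eigen (φ μ)) (λ t → b (lookup L′ t) ^)
      eigenspace-basis μ μ≢0 = record
        { inside      = inside′ (All.all-filter (λ k → l k ℚ.≟ μ) L) (All.filter⁺ (λ k → l k ℚ.≟ μ) apply-eigenvector)
        ; independent = orthogonal-independent L′ (AllPairs.filter⁺ (λ k → l k ℚ.≟ μ) orth) (All.filter⁺ (λ k → l k ℚ.≟ μ) norms)
        ; spanning    = λ v eigen → c v ∘ lookup L′ , λ i → begin
            v i                                         ≈⟨ *-identityˡ _ ⟨
            1# * v i                                    ≈⟨ *-congʳ (≈-trans (≈-sym 1#-homo) (≈-trans (φ-cong (≡.sym μ⁻¹*μ≡1)) (*-homo μ⁻¹ μ))) ⟩
            φ μ⁻¹ * φ μ * v i                           ≈⟨ *-assoc _ _ _ ⟩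
            φ μ⁻¹ * (φ μ * v i)                         ≈⟨ *-congˡ (≈-trans (≈-sym (eigen i)) (apply v i)) ⟩
            φ μ⁻¹ * sum (λ t → φ (l (lookup L t) ℚ.* ν (lookup L t)) * dot (b (lookup L t) ^) v * φ (b (lookup L t) i))
              ≈⟨ *-distribˡ-sum (φ μ⁻¹) (λ t → φ (l (lookup L t) ℚ.* ν (lookup L t)) * dot (b (lookup L t) ^) v * φ (b (lookup L t) i)) ⟩
            sum (λ t → φ μ⁻¹ * (φ (l (lookup L t) ℚ.* ν (lookup L t)) * dot (b (lookup L t) ^) v * φ (b (lookup L t) i)))
              ≈⟨ sum-cong-≋ {length L} (λ t → ≈-sym (*-assoc _ _ _)) ⟩
            sum (λ t → c v (lookup L t) * φ (b (lookup L t) i))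
              ≈⟨ sum-filter (λ k → l k ℚ.≟ μ) (λ k → c v k * φ (b k i)) (All.map (λ {k} eq lk≢μ →
                   ≈-trans (*-congʳ (≈-trans (*-congˡ (≈-trans (*-congˡ (vanish lk≢μ eq)) (zeroʳ _))) (zeroʳ _))) (zeroˡ _))
                   (eigen-adjoint eigen)) ⟩
            sum (λ t → c v (lookup L′ t) * φ (b (lookup L′ t) i)) ∎
        }
        where
        L′ : List K
        L′ = filter (λ k → l k ℚ.≟ μ) L
        μ⁻¹ : ℚ
        μ⁻¹ = (ℚ.1/ μ) {{ℚ.≢-nonZero μ≢0}}
        μ⁻¹*μ≡1 : μ⁻¹ ℚ.* μ ≡ 1ℚ
        μ⁻¹*μ≡1 = ℚ.*-inverseˡ μ {{ℚ.≢-nonZero μ≢0}}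
        c : (Fin N → Carrier) → K → Carrier
        c v k = φ μ⁻¹ * (φ (l k ℚ.* ν k) * dot (b k ^) v)

        inside′ : ∀ {L} → All (λ k → l k ≡ μ) L → All (λ k → ∀ i → dot (M i) (b k ^) ≈ φ (l k) * (b k ^) i) L →
                  ∀ t → Eigen (φ μ) (b (lookup L t) ^)
        inside′ (refl ∷ _) (eigen ∷ _)  zero    = eigen
        inside′ (_ ∷ eqs)  (_ ∷ eigens) (suc t) = inside′ eqs eigens t

        vanish : ∀ {k x} → l k ≢ μ → φ (l k) * x ≈ φ μ * x → x ≈ 0#
        vanish {k} {x} lk≢μ eq = φ-cancel-≢0 {l k ℚ.+ ℚ.- μ} (λ ≡0 → lk≢μ (difference ≡0)) (begin
          φ (l k ℚ.+ ℚ.- μ) * x               ≈⟨ *-congʳ (+-homo _ _) ⟩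
          (φ (l k) + φ (ℚ.- μ)) * x           ≈⟨ distribʳ _ _ _ ⟩
          φ (l k) * x + φ (ℚ.- μ) * x         ≈⟨ +-congʳ eq ⟩
          φ μ * x + φ (ℚ.- μ) * x             ≈⟨ distribʳ _ _ _ ⟨
          (φ μ + φ (ℚ.- μ)) * x               ≈⟨ *-congʳ (+-homo _ _) ⟨
          φ (μ ℚ.+ ℚ.- μ) * x                 ≈⟨ *-congʳ (≈-trans (φ-cong (ℚ.+-inverseʳ μ)) 0#-homo) ⟩
          0# * x                              ≈⟨ zeroˡ x ⟩
          0#                                  ∎)
          where
          difference : l k ℚ.+ ℚ.- μ ≡ 0ℚ → l k ≡ μ
          difference ≡0 = ≡.trans (solve 2 (λ p q → p := (p :+ :- q) :+ q) refl (l k) μ)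
            (≡.trans (cong (ℚ._+ μ) ≡0) (ℚ.+-identityˡ μ))

      -- The cancellation hypotheses express positively that `μ` differs from 0 and from every
      -- `l k`. They make `v` perpendicular to `L`, hence killed by `M`, and finally zero.
      eigenvector-null : ∀ {μ v} → Eigen μ v → (∀ x → μ * x ≈ 0# → x ≈ 0#) →
        All (λ k → ∀ x → φ (l k) * x ≈ μ * x → x ≈ 0#) L → ∀ i → v i ≈ 0#
      eigenvector-null eigen μ-cancel cancels i = μ-cancel _ (≈-trans (≈-sym (eigen i)) (apply-perpendicular
        (All.zipWith (λ (cancel , eq) → cancel _ eq) (cancels , eigen-adjoint eigen)) i))

-- Apartness of a real number from integers

module RealNumbers where
  open Defs using (_≈_; _+_; _*_; -_; ∣_∣)
  open Rationals
  open +-*-Solver using (solve; _:=_; _:+_; _:-_; _:*_; :-_; con)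
  private module ℝ-ring = CommutativeRing ℝ-ring

  pointwise : ∀ {x y} → (∀ n → seq x n ≡ seq y n) → x ≈ y
  pointwise {x} {y} eq ε ε>0 = let (N , h) = ℝ-ring.refl {y} ε ε>0 in
    N , λ n N≤n → subst (λ q → ℚ.∣ q ℚ.- seq y n ∣ ℚ.< ε) (sym (eq n)) (h n N≤n)

  fromℚ-homomorphism : IsRingHomomorphism (CommutativeRing.rawRing ℚ.+-*-commutativeRing) ℝ-ring.rawRing fromℚ
  fromℚ-homomorphism = record
    { isSemiringHomomorphism = record
      { isNearSemiringHomomorphism = record
        { +-isMonoidHomomorphism = record
          { isMagmaHomomorphism = record
            { isRelHomomorphism = record { cong = λ { {p} refl → ℝ-ring.refl {fromℚ p} } }
            ; homo = λ p q → ℝ-ring.refl {fromℚ (p ℚ.+ q)}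
            }
          ; ε-homo = ℝ-ring.refl {fromℕ 0}
          }
        ; *-homo = λ p q → ℝ-ring.refl {fromℚ (p ℚ.* q)}
        }
      ; 1#-homo = ℝ-ring.refl {fromℕ 1}
      }
    ; -‿homo = λ p → ℝ-ring.refl {fromℚ (ℚ.- p)}
    }

  -- Being nonzero with a witness, which is what cancelling a real factor requires.
  Apart : ℝ → Set
  Apart x = ∃ λ δ → 0ℚ ℚ.< δ × Eventually λ n → δ ℚ.≤ ℚ.∣ seq x n ∣

  ∣-0∣ : ∀ q → ℚ.∣ q ℚ.- 0ℚ ∣ ≡ ℚ.∣ q ∣
  ∣-0∣ q = cong ℚ.∣_∣ (ℚ.+-identityʳ q)

  1≤distance : ∀ {a b} → a ≢ b → 1ℚ ℚ.≤ ℚ.∣ ι a ℚ.- ι b ∣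
  1≤distance {a} {b} a≢b = subst (1ℚ ℚ.≤_)
    (sym (trans (cong ℚ.∣_∣ (trans (cong (ι a ℚ.+_) (sym (ι-neg b))) (sym (ι-+ a (ℤ.- b))))) (ι-∣∣ (a ℤ.- b))))
    (ι-mono-≤ {1ℤ} (ℤ.+≤+ (ℕ.n≢0⇒n>0 (a≢b ∘ ℤ.i-j≡0⇒i≡j a b ∘ ℤ.∣i∣≡0⇒i≡0))))

  fromℤ-injective : ∀ {a b} → fromℤ a ≈ fromℤ b → a ≡ b
  fromℤ-injective {a} {b} a≈b with a ℤ.≟ b
  ... | yes a≡b = a≡b
  ... | no a≢b  = let (N , small) = a≈b 1ℚ (ℚ.positive⁻¹ 1ℚ) in
    contradiction (ℚ.<-≤-trans (small N ℕ.≤-refl) (1≤distance a≢b)) (ℚ.<-irrefl refl)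

  apart-cancel : ∀ {x y} → Apart x → x * y ≈ fromℕ 0 → y ≈ fromℕ 0
  apart-cancel {x} {y} (δ , δ>0 , M , x≥) xy≈0 ε ε>0 =
    let (N , xy<) = xy≈0 (δ ℚ.* ε) δε>0 in
    M ℕ.⊔ N , λ n h → ℚ.≰⇒> λ ε≤ → ℚ.<-irrefl refl (begin-strict
      ℚ.∣ seq x n ℚ.* seq y n ℚ.- 0ℚ ∣   <⟨ xy< n (ℕ.≤-trans (ℕ.m≤n⊔m M N) h) ⟩
      δ ℚ.* ε                            ≤⟨ ℚ.*-monoˡ-≤-nonNeg δ {{ℚ.pos⇒nonNeg δ {{ℚ.positive δ>0}}}} ε≤ ⟩
      δ ℚ.* ℚ.∣ seq y n ℚ.- 0ℚ ∣         ≡⟨ cong (δ ℚ.*_) (∣-0∣ (seq y n)) ⟩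
      δ ℚ.* ℚ.∣ seq y n ∣
        ≤⟨ ℚ.*-monoʳ-≤-nonNeg ℚ.∣ seq y n ∣ {{ℚ.∣-∣-nonNeg (seq y n)}} (x≥ n (ℕ.≤-trans (ℕ.m≤m⊔n M N) h)) ⟩
      ℚ.∣ seq x n ∣ ℚ.* ℚ.∣ seq y n ∣    ≡⟨ ℚ.∣p*q∣≡∣p∣*∣q∣ (seq x n) (seq y n) ⟨
      ℚ.∣ seq x n ℚ.* seq y n ∣          ≡⟨ ∣-0∣ (seq x n ℚ.* seq y n) ⟨
      ℚ.∣ seq x n ℚ.* seq y n ℚ.- 0ℚ ∣   ∎)
    where
    open ℚ.≤-Reasoning
    δε>0 : 0ℚ ℚ.< δ ℚ.* ε
    δε>0 = ℚ.positive⁻¹ (δ ℚ.* ε) {{ℚ.pos*pos⇒pos δ {{ℚ.positive δ>0}} ε {{ℚ.positive ε>0}}}}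

  private
    gap : ∀ {a b c d e} → a ℚ.≤ b ℚ.+ c → b ℚ.< d → d ℚ.+ e ℚ.≤ a → e ℚ.≤ c
    gap {a} {b} {c} {d} {e} a≤b+c b<d d+e≤a = ℚ.≮⇒≥ λ c<e → ℚ.<-irrefl refl
      (ℚ.≤-<-trans a≤b+c (ℚ.<-≤-trans (ℚ.+-mono-< b<d c<e) d+e≤a))

    triangle : ∀ a b c → ℚ.∣ a ℚ.- c ∣ ℚ.≤ ℚ.∣ a ℚ.- b ∣ ℚ.+ ℚ.∣ b ℚ.- c ∣
    triangle a b c = ℚ.≤-trans
      (ℚ.≤-reflexive (cong ℚ.∣_∣ (solve 3 (λ a b c → a :- c := (a :- b) :+ (b :- c)) refl a b c)))
      (ℚ.∣p+q∣≤∣p∣+∣q∣ (a ℚ.- b) (b ℚ.- c))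

    distance-comm : ∀ a b → ℚ.∣ a ℚ.- b ∣ ≡ ℚ.∣ b ℚ.- a ∣
    distance-comm a b = trans (cong ℚ.∣_∣ (solve 2 (λ a b → a :- b := :- (b :- a)) refl a b)) (ℚ.∣-p∣≡∣p∣ (b ℚ.- a))

    ¼ : ℚ
    ¼ = ½ ℚ.* ½

    half>0 : ∀ {p} → 0ℚ ℚ.< p → 0ℚ ℚ.< p ℚ.* ½
    half>0 {p} p>0 = ℚ.positive⁻¹ (p ℚ.* ½) {{ℚ.pos*pos⇒pos p {{ℚ.positive p>0}} ½}}

    half+half : ∀ p → p ℚ.* ½ ℚ.+ p ℚ.* ½ ≡ p
    half+half p = solve 1 (λ p → p :* con ½ :+ p :* con ½ := p) refl p

    half< : ∀ {p} → 0ℚ ℚ.< p → p ℚ.* ½ ℚ.< p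
    half< {p} p>0 = subst₂ ℚ._<_ (ℚ.+-identityʳ (p ℚ.* ½)) (half+half p) (ℚ.+-monoʳ-< (p ℚ.* ½) (half>0 p>0))

  -- An entry known up to ε/4 is compared with ε/2: if it is smaller, later entries stay below ε;
  -- otherwise they stay above ε/4, which is excluded.
  tight : ∀ {x} → ¬ Apart x → x ≈ fromℕ 0
  tight {x} ¬apart ε ε>0 with cauchy x (ε ℚ.* ½ ℚ.* ½) (half>0 (half>0 ε>0))
  ... | N , close with ℚ.∣ seq x N ∣ ℚ.<? ε ℚ.* ½
  ...   | yes small = N , λ n N≤n → ℚ.≤-<-trans (triangle (seq x n) (seq x N) 0ℚ)
    (subst (_ ℚ.<_) (half+half ε) (ℚ.+-mono-<
      (ℚ.<-trans (close n N N≤n ℕ.≤-refl) (half< (half>0 ε>0)))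
      (subst (ℚ._< ε ℚ.* ½) (sym (∣-0∣ (seq x N))) small)))
  ...   | no large = contradiction
    (ε ℚ.* ½ ℚ.* ½ , half>0 (half>0 ε>0) , N , λ n N≤n →
      subst (ε ℚ.* ½ ℚ.* ½ ℚ.≤_) (∣-0∣ (seq x n))
        (gap (triangle (seq x N) (seq x n) 0ℚ) (close N n ℕ.≤-refl N≤n)
          (subst₂ ℚ._≤_ (sym (half+half (ε ℚ.* ½))) (sym (∣-0∣ (seq x N))) (ℚ.≮⇒≥ large))))
    ¬apart

  -- The choice is made on a rational approximation within 1/4. If it lies 1/2 or more from `s`,
  -- then `μ` stays 1/4 away from `s`; if less, the approximation lies at least 1/2 from every other
  -- integer, and `μ` stays 1/4 away from those.
  near-integer : ∀ μ s → Apart (μ + - fromℤ s) ⊎ (∀ s′ → s ≢ s′ → Apart (μ + - fromℤ s′))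
  near-integer μ s with cauchy μ ¼ (ℚ.positive⁻¹ ¼)
  ... | N , close = decide (ℚ.∣ seq μ N ℚ.- ι s ∣ ℚ.<? ½)
    where
    far : ∀ s → ½ ℚ.≤ ℚ.∣ seq μ N ℚ.- ι s ∣ → Apart (μ + - fromℤ s)
    far s ½≤ = ¼ , ℚ.positive⁻¹ ¼ , N , λ n N≤n →
      gap (triangle (seq μ N) (seq μ n) (ι s)) (close N n ℕ.≤-refl N≤n) ½≤

    decide : Dec (ℚ.∣ seq μ N ℚ.- ι s ∣ ℚ.< ½) →
             Apart (μ + - fromℤ s) ⊎ (∀ s′ → s ≢ s′ → Apart (μ + - fromℤ s′))
    decide (no large)  = inj₁ (far s (ℚ.≮⇒≥ large))
    decide (yes small) = inj₂ λ s′ s≢s′ → far s′ (gap (triangle (ι s) (seq μ N) (ι s′))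
      (subst (ℚ._< ½) (distance-comm (seq μ N) (ι s)) small) (1≤distance s≢s′))

  isolate : ∀ μ (S : List ℤ) → All (λ s → Apart (μ + - fromℤ s)) S ⊎
            ∃ λ s → s ∈ S × (∀ s′ → s ≢ s′ → Apart (μ + - fromℤ s′))
  isolate μ []      = inj₁ []
  isolate μ (s ∷ S) with near-integer μ s
  ... | inj₂ others = inj₂ (s , here refl , others)
  ... | inj₁ apart with isolate μ S
  ...   | inj₁ all                = inj₁ (apart ∷ all)
  ...   | inj₂ (s′ , s′∈S , rest) = inj₂ (s′ , there s′∈S , rest)

  nontrivial : ¬ fromℕ 1 ≈ fromℕ 0
  nontrivial 1≈0 with fromℤ-injective {1ℤ} {0ℤ} 1≈0
  ... | ()

-- Spectrum, nullity and energy from an exhausting family of integer eigenvectors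

module IntegerSpectrum {N : ℕ} {K : Set} (b : K → Fin N → ℤ) (l : K → ℤ) (L : List K) (A : Fin N → Fin N → ℤ)
  (orthogonal : AllPairs (λ k k′ → Sums.dot ℤ.+-*-commutativeRing (b k) (b k′) ≡ 0ℤ) L)
  (nonzero : All (λ k → ¬ (∀ i → b k i ≡ 0ℤ)) L)
  (eigens : All (λ k → ∀ i → Sums.dot ℤ.+-*-commutativeRing (A i) (b k) ≡ l k ℤ.* b k i) L)
  (l≢0 : All (λ k → l k ≢ 0ℤ) L)
  (frobenius≡ : Sums.sum ℤ.+-*-commutativeRing (λ i → Sums.dot ℤ.+-*-commutativeRing (A i) (A i)) ≡ Sums.sum ℤ.+-*-commutativeRing (λ t → l (lookup L t) ℤ.* l (lookup L t)))
  (M : Matrix N) (M≡A : ∀ i j → M i j ≡ fromℤ (A i j)) where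

  open Defs using (_≈_; _+_; _*_; -_; ∣_∣)
  open Rationals
  open RealNumbers
  open Counting using (∑; ∑-cong; ∑-+)
  private
    module ℝ-ring = CommutativeRing ℝ-ring
    module Z = Sums ℤ.+-*-commutativeRing
  open Spectral ℝ-ring fromℚ fromℚ-homomorphism nontrivial

  ι-sum : ∀ {n} (x : Fin n → ℤ) → ι (Z.sum x) ≡ Q.sum (ι ∘ x)
  ι-sum {zero}  x = refl
  ι-sum {suc n} x = trans (ι-+ (x zero) _) (cong (ι (x zero) ℚ.+_) (ι-sum (x ∘ suc)))

  ι-dot : ∀ {n} (x y : Fin n → ℤ) → ι (Z.dot x y) ≡ Q.dot (ι ∘ x) (ι ∘ y)
  ι-dot {n} x y = trans (ι-sum (λ i → x i ℤ.* y i)) (Q.sum-cong-≗ {n} λ i → ι-* (x i) (y i))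

  norm : K → ℚ
  norm k = Q.dot (ι ∘ b k) (ι ∘ b k)

  -- The inverse of the squared norm, made total by an irrelevant value for norm 0.
  ν : K → ℚ
  ν k with norm k ℚ.≟ 0ℚ
  ... | yes _  = 0ℚ
  ... | no ≢0 = (ℚ.1/ norm k) {{ℚ.≢-nonZero ≢0}}

  normalised : All (λ k → ν k ℚ.* norm k ≡ 1ℚ) L
  normalised = All.map (λ {k} → ν-inverse k) nonzero
    where
    ν-inverse : ∀ k → ¬ (∀ i → b k i ≡ 0ℤ) → ν k ℚ.* norm k ≡ 1ℚ
    ν-inverse k b≢0 with norm k ℚ.≟ 0ℚ
    ... | yes ≡0 = contradiction (λ i → ι-injective (Deflation.norm≡0 (ι ∘ b k) ≡0 i)) b≢0
    ... | no ≢0  = ℚ.*-inverseˡ (norm k) {{ℚ.≢-nonZero ≢0}}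

  private
    A′ : Fin N → Fin N → ℚ
    A′ i j = ι (A i j)

    orthogonal′ : AllPairs (λ k k′ → Q.dot (ι ∘ b k) (ι ∘ b k′) ≡ 0ℚ) L
    orthogonal′ = AllPairs.map (λ {k} {k′} eq → trans (sym (ι-dot (b k) (b k′))) (cong ι eq)) orthogonal

    eigens′ : All (λ k → ∀ i → Q.dot (A′ i) (ι ∘ b k) ≡ ι (l k) ℚ.* ι (b k i)) L
    eigens′ = All.map (λ {k} eq i → trans (sym (ι-dot (A i) (b k))) (trans (cong ι (eq i)) (ι-* (l k) (b k i)))) eigens

    frobenius′ : Deflation.frobenius A′ ≡ Deflation.total (λ k → ι (l k) ℚ.* ι (l k)) L
    frobenius′ = trans (Q.sum-cong-≗ {N} (λ i → sym (ι-dot (A i) (A i)))) (trans (sym (ι-sum (λ i → Z.dot (A i) (A i))))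
      (trans (cong ι frobenius≡) (trans (ι-sum (λ t → l (lookup L t) ℤ.* l (lookup L t)))
        (Q.sum-cong-≗ {length L} λ t → ι-* (l (lookup L t)) (l (lookup L t))))))

  open Family (λ k → ι ∘ b k) (ι ∘ l) ν
  open Operator L A′ orthogonal′ normalised eigens′
    (Deflation.expansion (λ k → ι ∘ b k) (ι ∘ l) ν L A′ orthogonal′ normalised eigens′ frobenius′)
    (All.map (_∘ ι-injective) l≢0) M (λ i j → ℝ-ring.reflexive (M≡A i j))

  private
    -- Comparing the two sides inside _≈_ would unfold the real arithmetic, which
    -- is prohibitively slow.
    combination≡ : ∀ {m} (c : Fin m → ℝ) (e : Fin m → Fin N → ℝ) i → Sums.combination ℝ-ring c e i ≡ linearCombination c e i
    combination≡ c e i = refl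

    apply≡ : ∀ v i → Sums.dot ℝ-ring (M i) v ≡ (M · v) i
    apply≡ v i = refl

    fromEigen : ∀ {μ v} → Eigen μ v → InEigenspace M μ v
    fromEigen {μ} {v} eigen i = subst (_≈ μ * v i) (apply≡ v i) (eigen i)

    toEigen : ∀ {μ v} → InEigenspace M μ v → Eigen μ v
    toEigen {μ} {v} eigen i = subst (_≈ μ * v i) (sym (apply≡ v i)) (eigen i)

    fromBasis : ∀ {μ m} {e : Fin m → Fin N → ℝ} → IsBasis (Eigen μ) e → IsBasisOf (InEigenspace M μ) e
    fromBasis {μ} {e = e} B = record
      { inside      = λ k → fromEigen {μ} {e k} (IsBasis.inside B k)
      ; independent = λ c c≋𝟎 → IsBasis.independent B c λ i → subst (_≈ fromℕ 0) (sym (combination≡ c e i)) (c≋𝟎 i)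
      ; spanning    = λ v eigen → let (c , v≈) = IsBasis.spanning B v (toEigen {μ} {v} eigen) in
                      c , λ i → subst (v i ≈_) (combination≡ c e i) (v≈ i)
      }

  nullity : ∃ λ p → p ℕ.+ length L ≡ N × HasMultiplicity M (fromℕ 0) p
  nullity = let (p , eq , e , B) = kernel-basis in p , eq , e , fromBasis {fromℕ 0} B

  -- The comparison takes place in ℚ so that this is literally the filter of `eigenspace-basis`.
  matching : ℤ → List K → List K
  matching z = filter (λ k → ι (l k) ℚ.≟ ι z)

  multiplicity : ∀ z → z ≢ 0ℤ → HasMultiplicity M (fromℤ z) (length (matching z L))
  multiplicity z z≢0 = _ , fromBasis {fromℤ z} (eigenspace-basis (ι z) (z≢0 ∘ ι-injective))

  -- If the first basis vector vanished, the coefficients `δ zero` would form a relation, and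
  -- independence would give 1 = 0.
  multiplicity⇒eigenvalue : ∀ {μ m} → HasMultiplicity M μ (suc m) → IsEigenvalue M μ
  multiplicity⇒eigenvalue {μ} {m} (e , B) = e zero , (λ e≋𝟎 → nontrivial (IsBasisOf.independent B (Sums.δ ℝ-ring zero) (λ i →
    subst (_≈ fromℕ 0) (combination≡ (Sums.δ ℝ-ring zero) e i)
      (ℝ-ring.trans {Sums.combination ℝ-ring (Sums.δ ℝ-ring zero) e i} {e zero i} {fromℕ 0}
        (Sums.dot-δˡ ℝ-ring zero (λ k → e k i)) (e≋𝟎 i))) zero)) , IsBasisOf.inside B zero

  -- Equality with a candidate is undecidable, but approximation leaves at most one candidate `s`
  -- from which `μ` is not known to be apart. Apartness from all candidates would make the
  -- eigenvector zero, so `μ` is not apart from `s`, and tightness turns this into equality.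
  classify : ∀ μ → IsEigenvalue M μ → ∃ λ s → s ∈ 0ℤ ∷ map l L × μ ≈ fromℤ s
  classify μ (v , v≢𝟎 , eigen) = conclude (isolate μ (0ℤ ∷ map l L))
    where
    cancel : ∀ {s} → Apart (μ + - fromℤ s) → ∀ x → fromℤ s * x ≈ μ * x → x ≈ fromℕ 0
    cancel {s} apart x eq = apart-cancel {μ + - fromℤ s} {x} apart (difference-null {fromℤ s} {μ} {x} eq)

    not-all : ¬ All (λ s → Apart (μ + - fromℤ s)) (0ℤ ∷ map l L)
    not-all (apart₀ ∷ aparts) = v≢𝟎 (eigenvector-null {μ} {v} (toEigen {μ} {v} eigen)
      (λ x μx≈0 → cancel {0ℤ} apart₀ x (ℝ-ring.trans {fromℕ 0 * x} {fromℕ 0} {μ * x}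
        (ℝ-ring.zeroˡ x) (ℝ-ring.sym {μ * x} {fromℕ 0} μx≈0)))
      (All.map (λ {k} → cancel {l k}) (All.map⁻ aparts)))

    conclude : All (λ s → Apart (μ + - fromℤ s)) (0ℤ ∷ map l L) ⊎
               (∃ λ s → s ∈ 0ℤ ∷ map l L × (∀ s′ → s ≢ s′ → Apart (μ + - fromℤ s′))) →
               ∃ λ s → s ∈ 0ℤ ∷ map l L × μ ≈ fromℤ s
    conclude (inj₁ all) = contradiction all not-all
    conclude (inj₂ (s , s∈ , others)) = s , s∈ , difference-≈ {fromℤ s} {μ} (tight {μ + - fromℤ s} λ apart →
      not-all (All.tabulate λ {s′} _ → case-≟ apart s′))
      where
      case-≟ : Apart (μ + - fromℤ s) → ∀ s′ → Apart (μ + - fromℤ s′)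
      case-≟ apart s′ with s ℤ.≟ s′
      ... | yes refl = apart
      ... | no s≢s′  = others s′ s≢s′

  values : List ℤ
  values = deduplicate ℤ._≟_ (map l L)

  values-unique : AllPairs _≢_ values
  values-unique = deduplicate-! ℤ._≟_ (map l L)

  -- The value 0 is listed whatever its multiplicity, so `isSpectrum` asks for a kernel of positive
  -- dimension.
  spectrum : ℕ → List (ℝ × ℕ)
  spectrum p = (fromℕ 0 , p) ∷ map (λ z → fromℤ z , length (matching z L)) values

  private
    values≢0 : All (_≢ 0ℤ) values
    values≢0 = All.tabulate λ z∈ → All.lookup (All.map⁺ l≢0) (∈-deduplicate⁻ ℤ._≟_ (map l L) z∈)

    matching-inhabited : ∀ {z} → z ∈ values → ∃ λ m → length (matching z L) ≡ suc m
    matching-inhabited {z} z∈ with ∈-map⁻ l (∈-deduplicate⁻ ℤ._≟_ (map l L) z∈)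
    ... | k , k∈L , refl = go k∈L
      where
      go : ∀ {L} → k ∈ L → ∃ λ m → length (matching (l k) L) ≡ suc m
      go {k′ ∷ L} k∈ with ι (l k′) ℚ.≟ ι (l k)
      ... | yes _ = length (matching (l k) L) , refl
      go {k′ ∷ L} (here refl) | no ≢ = contradiction refl ≢
      go {k′ ∷ L} (there k∈)  | no _ = go k∈

  isSpectrum : ∀ p → HasMultiplicity M (fromℕ 0) (suc p) → IsSpectrum M (spectrum (suc p))
  isSpectrum p kernel = record
    { distinct    = All.map⁺ (All.map (λ z≢0 0≈z → z≢0 (sym (fromℤ-injective 0≈z))) values≢0) ∷
                    AllPairs.map⁺ (AllPairs.map (λ z≢z′ z≈z′ → z≢z′ (fromℤ-injective z≈z′)) values-unique)
    ; eigenvalues = (multiplicity⇒eigenvalue {fromℕ 0} kernel , kernel) ∷ All.map⁺ (All.tabulate λ {z} z∈ →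
        let mult   = multiplicity z (All.lookup values≢0 z∈)
            (_ , eq) = matching-inhabited z∈
        in multiplicity⇒eigenvalue {fromℤ z} (subst (HasMultiplicity M (fromℤ z)) eq mult) , mult)
    ; complete    = λ μ eigenvalue → locate {μ} (classify μ eigenvalue)
    }
    where
    locate : ∀ {μ} → (∃ λ s → s ∈ 0ℤ ∷ map l L × μ ≈ fromℤ s) → Any (λ q → μ ≈ proj₁ q) (spectrum (suc p))
    locate (_ , here refl , μ≈) = here μ≈
    locate (s , there s∈ , μ≈)  = there (Any.map⁺ (Any.map (λ { refl → μ≈ }) (∈-deduplicate⁺ ℤ._≟_ s∈)))

  private
    hit : ℤ → ℤ → ℕ
    hit x z = (if does (ι x ℚ.≟ ι z) then 1 else 0) ℕ.* ℤ.∣ z ∣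

    miss : ∀ {x} zs → All (x ≢_) zs → ∑ (hit x) zs ≡ 0
    miss     []       []           = refl
    miss {x} (z ∷ zs) (x≢z ∷ x≢zs) with ι x ℚ.≟ ι z
    ... | yes eq = contradiction (ι-injective eq) x≢z
    ... | no _   = miss zs x≢zs

    once : ∀ {x zs} → AllPairs _≢_ zs → x ∈ zs → ∑ (hit x) zs ≡ ℤ.∣ x ∣
    once {x} {z ∷ zs} (z≢zs ∷ unique) x∈ with ι x ℚ.≟ ι z
    once {x} {z ∷ zs} (z≢zs ∷ unique) (here refl) | yes _ = trans
      (cong₂ ℕ._+_ (ℕ.*-identityˡ ℤ.∣ x ∣) (miss zs z≢zs)) (ℕ.+-identityʳ ℤ.∣ x ∣)
    once {x} {z ∷ zs} (z≢zs ∷ unique) (there x∈)  | yes eq = contradiction (sym (ι-injective eq)) (All.lookup z≢zs x∈)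
    once {x} {z ∷ zs} (z≢zs ∷ unique) (here refl) | no ≢ = contradiction refl ≢
    once {x} {z ∷ zs} (z≢zs ∷ unique) (there x∈)  | no _ = once unique x∈

    matching-∷ : ∀ k L z → length (matching z (k ∷ L)) ℕ.* ℤ.∣ z ∣ ≡ hit (l k) z ℕ.+ length (matching z L) ℕ.* ℤ.∣ z ∣
    matching-∷ k L z with ι (l k) ℚ.≟ ι z
    ... | yes _ = cong (ℕ._+ length (matching z L) ℕ.* ℤ.∣ z ∣) (sym (ℕ.*-identityˡ ℤ.∣ z ∣))
    ... | no _  = refl

    -- Double counting: each eigenvector is counted at exactly one of the distinct values, with the
    -- absolute value of its own eigenvalue.
    ∑-matching : ∀ {zs} → AllPairs _≢_ zs → ∀ L → All (λ k → l k ∈ zs) L →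
                 ∑ (λ z → length (matching z L) ℕ.* ℤ.∣ z ∣) zs ≡ ∑ (ℤ.∣_∣ ∘ l) L
    ∑-matching {zs} unique []      []         = trans (Counting.∑-const 0 zs) (ℕ.*-zeroʳ (length zs))
    ∑-matching {zs} unique (k ∷ L) (lk∈ ∷ l∈) = trans (∑-cong (matching-∷ k L) zs)
      (trans (∑-+ (hit (l k)) (λ z → length (matching z L) ℕ.* ℤ.∣ z ∣) zs)
        (cong₂ ℕ._+_ (once unique lk∈) (∑-matching unique L l∈)))

    contribution : ℝ × ℕ → ℝ → ℝ
    contribution (μ , m) t = fromℕ m * ∣ μ ∣ + t

    ι-product : ∀ m z → ι (+ m) ℚ.* ℚ.∣ ι z ∣ ≡ ι (+ (m ℕ.* ℤ.∣ z ∣))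
    ι-product m z = trans (cong (ι (+ m) ℚ.*_) (ι-∣∣ z)) (trans (sym (ι-* (+ m) (+ ℤ.∣ z ∣))) (cong ι (sym (ℤ.pos-* m ℤ.∣ z ∣))))

    -- The listed eigenvalues are constant sequences, so the energy is computed entrywise in ℚ.
    energy-seq : ∀ (c : ℤ → ℕ) zs n →
      seq (foldr contribution (fromℕ 0) (map (λ z → fromℤ z , c z) zs)) n ≡ ι (+ ∑ (λ z → c z ℕ.* ℤ.∣ z ∣) zs)
    energy-seq c []       n = refl
    energy-seq c (z ∷ zs) n = trans (cong₂ ℚ._+_ (ι-product (c z) z) (energy-seq c zs n))
      (trans (sym (ι-+ (+ (c z ℕ.* ℤ.∣ z ∣)) (+ ∑ (λ z → c z ℕ.* ℤ.∣ z ∣) zs)))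
        (cong ι (sym (ℤ.pos-+ (c z ℕ.* ℤ.∣ z ∣) (∑ (λ z → c z ℕ.* ℤ.∣ z ∣) zs)))))

    energy : ∀ p → fromℕ (∑ (ℤ.∣_∣ ∘ l) L) ≈ foldr contribution (fromℕ 0) (spectrum p)
    energy p = pointwise {fromℕ (∑ (ℤ.∣_∣ ∘ l) L)} {foldr contribution (fromℕ 0) (spectrum p)} λ n → sym (trans
      (cong₂ ℚ._+_ (trans (ι-product p 0ℤ) (cong (λ m → ι (+ m)) (ℕ.*-zeroʳ p)))
        (trans (energy-seq (λ z → length (matching z L)) values n)
          (cong (λ m → ι (+ m)) (∑-matching values-unique L (All.tabulate λ k∈ → ∈-deduplicate⁺ ℤ._≟_ (∈-map⁺ l k∈))))))
      (ℚ.+-identityˡ (ι (+ ∑ (ℤ.∣_∣ ∘ l) L))))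

  integral : ∀ μ → IsEigenvalue M μ → ∃ λ z → μ ≈ fromℤ z
  integral μ eigenvalue = let (z , _ , μ≈z) = classify μ eigenvalue in z , μ≈z

  spectrumEnergy : length L ℕ.< N → ∃ λ s → IsSpectrum M s ×
    fromℕ (∑ (ℤ.∣_∣ ∘ l) L) ≈ foldr (λ (μ , m) t → fromℕ m * ∣ μ ∣ + t) (fromℕ 0) s
  spectrumEnergy L<N = positive nullity
    where
    positive : (∃ λ p → p ℕ.+ length L ≡ N × HasMultiplicity M (fromℕ 0) p) → ∃ λ s → IsSpectrum M s ×
      fromℕ (∑ (ℤ.∣_∣ ∘ l) L) ≈ foldr (λ (μ , m) t → fromℕ m * ∣ μ ∣ + t) (fromℕ 0) s
    -- A zero kernel would mean as many eigenvectors in `L` as there are vertices.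
    positive (zero  , L≡N , _)    = contradiction L<N (ℕ.<-irrefl L≡N)
    positive (suc p , _ , kernel) = spectrum (suc p) , isSpectrum p kernel , energy (suc p)

-- The matrix coefficients as eigenfunctions of the Cayley graph

module CayleySpectrum (d : ℕ) (cycle? : ∀ π → Dec (IsNCycle {suc d} π)) where
  open Sums ℤ.+-*-commutativeRing
  open JucysMurphy
  open GroupSums
  open MatrixCoefficients
  open Counting using (∑; pairs; squares-pairs)
  open ≡.≡-Reasoning

  n : ℕ
  n = suc d

  -- As `∘ₚ` applies its left argument first, the tested permutation is v u⁻¹ for u = `decode n i`
  -- and v = `decode n j`, exactly as in the adjacency test of `Cay`.
  A : Fin (n !) → Fin (n !) → ℤ
  A i j = indicator (cycle? (Perm.flip (decode n i) ∘ₚ decode n j))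

  -- Substituting `u ∘ₚ π` for `π` turns the row of `u` into the indicator of the long cycles.
  row-cycleSum : ∀ {F} → Invariant F → ∀ i → dot (A i) (F ∘ decode n) ≡ cycleSum d (λ σ → F (decode n i ∘ₚ σ))
  row-cycleSum {F} F-inv i = begin
    groupSum n (λ π → indicator (cycle? (Perm.flip u ∘ₚ π)) ℤ.* F π)
      ≡⟨ groupSum-∘ₚˡ n {λ π → indicator (cycle? (Perm.flip u ∘ₚ π)) ℤ.* F π} (λ π ρ π≈ρ → cong₂ ℤ._*_
           (indicator-cong cycle? (Perm.flip u ∘ₚ π) (Perm.flip u ∘ₚ ρ) (λ k → π≈ρ (u ⟨$⟩ˡ k))) (F-inv π ρ π≈ρ)) u ⟩
    groupSum n (λ π → indicator (cycle? (Perm.flip u ∘ₚ (u ∘ₚ π))) ℤ.* F (u ∘ₚ π))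
      ≡⟨ groupSum-cong n (λ π → cong (ℤ._* F (u ∘ₚ π))
           (indicator-cong cycle? (Perm.flip u ∘ₚ (u ∘ₚ π)) π (λ k → cong (π ⟨$⟩ʳ_) (Perm.inverseʳ u)))) ⟩
    groupSum n (λ π → indicator (cycle? π) ℤ.* F (u ∘ₚ π))
      ≡⟨ groupSum-nCycles d cycle? (λ π ρ π≈ρ → F-inv (u ∘ₚ π) (u ∘ₚ ρ) (λ k → π≈ρ (u ⟨$⟩ʳ k))) ⟩
    cycleSum d (λ σ → F (u ∘ₚ σ)) ∎
    where
    u : Permutation′ n
    u = decode n i

  K : Set
  K = Vec Bool d × Vec Bool d

  b : K → Fin (n !) → ℤ
  b (I , J) k = coefficient I J (decode n k)

  l : K → ℤ
  l (I , _) = eigenvalue I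

  b-eigenvector : ∀ k i → dot (A i) (b k) ≡ l k ℤ.* b k i
  b-eigenvector (I , J) i = trans (row-cycleSum (coefficient-invariant I J) i) (coefficient-cycleSum I J (decode n i))

  b-orthogonal : ∀ {k k′} → k ≢ k′ → dot (b k) (b k′) ≡ 0ℤ
  b-orthogonal {I , J} {I′ , J′} k≢k′ with Vec.≡-dec Bool._≟_ I I′
  ... | no I≢I′  = orthogonalˡ I J I′ J′ I≢I′
  ... | yes refl = orthogonalʳ I J I J′ λ { refl → k≢k′ refl }

  b-nonzero : ∀ (k : K) → trues (proj₁ k) ≡ trues (proj₂ k) → ¬ (∀ i → b k i ≡ 0ℤ)
  b-nonzero (I , J) eq null = coefficient-nonzero I J eq λ σ →
    trans (sym (coefficient-invariant I J (decode n (encode n σ)) σ (decode-encode n σ))) (null (encode n σ))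

  cycleSum-one : ∀ d → cycleSum d (λ _ → 1ℤ) ≡ + (d !)
  cycleSum-one zero    = refl
  cycleSum-one (suc d) = begin
    cycleSum d (λ σ → sum {suc d} (λ _ → 1ℤ))  ≡⟨ cycleSum-cong d (λ _ → sum-const (suc d) 1ℤ) ⟩
    cycleSum d (λ σ → + suc d ℤ.* 1ℤ)          ≡⟨ cycleSum-scale d (+ suc d) (λ _ → 1ℤ) ⟩
    + suc d ℤ.* cycleSum d (λ _ → 1ℤ)          ≡⟨ cong (+ suc d ℤ.*_) (cycleSum-one d) ⟩
    + suc d ℤ.* + (d !)                        ≡⟨ ℤ.pos-* (suc d) (d !) ⟨
    + ((suc d) !)                              ∎

  -- The entries are 0 or 1, their own squares, so the norm is the degree of the graph, the number
  -- of long cycles.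
  row-norm : ∀ i → dot (A i) (A i) ≡ + (d !)
  row-norm i = begin
    dot (A i) (A i)            ≡⟨ sum-cong-≋ {n !} (λ j → idempotent (cycle? (Perm.flip (decode n i) ∘ₚ decode n j))) ⟩
    dot (A i) (λ _ → 1ℤ)       ≡⟨ row-cycleSum {λ _ → 1ℤ} (λ _ _ _ → refl) i ⟩
    cycleSum d (λ _ → 1ℤ)      ≡⟨ cycleSum-one d ⟩
    + (d !)                    ∎
    where
    idempotent : ∀ {P : Set} (P? : Dec P) → indicator P? ℤ.* indicator P? ≡ indicator P? ℤ.* 1ℤ
    idempotent (yes _) = refl
    idempotent (no _)  = refl

  sum-squares : ∀ (L : List K) →
    sum (λ t → l (lookup L t) ℤ.* l (lookup L t)) ≡ + ∑ (λ k → ℤ.∣ l k ∣ ℕ.* ℤ.∣ l k ∣) L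
  sum-squares []      = refl
  sum-squares (k ∷ L) = trans (cong₂ ℤ._+_ (square (l k)) (sum-squares L)) (sym (ℤ.pos-+ (ℤ.∣ l k ∣ ℕ.* ℤ.∣ l k ∣) _))
    where
    square : ∀ z → z ℤ.* z ≡ + (ℤ.∣ z ∣ ℕ.* ℤ.∣ z ∣)
    square (+ m)    = sym (ℤ.pos-* m m)
    square -[1+ m ] = refl

  frobenius≡ : sum (λ i → dot (A i) (A i)) ≡ sum (λ t → l (lookup (pairs d) t) ℤ.* l (lookup (pairs d) t))
  frobenius≡ = begin
    sum (λ i → dot (A i) (A i))          ≡⟨ sum-cong-≋ {n !} row-norm ⟩
    sum {n !} (λ _ → + (d !))            ≡⟨ sum-const (n !) (+ (d !)) ⟩
    + (n !) ℤ.* + (d !)                  ≡⟨ ℤ.pos-* (n !) (d !) ⟨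
    + (n ! ℕ.* d !)                      ≡⟨ cong +_ (squares-pairs d) ⟨
    + ∑ (λ k → ℤ.∣ l k ∣ ℕ.* ℤ.∣ l k ∣) (pairs d)  ≡⟨ sum-squares (pairs d) ⟨
    sum (λ t → l (lookup (pairs d) t) ℤ.* l (lookup (pairs d) t)) ∎

-- From an inequality of naturals to a strict inequality of reals

open import Data.Nat.Base using (_∸_; _*_; _^_; _≤_; _<_)

module _ where
  open Rationals using (ι; ι-+; ι-mono-≤)

  exceeds : ∀ m k → 2 * m ≤ k → Defs._<_ (fromℤ (+ 2 ℤ.* + m ℤ.- + 2)) (fromℕ k)
  -- The gap 1 is available because 2m - 2 + 1 ≤ 2m ≤ k.
  exceeds m k 2m≤k = 1ℚ , ℚ.positive⁻¹ 1ℚ , 0 , λ _ _ →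
    subst (ℚ._≤ ι (+ k)) (ι-+ (+ 2 ℤ.* + m ℤ.- + 2) 1ℤ) (ι-mono-≤ bound)
    where
    bound : + 2 ℤ.* + m ℤ.- + 2 ℤ.+ 1ℤ ℤ.≤ + k
    bound = begin
      + 2 ℤ.* + m ℤ.- + 2 ℤ.+ 1ℤ     ≡⟨ ℤ.+-assoc (+ 2 ℤ.* + m) (ℤ.- + 2) 1ℤ ⟩
      + 2 ℤ.* + m ℤ.+ ℤ.-1ℤ          ≤⟨ ℤ.+-monoʳ-≤ (+ 2 ℤ.* + m) ℤ.-≤+ ⟩
      + 2 ℤ.* + m ℤ.+ 0ℤ             ≡⟨ ℤ.+-identityʳ _ ⟩
      + 2 ℤ.* + m                    ≡⟨ ℤ.pos-* 2 m ⟨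
      + (2 * m)                      ≤⟨ ℤ.+≤+ 2m≤k ⟩
      + k                            ∎
      where open ℤ.≤-Reasoning

-- The graph of n-cycles: integrality, energy, nullity

module NCycleGraph (d : ℕ) (4≤n : 4 ≤ suc d) where
  open Counting using (pairs; pairs-unique; pairs-trues; length-pairs; energy-pairs; eigenvalue≢0)

  private
    3≤d : ∃ λ e → 3 ℕ.+ e ≡ d
    3≤d = ℕ.m≤n⇒∃[o]m+o≡n (ℕ.s≤s⁻¹ 4≤n)

    few : (2 * d) C d < (suc d) !
    few = let (e , eq) = 3≤d in subst (λ d → (2 * d) C d < (suc d) !) eq (Counting.central-binomial<factorial e)

    large : 2 * suc d ≤ 2 ^ d
    large = let (e , eq) = 3≤d in subst (λ d → 2 * suc d ≤ 2 ^ d) eq (Counting.double≤power e)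

    cycle? : ∀ π → Dec (IsNCycle {suc d} π)
    cycle? = ConnectionSet.S? (nCycles (suc d) (ℕ.≤-trans (s≤s (s≤s z≤n)) 4≤n))

    open CayleySpectrum d cycle? hiding (n)

    adjacency≡ : ∀ i j → SimpleGraph.adjacencyMatrix (Γ (suc d) 4≤n) i j ≡ fromℤ (A i j)
    adjacency≡ i j = sym (Bool.if-float fromℤ (does (cycle? (Perm.flip (decode (suc d) i) ∘ₚ decode (suc d) j))))

    module Spectrum = IntegerSpectrum {SimpleGraph.order (Γ (suc d) 4≤n)} b l (pairs d) A
      (AllPairs.map b-orthogonal (pairs-unique d))
      (All.map (λ {k} → b-nonzero k) (pairs-trues d))
      (All.universal b-eigenvector (pairs d))
      (All.universal (λ k → eigenvalue≢0 (proj₁ k)) (pairs d))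
      frobenius≡ (SimpleGraph.adjacencyMatrix (Γ (suc d) 4≤n)) adjacency≡

  integral : IsIntegral (Γ (suc d) 4≤n)
  integral = Spectrum.integral

  hasEnergy : HasEnergy (Γ (suc d) 4≤n) (fromℕ (2 ^ (suc d ∸ 1) * (suc d ∸ 1) !))
  hasEnergy = subst (λ E → HasEnergy (Γ (suc d) 4≤n) (fromℕ E)) (energy-pairs d)
    (Spectrum.spectrumEnergy (subst (_< (suc d) !) (sym (length-pairs d)) few))

  hyperenergetic : IsHyperenergetic (Γ (suc d) 4≤n)
  hyperenergetic = fromℕ (2 ^ d * d !) , hasEnergy , exceeds (SimpleGraph.order (Γ (suc d) 4≤n)) (2 ^ d * d !)
    -- Twice the order is 2 (d + 1) d!, and 2 (d + 1) ≤ 2^d.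
    (ℕ.≤-trans (ℕ.≤-reflexive (sym (ℕ.*-assoc 2 (suc d) (d !)))) (ℕ.*-monoˡ-≤ (d !) large))

  hasNullity : ∃[ η ] (HasNullity (Γ (suc d) 4≤n) η × + η ≡ + ((suc d) !) ℤ.- + ((2 * suc d ∸ 2) C (suc d ∸ 1)))
  hasNullity = let (p , eq , mult) = Spectrum.nullity in p , mult , (begin
    + p                                                 ≡⟨ ℤ.+-identityʳ (+ p) ⟨
    + p ℤ.+ 0ℤ                                          ≡⟨ cong (λ t → + p ℤ.+ t) (ℤ.+-inverseʳ (+ M)) ⟨
    + p ℤ.+ (+ M ℤ.- + M)                               ≡⟨ ℤ.+-assoc (+ p) (+ M) (ℤ.- + M) ⟨
    + p ℤ.+ + M ℤ.- + M                                 ≡⟨ cong (ℤ._- + M) (ℤ.pos-+ p M) ⟨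
    + (p ℕ.+ M) ℤ.- + M                                 ≡⟨ cong₂ (λ s t → + s ℤ.- + t) eq M≡ ⟩
    + ((suc d) !) ℤ.- + ((2 * suc d ∸ 2) C (suc d ∸ 1)) ∎)
    where
    open ≡.≡-Reasoning
    M : ℕ
    M = length (pairs d)
    M≡ : M ≡ (2 * suc d ∸ 2) C (suc d ∸ 1)
    M≡ = trans (length-pairs d) (cong (λ m → (m ∸ 2) C d) (sym (ℕ.*-suc 2 d)))

theorem1p1 : (n : ℕ) (4≤n : 4 ≤ n) →
    IsIntegral (Γ n 4≤n)
    × IsHyperenergetic (Γ n 4≤n)
    × HasEnergy (Γ n 4≤n) (fromℕ (2 ^ (n ∸ 1) * (n ∸ 1) !))
    × (∃[ η ] (HasNullity (Γ n 4≤n) η × + η ≡ + (n !) ℤ.- + ((2 * n ∸ 2) C (n ∸ 1))))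
theorem1p1 (suc d) 4≤n = integral , hyperenergetic , hasEnergy , hasNullity
  where open NCycleGraph d 4≤n
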